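{- Let $Y$ be the affine curve (of genus 5) over $\mathbb{Q}$ in coordinates $(q,y,z)$ defined by \[ y^2 = (5q^2-1)(q^2+3), \qquad z^2 = 5q^4-8q^3+6q^2+8q+5. \] Then $Y(\mathbb{Q},2) = Y(\mathbb{Q}) = \{(\pm1,\pm4,\pm4)\}$.
   Context: For a curve $X$ defined over $\mathbb{Q}$, $X(\mathbb{Q},2)$ denotes the set of points $P \in X(\overline{\mathbb{Q}})$ with $[\mathbb{Q}(P):\mathbb{Q}] \le 2$. Sign choices are independent. -}

module Defs where

open import Data.Integer using (ℤ; +_; -[1+_])
open import Data.Rational using (ℚ; _+_; _*_; _-_; -_; _/_; 0ℚ)
open import Data.Product using (_×_; ∃; _,_)
open import Data.Sum using (_⊎_)
open import Relation.Binary.PropositionalEquality using (_≡_; _≢_)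
open import Relation.Nullary using (¬_)

κ : ℤ → ℚ
κ z = z / 1

-- d is not a square in ℚ, so ℚ(√d) = ℚ[t]/(t² - d) is a quadratic field
NonSquare : ℚ → Set
NonSquare d = ∀ (r : ℚ) → r * r ≢ d

-- element a + b√d of ℚ(√d), represented by its coordinates (a , b)
record QF (d : ℚ) : Set where
  constructor _+√_
  field
    re : ℚ
    im : ℚ
open QF public

module QFArith (d : ℚ) where
  infixl 6 _⊕_ _⊖_
  infixl 7 _⊗_
  _⊕_ : QF d → QF d → QF d
  (a +√ b) ⊕ (c +√ e) = (a + c) +√ (b + e)
  _⊖_ : QF d → QF d → QF d
  (a +√ b) ⊖ (c +√ e) = (a - c) +√ (b - e)
  _⊗_ : QF d → QF d → QF d
  (a +√ b) ⊗ (c +√ e) = (a * c + d * (b * e)) +√ (a * e + b * c)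
  ι : ℚ → QF d
  ι a = a +√ 0ℚ
  k : ℤ → QF d
  k z = ι (κ z)

OnY : (d : ℚ) → QF d → QF d → QF d → Set
OnY d q y z =
  (y ⊗ y ≡ (k (+ 5) ⊗ q ⊗ q ⊖ k (+ 1)) ⊗ (q ⊗ q ⊕ k (+ 3)))
  × (z ⊗ z ≡ k (+ 5) ⊗ q ⊗ q ⊗ q ⊗ q ⊖ k (+ 8) ⊗ q ⊗ q ⊗ q
             ⊕ k (+ 6) ⊗ q ⊗ q ⊕ k (+ 8) ⊗ q ⊕ k (+ 5))
  where open QFArith d

IsPM : ℚ → ℚ → Set
IsPM a x = (x ≡ a) ⊎ (x ≡ - a)

IsListedPoint : ℚ → ℚ → ℚ → Set
IsListedPoint q y z = IsPM (κ (+ 1)) q × IsPM (κ (+ 4)) y × IsPM (κ (+ 4)) z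

{-# OPTIONS --safe #-}
-- Let f₁ = (5q² − 1)(q² + 3) and f₂ = 5q⁴ − 8q³ + 6q² + 8q + 5.  The curves y² = f₁ and z² = f₂ have Jacobians of
-- rank 0, of conductor 15 and 17.  Mapping to a curve with full rational 2-torsion and doubling there turns a rational
-- point into a pair of numbers for which w² + x² and w² + 16x² (respectively w² + x² and w² − 16x²) are both squares;
-- Fermat's descent shows that these are degenerate, so the rational points lie over q = ±1.
--
-- If q is rational but y and z are not, they are rational multiples of √d and f₁ f₂ is a square.  The resultant of f₁ and f₂
-- has no prime factors besides 2 and 5, and f₁ turns out to be a square or five times a square.  The latter leads to
-- w² + 5x² and w² + 80x² both being squares, which a third descent excludes.
--
-- If q is irrational, the parabola through (q , y), its conjugate and (1 , 4) meets y² = f₁ in a fourth point, which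
-- is rational and hence known.  So the minimal polynomial of q lies in one of three one-parameter families.
-- The same holds for f₂, and the families for f₁ and f₂ share no irreducible polynomial.
module Submission where

open import Defs
open import Data.Rational using (ℚ; 0ℚ)
open import Data.Product using (_×_; ∃; ∃₂; _,_; proj₁; proj₂)
open import Relation.Binary.PropositionalEquality using (_≡_; _≢_; refl; sym; trans; cong; cong₂; subst; subst₂)
open import Function.Bundles using (_⇔_; mk⇔)
open import Function using (_∘_; case_of_)
open import Data.Sum using (_⊎_; inj₁; inj₂)
import Data.Sum
open import Data.Empty using (⊥; ⊥-elim)
open import Data.Unit using (⊤; tt)
open import Data.Bool using (Bool; true; false; _∧_; _∨_; not; T; _xor_; if_then_else_)
open import Data.Fin using (Fin)
open import Data.Fin.Patterns using (0F; 1F; 2F; 3F)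
open import Data.List using (List; []; _∷_)
open import Data.Vec using (Vec; []; _∷_; lookup; map)
open import Data.Vec.Properties using (lookup-map)
import Data.Nat as ℕ
open ℕ using (ℕ; zero; suc)
import Data.Nat.Properties as ℕₚ
open import Data.Nat.Divisibility using (_∣_; _∣?_; divides; ∣-trans; ∣-antisym; ∣-refl; ∣⇒≤; *-cancelʳ-∣;
        *-cancelˡ-∣; ∣m+n∣m⇒∣n; ∣m∣n⇒∣m+n; m∣m*n; n∣m*n; *-monoˡ-∣; *-pres-∣; ∣n⇒∣m*n; ∣m⇒∣m*n; 0∣⇒≡0; m%n≡0⇒n∣m)
open import Data.Nat.GCD using (gcd; gcd[m,n]∣m; gcd[m,n]∣n; gcd[m,n]≢0; gcd-greatest)
import Data.Nat.Coprimality as Coprimality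
open Coprimality using (Coprime; coprime-divisor)
open import Data.Nat.Primality using (Prime; prime?; euclidsLemma; prime⇒irreducible)
import Data.Nat.Tactic.RingSolver as ℕ-Solver
open import Relation.Nullary using (¬_; yes; no; Dec)
open import Relation.Nullary.Decidable using (from-yes; does; dec⇒maybe)

-- On a cubic with full rational 2-torsion, the abscissa of a double differs from each 2-torsion
-- abscissa by a square. So no group law or rank enters: what remains is a pair of diagonal
-- equations in `v`, `w`, `u`, `x`. In each descent the differences of any two of v², w², u² are
-- multiples of x² and split into coprime halves; two of the splittings give A, A′, B, B′, and the
-- half-sum belonging to the third is a quadratic form in these in two ways. Only its square class
-- is open; if it is trivial, (AB , AA′) is a smaller solution, because AA′ = x/2. For irrational q
-- with minimal polynomial m, the parabola is αt + β + γm(t). Both quartics have leading coefficient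
-- 5 and value 16 at ±1, so they are members of one family and one computation serves both. The
-- residual quadratic has leading coefficient 5 - γ², nonzero as √5 is irrational: the fourth point
-- is never at infinity. The resulting families are compared through m(1) and m(-1), which are
-- nonzero norms. A common member would make one of them vanish or contradict a numerical identity.

module Descent where

  open import Data.Nat using (ℕ; zero; suc; _+_; _*_; _≤_; _<_; _/_; _%_; _≡ᵇ_; NonZero; z≤n; s≤s; ≢-nonZero; _≤?_)
  open import Data.Nat.DivMod using (%-distribˡ-+; %-distribˡ-*; m%n<n; m%n%n≡m%n; m≡m%n+[m/n]*n)
  open import Data.Nat.Induction using (<-rec)
  open import Data.Nat.Tactic.RingSolver using (solve-∀)

  -- Coprime factorisations of squares

  gcd-split : ∀ m n → m ≢ 0 → ∃ λ g → ∃₂ λ m′ n′ → g ≢ 0 × m ≡ m′ * g × n ≡ n′ * g × Coprime m′ n′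
  gcd-split m n m≢0 with gcd[m,n]∣m m n | gcd[m,n]∣n m n | gcd[m,n]≢0 m n (inj₁ m≢0)
  ... | divides m′ m≡ | divides n′ n≡ | g≢0 =
    gcd m n , m′ , n′ , g≢0 , m≡ , n≡ , cop
    where
    instance _ = ≢-nonZero g≢0
    cop : Coprime m′ n′
    cop {d} (d∣m′ , d∣n′) = ℕₚ.m*n≡1⇒m≡1 d _ (sym (proj₂ one))
      where
      dg∣g : d * gcd m n ∣ gcd m n
      dg∣g = gcd-greatest (subst (d * gcd m n ∣_) (sym m≡) (*-monoˡ-∣ (gcd m n) d∣m′))
                          (subst (d * gcd m n ∣_) (sym n≡) (*-monoˡ-∣ (gcd m n) d∣n′))
      one : ∃ λ q → 1 ≡ d * q
      one with *-cancelʳ-∣ {d} {1} (gcd m n) (subst (d * gcd m n ∣_) (sym (ℕₚ.*-identityˡ _)) dg∣g)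
      ... | divides q 1≡qd = q , trans 1≡qd (ℕₚ.*-comm q d)

  m*m≡0⇒m≡0 : ∀ m → m * m ≡ 0 → m ≡ 0
  m*m≡0⇒m≡0 zero _ = refl

  private
    square-scale : ∀ a g → (a * g) * (a * g) ≡ (a * a) * (g * g)
    square-scale = solve-∀

  -- Dividing out the gcd leaves coprime m′ and n′ with m′² ∣ n′². Then m′ divides n′ as well, so it
  -- is 1.
  ∣-from-squares : ∀ m n → m * m ∣ n * n → m ∣ n
  ∣-from-squares zero n d = subst (0 ∣_) (sym (m*m≡0⇒m≡0 n (0∣⇒≡0 d))) ∣-refl
  ∣-from-squares m@(suc _) n d with gcd-split m n (λ ())
  ... | g , m′ , n′ , g≢0 , m≡ , n≡ , cop = divides n′ (trans n≡ (cong (n′ *_) (sym m≡g)))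
    where
    instance _ = ≢-nonZero g≢0
    instance _ = ℕₚ.m*n≢0 g g
    d′ : m′ * m′ ∣ n′ * n′
    d′ = *-cancelʳ-∣ (g * g)
           (subst₂ _∣_ (trans (cong₂ _*_ m≡ m≡) (square-scale m′ g))
                       (trans (cong₂ _*_ n≡ n≡) (square-scale n′ g)) d)
    m′≡1 : m′ ≡ 1
    m′≡1 = cop (∣-refl , coprime-divisor cop (∣-trans (m∣m*n m′) d′))
    m≡g : m ≡ g
    m≡g = trans m≡ (trans (cong (_* g) m′≡1) (ℕₚ.*-identityˡ g))

  square-injective : ∀ {m n} → m * m ≡ n * n → m ≡ n
  square-injective {m} {n} e =
    ∣-antisym (∣-from-squares m n (subst (m * m ∣_) e ∣-refl))
              (∣-from-squares n m (subst (n * n ∣_) (sym e) ∣-refl))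

  coprime-restrict : ∀ {d m n} → Coprime m n → d ∣ m → Coprime d n
  coprime-restrict c d∣m (e∣d , e∣n) = c (∣-trans e∣d d∣m , e∣n)

  coprime-* : ∀ {m n o} → Coprime m n → Coprime m o → Coprime m (n * o)
  coprime-* c₁ c₂ (d∣m , d∣no) = c₂ (d∣m , coprime-divisor (coprime-restrict c₁ d∣m) d∣no)

  coprime-squares : ∀ {m n} → Coprime m n → Coprime (m * m) (n * n)
  coprime-squares c = Coprimality.sym (coprime-* s s)
    where s = Coprimality.sym (coprime-* c c)

  -- No prime factorisation is needed: put g = gcd(a, n), a = a′g, n = n′g, so that a′b = n′²g.
  -- Being coprime to n′, a′ divides g; being a divisor of a, g is coprime to b and divides a′.
  -- Hence a = g².
  square-factor : ∀ {a b n} → Coprime a b → a * b ≡ n * n → ∃ λ s → a ≡ s * s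
  square-factor {zero} _ _ = 0 , refl
  square-factor {a@(suc _)} {b} {n} cop e with gcd-split a n (λ ())
  ... | g , a′ , n′ , g≢0 , a≡ , n≡ , cop′ = g , trans a≡ (cong (_* g) (∣-antisym a′∣g g∣a′))
    where
    instance _ = ≢-nonZero g≢0
    e′ : a′ * b ≡ n′ * (n′ * g)
    e′ = ℕₚ.*-cancelʳ-≡ (a′ * b) (n′ * (n′ * g)) g
           (trans (l a′ g b) (trans (cong (_* b) (sym a≡)) (trans e (trans (cong₂ _*_ n≡ n≡) (r n′ g)))))
      where
      l : ∀ a g b → a * b * g ≡ a * g * b
      l = solve-∀
      r : ∀ n g → n * g * (n * g) ≡ n * (n * g) * g
      r = solve-∀
    a′∣g : a′ ∣ g
    a′∣g = coprime-divisor cop′ (coprime-divisor cop′ (subst (a′ ∣_) e′ (m∣m*n b)))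
    g∣a′ : g ∣ a′
    g∣a′ = coprime-divisor (coprime-restrict cop (subst (g ∣_) (sym a≡) (n∣m*n a′)))
             (subst (g ∣_) (ℕₚ.*-comm a′ b) (subst (g ∣_) (sym e′) (∣n⇒∣m*n n′ (n∣m*n n′))))

  square-factors : ∀ {a b n} → Coprime a b → a * b ≡ n * n →
                   ∃₂ λ s t → a ≡ s * s × b ≡ t * t × s * t ≡ n
  square-factors {a} {b} {n} cop e
    with square-factor {n = n} cop e | square-factor {b} {a} {n} (Coprimality.sym cop) (trans (ℕₚ.*-comm b a) e)
  ... | s , refl | t , refl = s , t , refl , refl , square-injective (trans (square-scale s t) e)

  prime-split : ∀ {p a b M} → Prime p → .{{NonZero p}} → a * b ≡ p * M →
                (∃ λ a′ → a ≡ p * a′ × a′ * b ≡ M) ⊎ (∃ λ b′ → b ≡ p * b′ × a * b′ ≡ M)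
  prime-split {p} {a} {b} {M} pp e with euclidsLemma a b pp (subst (p ∣_) (sym e) (m∣m*n M))
  ... | inj₁ (divides a′ refl) = inj₁ (a′ , ℕₚ.*-comm a′ p , ℕₚ.*-cancelˡ-≡ (a′ * b) M p (trans (l p a′ b) e))
    where
    l : ∀ p a b → p * (a * b) ≡ a * p * b
    l = solve-∀
  ... | inj₂ (divides b′ refl) = inj₂ (b′ , ℕₚ.*-comm b′ p , ℕₚ.*-cancelˡ-≡ (a * b′) M p (trans (l p a b′) e))
    where
    l : ∀ p a b → p * (a * b) ≡ a * (b * p)
    l = solve-∀

  prime-square-factors : ∀ {p a b n} → Prime p → .{{NonZero p}} → Coprime a b → a * b ≡ p * (n * n) →
    (∃₂ λ s t → a ≡ p * (s * s) × b ≡ t * t × s * t ≡ n) ⊎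
    (∃₂ λ s t → a ≡ s * s × b ≡ p * (t * t) × s * t ≡ n)
  prime-square-factors {p} {a} {b} {n} pp cop e with prime-split {p} {a} {b} pp e
  ... | inj₁ (a′ , refl , e′) with square-factors {n = n} (coprime-restrict cop (n∣m*n p)) e′
  ...   | s , t , refl , refl , st = inj₁ (s , t , refl , refl , st)
  prime-square-factors {p} {a} {b} {n} pp cop e | inj₂ (b′ , refl , e′)
    with square-factors {n = n} (Coprimality.sym (coprime-restrict (Coprimality.sym cop) (n∣m*n p))) e′
  ...   | s , t , refl , refl , st = inj₂ (s , t , refl , refl , st)

  -- d² divides X² - Y² = kZ², and d, a divisor of Y, is coprime to Z. This bounds the common
  -- factors of the halves in the descents, where k is squarefree up to a small correction.
  common-divisor² : ∀ {X Y Z k d} → X * X ≡ Y * Y + k * (Z * Z) → Coprime Y Z → d ∣ X → d ∣ Y → d * d ∣ k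
  common-divisor² {X} {Y} {Z} {k} {d} e cop d∣X d∣Y =
    coprime-divisor (coprime-squares (coprime-restrict cop d∣Y))
      (subst (d * d ∣_) (ℕₚ.*-comm k (Z * Z))
        (∣m+n∣m⇒∣n (subst (d * d ∣_) e (*-pres-∣ d∣X d∣X)) (*-pres-∣ d∣Y d∣Y)))

  coprime-step : ∀ {v w x k} → v * v ≡ w * w + k * (x * x) → Coprime w x → Coprime v x
  coprime-step {v} {w} {x} {k} e cop {d} (d∣v , d∣x) =
    Coprimality.sym (coprime-* (Coprimality.sym cop) (Coprimality.sym cop))
      (∣m+n∣m⇒∣n (subst (d ∣_) (trans e (ℕₚ.+-comm (w * w) _)) (∣m⇒∣m*n v d∣v)) (∣n⇒∣m*n k (∣m⇒∣m*n x d∣x)) , d∣x)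

  cancel-combination : ∀ {L R P Q} → P ≡ Q → L + P ≡ R + Q → L ≡ R
  cancel-combination {L} {R} {P} refl e = ℕₚ.+-cancelʳ-≡ P L R e

  -- Congruence checks by evaluation

  below : ℕ → (ℕ → Bool) → Bool
  below zero f = true
  below (suc k) f = if f k then below k f else false

  below-sound : ∀ k f → below k f ≡ true → ∀ {i} → i < k → f i ≡ true
  below-sound (suc k) f e {i} (s≤s i≤k) with f k in eq
  ... | true with ℕₚ.m≤n⇒m<n∨m≡n i≤k
  ...   | inj₁ i<k = below-sound k f e i<k
  ...   | inj₂ refl = eq

  -- Congruence obstructions, decided by running through all residue vectors.

  infixl 7 _⊞_
  infixl 8 _⊠_
  infix 6 _≗_

  data Expr (n : ℕ) : Set where
    var : Fin n → Expr n
    lit : ℕ → Expr n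
    _⊞_ _⊠_ : Expr n → Expr n → Expr n

  record Equation (n : ℕ) : Set where
    constructor _≗_
    field
      lhs rhs : Expr n

  eval : ∀ {n} → Vec ℕ n → Expr n → ℕ
  eval ρ (var i) = lookup ρ i
  eval ρ (lit c) = c
  eval ρ (e ⊞ f) = eval ρ e + eval ρ f
  eval ρ (e ⊠ f) = eval ρ e * eval ρ f

  -- The singleton clause avoids a trailing `⊤`, so that a single equation is its own proof and two
  -- equations are a plain pair.
  Holds : ∀ {n} → Vec ℕ n → List (Equation n) → Set
  Holds ρ [] = ⊤
  Holds ρ ((e ≗ f) ∷ []) = eval ρ e ≡ eval ρ f
  Holds ρ ((e ≗ f) ∷ es@(_ ∷ _)) = eval ρ e ≡ eval ρ f × Holds ρ es

  module Mod (m : ℕ) .{{_ : NonZero m}} where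

    residues : ∀ {n} → Vec ℕ n → Vec ℕ n
    residues = map (_% m)

    eval-residues : ∀ {n} (ρ : Vec ℕ n) e → eval (residues ρ) e % m ≡ eval ρ e % m
    eval-residues ρ (var i) = trans (cong (_% m) (lookup-map i (_% m) ρ)) (m%n%n≡m%n (lookup ρ i) m)
    eval-residues ρ (lit c) = refl
    eval-residues ρ (e ⊞ f) =
      trans (%-distribˡ-+ (eval (residues ρ) e) _ m)
        (trans (cong₂ (λ a b → (a + b) % m) (eval-residues ρ e) (eval-residues ρ f))
          (sym (%-distribˡ-+ (eval ρ e) _ m)))
    eval-residues ρ (e ⊠ f) =
      trans (%-distribˡ-* (eval (residues ρ) e) _ m)
        (trans (cong₂ (λ a b → (a * b) % m) (eval-residues ρ e) (eval-residues ρ f))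
          (sym (%-distribˡ-* (eval ρ e) _ m)))

    holdsᵇ : ∀ {n} → Vec ℕ n → List (Equation n) → Bool
    holdsᵇ r [] = true
    holdsᵇ r ((e ≗ f) ∷ es) = if eval r e % m ≡ᵇ eval r f % m then holdsᵇ r es else false

    holdsᵇ-sound : ∀ {n} (ρ : Vec ℕ n) es → Holds ρ es → holdsᵇ (residues ρ) es ≡ true
    holdsᵇ-sound ρ [] _ = refl
    holdsᵇ-sound ρ ((e ≗ f) ∷ es) h
      with eval (residues ρ) e % m ≡ᵇ eval (residues ρ) f % m
         | ℕₚ.≡⇒≡ᵇ (eval (residues ρ) e % m) (eval (residues ρ) f % m)
             (trans (eval-residues ρ e) (trans (cong (_% m) (head es h)) (sym (eval-residues ρ f))))
      where
      head : ∀ es → Holds ρ ((e ≗ f) ∷ es) → eval ρ e ≡ eval ρ f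
      head [] h = h
      head (_ ∷ _) (h , _) = h
    ... | true | _ = holdsᵇ-sound ρ es (tail es h)
      where
      tail : ∀ es → Holds ρ ((e ≗ f) ∷ es) → Holds ρ es
      tail [] _ = tt
      tail (_ ∷ _) (_ , h) = h

    everywhere : ∀ n → (Vec ℕ n → Bool) → Bool
    everywhere zero f = f []
    everywhere (suc n) f = below m (λ k → everywhere n (f ∘ (k ∷_)))

    everywhere-sound : ∀ {n} f → everywhere n f ≡ true → ∀ (ρ : Vec ℕ n) → f (residues ρ) ≡ true
    everywhere-sound f e [] = e
    everywhere-sound f e (a ∷ ρ) = everywhere-sound _ (below-sound m _ e (m%n<n a m)) ρ

    implies : Bool → Bool → Bool
    implies a b = if a then b else true

    -- The check is `refl` at every use: evaluation runs over all residue vectors. `pre` stands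
    -- outermost so that vectors violating it are discarded before any equation is evaluated.
    consequence : ∀ n (es : List (Equation n)) (pre post : Vec ℕ n → Bool) →
      everywhere n (λ r → implies (pre r) (implies (holdsᵇ r es) (post r))) ≡ true →
      ∀ (ρ : Vec ℕ n) → T (pre (residues ρ)) → Holds ρ es → T (post (residues ρ))
    consequence n es pre post c ρ p h
      with everywhere-sound (λ r → implies (pre r) (implies (holdsᵇ r es) (post r))) c ρ | holdsᵇ-sound ρ es h
    ... | e | h′ with pre (residues ρ) | p | holdsᵇ (residues ρ) es | h′
    ...   | true | _ | true | refl = subst T (sym e) tt

  open Mod using (consequence)

  -- Parity and squarefree constants

  oddᵇ : ℕ → Bool
  oddᵇ r = r % 2 ≡ᵇ 1

  -- Read off the residue modulo 8, so that congruence checks modulo 8 see it.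
  record Odd (n : ℕ) : Set where
    constructor odd
    field
      residue : T (oddᵇ (n % 8))
  open Odd public

  _,ᵀ_ : ∀ {a b} → T a → T b → T (a ∧ b)
  _,ᵀ_ {true} {true} _ _ = tt

  infixr 4 _,ᵀ_

  halves : ∀ n → (∃ λ k → n ≡ 2 * k) ⊎ (∃ λ k → n ≡ 1 + 2 * k)
  halves zero = inj₁ (0 , refl)
  halves (suc n) with halves n
  ... | inj₁ (k , refl) = inj₂ (k , refl)
  ... | inj₂ (k , refl) = inj₁ (suc k , cong suc (sym (ℕₚ.+-suc k (k + 0))))

  even-or-odd : ∀ n → (∃ λ k → n ≡ 2 * k) ⊎ Odd n
  even-or-odd n with halves n
  ... | inj₁ e = inj₁ e
  ... | inj₂ (k , e) = inj₂ (odd (consequence 8 2 (var 0F ≗ lit 1 ⊞ lit 2 ⊠ var 1F ∷ [])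
          (λ _ → true) (λ { (n ∷ _ ∷ []) → oddᵇ n }) refl (n ∷ k ∷ []) tt e))

  odd-*⁻ : ∀ {a b} → Odd (a * b) → Odd a × Odd b
  odd-*⁻ {a} {b} o = f a b o , f b a (subst Odd (ℕₚ.*-comm a b) o)
    where
    f : ∀ a b → Odd (a * b) → Odd a
    f a b (odd o) = odd (consequence 8 3 (var 0F ≗ var 1F ⊠ var 2F ∷ [])
      (λ { (c ∷ _) → oddᵇ c }) (λ { (_ ∷ a ∷ _) → oddᵇ a }) refl (a * b ∷ a ∷ b ∷ []) o refl)

  odd-* : ∀ {a b} → Odd a → Odd b → Odd (a * b)
  odd-* {a} {b} (odd oa) (odd ob) = odd (consequence 8 3 (var 0F ≗ var 1F ⊠ var 2F ∷ [])
      (λ { (_ ∷ a ∷ b ∷ []) → oddᵇ a ∧ oddᵇ b }) (λ { (c ∷ _) → oddᵇ c }) refl (a * b ∷ a ∷ b ∷ []) (oa ,ᵀ ob) refl)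

  odd-even-⊥ : ∀ {n} → Odd n → 2 ∣ n → ⊥
  odd-even-⊥ o (divides q refl) with proj₂ (odd-*⁻ {q} {2} o)
  ... | odd ()

  odd-divisor : ∀ {d n} → Odd n → d ∣ n → Odd d
  odd-divisor o (divides q refl) = proj₂ (odd-*⁻ {q} o)

  coprime-2 : ∀ {n} → Odd n → Coprime n 2
  coprime-2 o {zero} (_ , divides q e) = case trans e (ℕₚ.*-zeroʳ q) of λ ()
  coprime-2 o {suc zero} _ = refl
  coprime-2 o {suc (suc zero)} (2∣n , _) = ⊥-elim (odd-even-⊥ o 2∣n)
  coprime-2 o {suc (suc (suc d))} (_ , d∣2) = case ∣⇒≤ d∣2 of λ { (s≤s (s≤s ())) }

  coprime-4 : ∀ {n} → Odd n → Coprime n 4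
  coprime-4 o = coprime-* (coprime-2 o) (coprime-2 o)

  -- For a numeral `k` this is settled by evaluation, since d ≤ d² ≤ k leaves finitely many
  -- candidates.
  squarefree : ∀ k → .{{_ : NonZero k}} → below (suc k) (λ d → if does (d * d ∣? k) then d ≡ᵇ 1 else true) ≡ true →
               ∀ {d} → d * d ∣ k → d ≡ 1
  squarefree k c {d} dd∣k
    with d * d ∣? k | below-sound (suc k) _ c {d} (s≤s (ℕₚ.≤-trans (d≤d*d d) (∣⇒≤ dd∣k)))
    where
    d≤d*d : ∀ d → d ≤ d * d
    d≤d*d zero = z≤n
    d≤d*d (suc d) = ℕₚ.m≤m*n (suc d) (suc d)
  ... | yes _ | e = ℕₚ.≡ᵇ⇒≡ d 1 (subst T (sym e) tt)
  ... | no ¬p | _ = ⊥-elim (¬p dd∣k)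

  -- Differences of squares and their coprime halves

  Square : ℕ → Set
  Square n = ∃ λ r → r * r ≡ n

  square-descale : ∀ {g} n → g ≢ 0 → ∀ r → r * r ≡ n * (g * g) → ∃ λ s → r ≡ s * g × s * s ≡ n
  square-descale {g} n g≢0 r e with ∣-from-squares g r (divides n e)
  ... | divides s refl = s , refl , ℕₚ.*-cancelʳ-≡ (s * s) n (g * g) (trans (l s g) e)
    where
    instance _ = ≢-nonZero g≢0
    instance _ = ℕₚ.m*n≢0 g g
    l : ∀ s g → s * s * (g * g) ≡ s * g * (s * g)
    l = solve-∀

  odd-gap : ∀ {v w s} → Odd v → Odd w → v * v ≡ w * w + s → ∃ λ a → v ≡ w + 2 * a
  odd-gap {v} {w} {s} (odd ov) (odd ow) e with w ≤? v
  ... | no w≰v = ⊥-elim (ℕₚ.<⇒≱ (ℕₚ.*-mono-< (ℕₚ.≰⇒> w≰v) (ℕₚ.≰⇒> w≰v)) (subst (w * w ≤_) (sym e) (ℕₚ.m≤m+n _ s)))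
  ... | yes w≤v with ℕₚ.m≤n⇒∃[o]m+o≡n w≤v
  ...   | c , refl with even-or-odd c
  ...     | inj₁ (a , refl) = a , refl
  ...     | inj₂ oc = ⊥-elim (consequence 8 3 (var 0F ≗ var 1F ⊞ var 2F ∷ [])
             (λ { (v ∷ w ∷ c ∷ []) → oddᵇ v ∧ oddᵇ w ∧ oddᵇ c }) (λ _ → false) refl (w + c ∷ w ∷ c ∷ [])
                     (ov ,ᵀ ow ,ᵀ residue oc) refl)

  gap-product : ∀ w a n → (w + 2 * a) * (w + 2 * a) ≡ w * w + 4 * n → (w + a) * a ≡ n
  gap-product w a n e = ℕₚ.*-cancelˡ-≡ _ _ 4 (ℕₚ.+-cancelˡ-≡ (w * w) _ _ (trans (l w a) e))
    where
    l : ∀ w a → w * w + 4 * ((w + a) * a) ≡ (w + 2 * a) * (w + 2 * a)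
    l = solve-∀

  -- With v = w + 2a, the numbers w + a and a are the factors (v ± w)/2 of (v² − w²)/4.
  coprime-gap : ∀ {w a x k} → (w + 2 * a) * (w + 2 * a) ≡ w * w + k * (x * x) → Coprime w x →
                (∀ {d} → Coprime d x → d ∣ w → d * d ∣ k → d ≡ 1) → Coprime (w + a) a
  coprime-gap {w} {a} e cop sf {d} (d∣w+a , d∣a) = sf (coprime-restrict cop d∣w) d∣w (common-divisor² e cop d∣v d∣w)
    where
    d∣w : d ∣ w
    d∣w = ∣m+n∣m⇒∣n (subst (d ∣_) (ℕₚ.+-comm w a) d∣w+a) d∣a
    d∣v : d ∣ w + 2 * a
    d∣v = ∣m∣n⇒∣m+n d∣w (∣n⇒∣m*n 2 d∣a)

  -- The descent step: if w = A² − kA′² = B² − kB′², x = 2AA′, BB′ = 2x and (u + v)/2 = B² + kA′² = A² + kB′²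
  -- is a square, then (w , x) descends to (AB , AA′).
  module _ (k : ℕ) (A A′ B B′ C : ℕ) where
    private
      l₁ : ∀ A B C A′ k → A * C * (A * C) + A * A * (B * B + k * (A′ * A′))
          ≡ A * B * (A * B) + k * (A * A′ * (A * A′)) + A * A * (C * C)
      l₁ = solve-∀
      l₂ : ∀ A B C A′ B′ k → B * C * (B * C) + (B * B * (A * A + k * (B′ * B′)) + k * (4 * (A * A′) * (4 * (A * A′))))
            ≡ A * B * (A * B) + 16 * k * (A * A′ * (A * A′)) + (B * B * (C * C) + k * (B * B′ * (B * B′)))
      l₂ = solve-∀
    descend₁ : B * B + k * (A′ * A′) ≡ C * C → A * C * (A * C) ≡ A * B * (A * B) + k * (A * A′ * (A * A′))
    descend₁ h = cancel-combination (cong (A * A *_) h) (l₁ A B C A′ k)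
    descend₂ : A * A + k * (B′ * B′) ≡ C * C → B * B′ ≡ 4 * (A * A′) → B * C * (B * C)
        ≡ A * B * (A * B) + 16 * k * (A * A′ * (A * A′))
    descend₂ h g = cancel-combination (cong₂ _+_ (cong (B * B *_) h) (cong (k *_) (cong₂ _*_ (sym g) (sym g)))) (l₂ A B C A′ B′ k)

  prime-3 : Prime 3
  prime-3 = from-yes (prime? 3)

  prime-5 : Prime 5
  prime-5 = from-yes (prime? 5)

  prime-17 : Prime 17
  prime-17 = from-yes (prime? 17)

  -- The system w² = u² + x², v² = 16w² + x² with x odd

  square≤⇒≤ : ∀ {m n s} → n * n ≡ m * m + s → m ≤ n
  square≤⇒≤ {m} {n} {s} e with m ≤? n
  ... | yes p = p
  ... | no p = ⊥-elim (ℕₚ.<⇒≱ (ℕₚ.*-mono-< (ℕₚ.≰⇒> p) (ℕₚ.≰⇒> p)) (subst (m * m ≤_) (sym e) (ℕₚ.m≤m+n _ s)))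

  gap : ∀ {v m s} → v * v ≡ m * m + s → ∃ λ e → v ≡ m + e × (m + m + e) * e ≡ s
  gap {v} {m} {s} h with ℕₚ.m≤n⇒∃[o]m+o≡n (square≤⇒≤ {m} {v} h)
  ... | e , refl = e , refl , ℕₚ.+-cancelˡ-≡ (m * m) _ _ (trans (l m e) h)
    where
    l : ∀ m e → m * m + (m + m + e) * e ≡ (m + e) * (m + e)
    l = solve-∀

  -- Counterpart of `coprime-gap` for roots m + e and m of opposite parity, where nothing can be
  -- halved. A common divisor of 2m + e and e divides the odd s, hence is odd and can be cancelled
  -- from 2m.
  coprime-odd-gap : ∀ {m e s} → Odd s → (m + m + e) * e ≡ s → (∀ {d} → Odd d → d ∣ m → d ∣ s → d ∣ m + e → d ≡ 1) →
      Coprime (m + m + e) e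
  coprime-odd-gap {m} {e} {s} os h f {d} (d∣₁ , d∣e) = f od d∣m d∣s (∣m∣n⇒∣m+n d∣m d∣e)
    where
    d∣s : d ∣ s
    d∣s = subst (d ∣_) h (∣n⇒∣m*n (m + m + e) d∣e)
    od : Odd d
    od = odd-divisor os d∣s
    2m : ∀ m e → m + m + e ≡ e + 2 * m
    2m = solve-∀
    d∣m : d ∣ m
    d∣m = coprime-divisor (coprime-2 od) (∣m+n∣m⇒∣n (subst (d ∣_) (2m m e) d∣₁) d∣e)

  square-descale⁻ : ∀ {k w x u g} → g ≢ 0 → w * g * (w * g) ≡ u * u + k * (x * g * (x * g)) → ∃ λ s → w * w
      ≡ s * s + k * (x * x)
  square-descale⁻ {k} {w} {x} {u} {g} g≢0 e
    with ∣-from-squares g u (∣m+n∣m⇒∣n (divides (w * w) (trans (ℕₚ.+-comm (k * (x * g * (x * g))) (u * u)) (trans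
            (sym e) (l₂ w g)))) (divides (k * (x * x)) (l₃ k x g)))
    where
    l₂ : ∀ w g → w * g * (w * g) ≡ w * w * (g * g)
    l₂ = solve-∀
    l₃ : ∀ k x g → k * (x * g * (x * g)) ≡ k * (x * x) * (g * g)
    l₃ = solve-∀
  ... | divides s refl = s , ℕₚ.*-cancelʳ-≡ (w * w) (s * s + k * (x * x)) (g * g) (trans (l w g) (trans e (r k s x g)))
    where
    instance _ = ≢-nonZero g≢0
    instance _ = ℕₚ.m*n≢0 g g
    l : ∀ w g → w * w * (g * g) ≡ w * g * (w * g)
    l = solve-∀
    r : ∀ k u x g → u * g * (u * g) + k * (x * g * (x * g)) ≡ (u * u + k * (x * x)) * (g * g)
    r = solve-∀

  -- The differences v² - (4w)² = x², w² - u² = x² and v² - (4u)² = 17x² factor into coprime odd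
  -- parts. With v + 4w = A², w - u = B′² and v + 4u = cC², where c is 1 or 17, the identity v + 4w
  -- = (v + 4u) + 4(w - u) reads A² = cC² + 4B′². For odd A, B′, C this is 1 ≡ 5 modulo 8.
  module _ {w x u v} (cop : Coprime w x) (ox : Odd x) (hw : w * w ≡ u * u + 1 * (x * x)) (hv : v * v ≡ 16 * (w * w) + x * x) where
    private
      oxx : Odd (x * x)
      oxx = odd-* {x} {x} ox ox
      hv₁ : v * v ≡ 4 * w * (4 * w) + x * x
      hv₁ = trans hv (cong (_+ x * x) (l w))
        where
        l : ∀ w → 16 * (w * w) ≡ 4 * w * (4 * w)
        l = solve-∀
      hv₂ : v * v ≡ 4 * u * (4 * u) + 17 * (x * x)
      hv₂ = trans hv (trans (cong (λ z → 16 * z + x * x) hw) (l u x))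
        where
        l : ∀ u x → 16 * (u * u + 1 * (x * x)) + x * x ≡ 4 * u * (4 * u) + 17 * (x * x)
        l = solve-∀
      cop-w : ∀ {d} → d ∣ w → d ∣ x * x → d ≡ 1
      cop-w d∣w d∣xx = coprime-* cop cop (d∣w , d∣xx)
      cop-u : Coprime (4 * u) x
      cop-u {d} (d∣4u , d∣x) = Coprimality.sym (coprime-* (Coprimality.sym cop) (Coprimality.sym cop))
        (subst (d ∣_) (sym hw) (∣m∣n⇒∣m+n (∣m⇒∣m*n u d∣u) (∣n⇒∣m*n 1 (∣m⇒∣m*n x d∣x))) , d∣x)
        where
        d∣u : d ∣ u
        d∣u = coprime-divisor (coprime-4 (odd-divisor ox d∣x)) d∣4u

    module Gaps {e f h} (v≡ : v ≡ 4 * w + e) (he : (4 * w + 4 * w + e) * e ≡ x * x)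
             (w≡ : w ≡ u + f) (hf : (u + u + f) * f ≡ 1 * (x * x))
             (v≡′ : v ≡ 4 * u + h) (hh : (4 * u + 4 * u + h) * h ≡ 17 * (x * x)) where
      cop₁ : Coprime (4 * w + 4 * w + e) e
      cop₁ = coprime-odd-gap {4 * w} {e} oxx he (λ od d∣ d∣s _ → cop-w (coprime-divisor (coprime-4 od) d∣) d∣s)
      hf′ : (u + u + f) * f ≡ x * x
      hf′ = trans hf (ℕₚ.*-identityˡ (x * x))
      cop₂ : Coprime (u + u + f) f
      cop₂ = coprime-odd-gap {u} {f} oxx hf′ (λ {d} od _ d∣s d∣w → cop-w (subst (d ∣_) (sym w≡) d∣w) d∣s)
      cop₃ : Coprime (4 * u + 4 * u + h) h
      cop₃ = coprime-odd-gap {4 * u} {h} (odd-* {17} {x * x} (odd tt) oxx) hh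
        (λ {d} od d∣4u _ d∣v → squarefree 17 refl (common-divisor² hv₂ cop-u (subst (d ∣_) (sym v≡′) d∣v) d∣4u))
      relation : 4 * w + 4 * w + e ≡ 4 * u + 4 * u + h + 4 * f
      relation = trans (ℕₚ.+-assoc (4 * w) (4 * w) e) (trans (cong (4 * w +_) (trans (sym v≡) v≡′))
        (trans (cong (λ z → 4 * z + (4 * u + h)) w≡) (l u f h)))
        where
        l : ∀ u f h → 4 * (u + f) + (4 * u + h) ≡ 4 * u + 4 * u + h + 4 * f
        l = solve-∀
      mod-8 : ∀ {A B C} c → T (c % 8 ≡ᵇ 1) → Odd A → Odd B → Odd C → A * A ≡ c * (C * C) + 4 * (B * B) → ⊥
      mod-8 {A} {B} {C} c c1 (odd oA) (odd oB) (odd oC) eq = consequence 8 4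
        (var 0F ⊠ var 0F ≗ var 3F ⊠ (var 2F ⊠ var 2F) ⊞ lit 4 ⊠ (var 1F ⊠ var 1F) ∷ [])
        (λ { (a ∷ b ∷ c ∷ k ∷ []) → (k ≡ᵇ 1) ∧ oddᵇ a ∧ oddᵇ b ∧ oddᵇ c }) (λ _ → false) refl
        (A ∷ B ∷ C ∷ c ∷ []) (c1 ,ᵀ oA ,ᵀ oB ,ᵀ oC) eq
      odd-factors : ∀ {s t} → s * t ≡ x → Odd s × Odd t
      odd-factors {s} {t} st = odd-*⁻ {s} {t} (subst Odd (sym st) ox)
      finish : (∃₂ λ s t → 4 * w + 4 * w + e ≡ s * s × e ≡ t * t × s * t ≡ x) →
               (∃₂ λ s t → u + u + f ≡ s * s × f ≡ t * t × s * t ≡ x) →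
               (∃₂ λ s t → 4 * u + 4 * u + h ≡ 17 * (s * s) × h ≡ t * t × s * t ≡ x) ⊎
               (∃₂ λ s t → 4 * u + 4 * u + h ≡ s * s × h ≡ 17 * (t * t) × s * t ≡ x) → ⊥
      finish (A , A′ , A≡ , _ , AA′) (B , B′ , _ , B≡ , BB′) (inj₁ (C , C′ , C≡ , _ , CC′)) =
        mod-8 {A} {B′} {C} 17 tt (proj₁ (odd-factors AA′)) (proj₂ (odd-factors {B} BB′)) (proj₁ (odd-factors CC′))
          (trans (sym A≡) (trans relation (cong₂ _+_ C≡ (cong (4 *_) B≡))))
      finish (A , A′ , A≡ , _ , AA′) (B , B′ , _ , B≡ , BB′) (inj₂ (C , C′ , C≡ , _ , CC′)) =
        mod-8 {A} {B′} {C} 1 tt (proj₁ (odd-factors AA′)) (proj₂ (odd-factors {B} BB′)) (proj₁ (odd-factors CC′))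
          (trans (sym A≡) (trans relation (cong₂ _+_ (trans C≡ (sym (ℕₚ.*-identityˡ (C * C)))) (cong (4 *_) B≡))))

    no-odd-17-coprime : ⊥
    no-odd-17-coprime =
      let e , v≡ , he = gap {v} {4 * w} hv₁
          f , w≡ , hf = gap {w} {u} hw
          h , v≡′ , hh = gap {v} {4 * u} hv₂
      in Gaps.finish v≡ he w≡ hf v≡′ hh
           (square-factors {n = x} (Gaps.cop₁ v≡ he w≡ hf v≡′ hh) he)
           (square-factors {n = x} (Gaps.cop₂ v≡ he w≡ hf v≡′ hh) (Gaps.hf′ v≡ he w≡ hf v≡′ hh))
           (prime-square-factors {n = x} prime-17 (Gaps.cop₃ v≡ he w≡ hf v≡′ hh) hh)

  odd⇒≢0 : ∀ {n} → Odd n → n ≢ 0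
  odd⇒≢0 (odd ()) refl

  no-odd-17 : ∀ w x u v → Odd x → w * w ≡ u * u + 1 * (x * x) → v * v ≡ 16 * (w * w) + x * x → ⊥
  no-odd-17 w x u v ox hw hv = reduce (gcd-split x w (odd⇒≢0 ox)) ox hw hv
    where
    l₁ : ∀ w x g → 16 * (w * g * (w * g)) + x * g * (x * g) ≡ (16 * (w * w) + x * x) * (g * g)
    l₁ = solve-∀
    reduce : ∀ {w x} → (∃ λ g → ∃₂ λ x₀ w₀ → g ≢ 0 × x ≡ x₀ * g × w ≡ w₀ * g × Coprime x₀ w₀) →
             Odd x → w * w ≡ u * u + 1 * (x * x) → v * v ≡ 16 * (w * w) + x * x → ⊥
    reduce (g , x₀ , w₀ , g≢0 , refl , refl , cop) ox hw hv =
      let u₀ , hw₀ = square-descale⁻ {1} {w₀} {x₀} {u} g≢0 hw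
          v₀ , _ , hv₀ = square-descale (16 * (w₀ * w₀) + x₀ * x₀) g≢0 v (trans hv (l₁ w₀ x₀ g))
      in no-odd-17-coprime {w₀} {x₀} {u₀} {v₀} (Coprimality.sym cop) (proj₁ (odd-*⁻ {x₀} {g} ox)) hw₀ hv₀

  -- Infinite descent on the second coordinate

  halved-< : ∀ {y} → 2 * y ≢ 0 → y < 2 * y
  halved-< {zero} h = ⊥-elim (h refl)
  halved-< {suc y} _ = ℕₚ.m<m+n (suc y) (s≤s z≤n)

  coprime-reduction : ∀ {P : ℕ → ℕ → Set} → (∀ {g w x} → g ≢ 0 → P (w * g) (x * g) → P w x) → (∀ {w x} → Coprime w x →
      x ≢ 0 → P w x → ⊥) → ∀ {w x} → x ≢ 0 → ¬ P w x
  coprime-reduction {P} scale none {w} {x} x≢0 p = go (gcd-split x w x≢0) x≢0 p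
    where
    go : ∀ {w x} → (∃ λ g → ∃₂ λ x₀ w₀ → g ≢ 0 × x ≡ x₀ * g × w ≡ w₀ * g × Coprime x₀ w₀) → x ≢ 0 → P w x → ⊥
    go (g , x₀ , w₀ , g≢0 , refl , refl , cop) x≢0 p = none (Coprimality.sym cop) (λ { refl → x≢0 refl }) (scale g≢0 p)

  square-scale₊ : ∀ k {g w x} → g ≢ 0 → Square (w * g * (w * g) + k * (x * g * (x * g))) → Square (w * w + k * (x * x))
  square-scale₊ k {g} {w} {x} g≢0 (v , e) =
    let v₀ , _ , e₀ = square-descale (w * w + k * (x * x)) g≢0 v (trans e (l k w x g)) in v₀ , e₀
    where
    l : ∀ k w x g → w * g * (w * g) + k * (x * g * (x * g)) ≡ (w * w + k * (x * x)) * (g * g)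
    l = solve-∀

  odd-or-odd : ∀ {w x} → Coprime w x → Odd w ⊎ Odd x
  odd-or-odd {w} {x} cop with even-or-odd w | even-or-odd x
  ... | inj₂ o | _ = inj₁ o
  ... | _ | inj₂ o = inj₂ o
  ... | inj₁ (k , refl) | inj₁ (l , refl) = case cop {2} (m∣m*n k , m∣m*n l) of λ ()

  -- The step is demanded only of coprime pairs: dividing out the gcd does not increase x, and the
  -- halving that follows decreases it strictly.
  infinite-descent : ∀ {P : ℕ → ℕ → Set} → (∀ {g w x} → g ≢ 0 → P (w * g) (x * g) → P w x) →
    (∀ {w x} → Coprime w x → P w x → ∃ λ y → x ≡ 2 * y × ∃ λ w′ → P w′ y) → ∀ x w → x ≢ 0 → ¬ P w x
  infinite-descent {P} scale step = <-rec (λ x → ∀ w → x ≢ 0 → ¬ P w x) λ x rec w x≢0 p → reduce (gcd-split x w x≢0) rec x≢0 p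
    where
    reduce : ∀ {w x} → (∃ λ g → ∃₂ λ x₀ w₀ → g ≢ 0 × x ≡ x₀ * g × w ≡ w₀ * g × Coprime x₀ w₀) →
             (∀ {y} → y < x → ∀ w → y ≢ 0 → ¬ P w y) → x ≢ 0 → P w x → ⊥
    reduce (g , x₀ , w₀ , g≢0 , refl , refl , cop) rec x≢0 p =
      finish (step (Coprimality.sym cop) (scale g≢0 p)) x₀≢0 (λ y<x₀ → rec (ℕₚ.<-≤-trans y<x₀ (ℕₚ.m≤m*n x₀ g)))
      where
      instance _ = ≢-nonZero g≢0
      x₀≢0 : x₀ ≢ 0
      x₀≢0 refl = x≢0 refl
      finish : ∀ {x₀} → (∃ λ y → x₀ ≡ 2 * y × ∃ λ w′ → P w′ y) → x₀ ≢ 0 → (∀ {y} → y < x₀ → ∀ w → y ≢ 0 → ¬ P w y) → ⊥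
      finish (y , refl , w′ , p) n r = r (halved-< n) w′ (λ { refl → n refl }) p

  coprime-step⁻ : ∀ {w u x k} → w * w ≡ u * u + k * (x * x) → Coprime w x → Coprime u x
  coprime-step⁻ {w} {u} {x} {k} e cop {d} (d∣u , d∣x) =
    Coprimality.sym (coprime-* (Coprimality.sym cop) (Coprimality.sym cop))
      (subst (d ∣_) (sym e) (∣m∣n⇒∣m+n (∣m⇒∣m*n u d∣u) (∣n⇒∣m*n k (∣m⇒∣m*n x d∣x))) , d∣x)

  odd-root : ∀ {v w z} → Odd w → v * v ≡ w * w + 4 * z → Odd v
  odd-root {v} {w} {z} (odd ow) e = odd (consequence 8 3 (var 0F ⊠ var 0F ≗ var 1F ⊠ var 1F ⊞ lit 4 ⊠ var 2F ∷ [])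
    (λ { (v ∷ w ∷ z ∷ []) → oddᵇ w }) (λ { (v ∷ _) → oddᵇ v }) refl (v ∷ w ∷ z ∷ []) ow e)

  odd-root⁻ : ∀ {w u z} → Odd w → w * w ≡ u * u + 4 * z → Odd u
  odd-root⁻ {w} {u} {z} (odd ow) e = odd (consequence 8 3 (var 0F ⊠ var 0F ≗ var 1F ⊠ var 1F ⊞ lit 4 ⊠ var 2F ∷ [])
    (λ { (w ∷ u ∷ z ∷ []) → oddᵇ w }) (λ { (_ ∷ u ∷ _) → oddᵇ u }) refl (w ∷ u ∷ z ∷ []) ow e)

  even-leg : ∀ {v w x} → Odd w → v * v ≡ w * w + 1 * (x * x) → ∃ λ y → x ≡ 2 * y
  even-leg {v} {w} {x} (odd ow) e with even-or-odd x
  ... | inj₁ p = p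
  ... | inj₂ (odd ox) = ⊥-elim (consequence 8 3 (var 0F ⊠ var 0F ≗ var 1F ⊠ var 1F ⊞ lit 1 ⊠ (var 2F ⊠ var 2F) ∷ [])
    (λ { (v ∷ w ∷ x ∷ []) → oddᵇ w ∧ oddᵇ x }) (λ _ → false) refl (v ∷ w ∷ x ∷ []) (ow ,ᵀ ox) e)

  quarter : ∀ k y → k * (2 * y * (2 * y)) ≡ 4 * (k * (y * y))
  quarter = solve-∀

  odd-square-gap-coprime : ∀ k {j d w} → Odd w → d ∣ w → (∀ {d} → d * d ∣ k → d ≡ 1) → j ≡ 16 * k → d * d ∣ j → d ≡ 1
  odd-square-gap-coprime k {_} {d} ow d∣w sf refl dd∣ = sf (coprime-divisor {n = 16} (Coprimality.sym (coprime-* s s)) dd∣)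
    where
    od : Odd d
    od = odd-divisor ow d∣w
    c16 : Coprime d 16
    c16 = coprime-* (coprime-4 od) (coprime-4 od)
    s : Coprime 16 d
    s = Coprimality.sym c16

  -- Conductor 17: w² + x² and w² - 16x²

  -- For X = (w/x)² the numbers X, X + 1 and X - 16 are squares: the image of doubling on Y² = X(X +
  -- 1)(X - 16). Oddness of w belongs to the invariant because an even w leads to the system of
  -- `no-odd-17` instead.
  record Triple₁₇ (w x : ℕ) : Set where
    constructor triple
    field
      v u : ℕ
      odd-w : Odd w
      sum : v * v ≡ w * w + 1 * (x * x)
      difference : w * w ≡ u * u + 16 * (x * x)

  module _ {A A′ B B′ : ℕ} (BB′ : B * B′ ≡ 4 * (A * A′)) where
    private
      l₁ : ∀ A B C A′ B′ → A * B * (A * B) + (B * B * (C * C + B′ * B′) + 4 * (A * A′) * (4 * (A * A′)))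
            ≡ B * C * (B * C) + 16 * (A * A′ * (A * A′)) + (B * B * (A * A) + B * B′ * (B * B′))
      l₁ = solve-∀
      l₂ : ∀ A B C A′ C′ → A * C * (A * C) + (C * C * (B * B + C′ * C′) + A * A′ * (A * A′))
            ≡ A * A′ * (A * A′) + 1 * (B * C * (B * C)) + (C * C * (A * A) + C * C′ * (C * C′))
      l₂ = solve-∀
      l₃ : ∀ A B C A′ → A * B * (A * B) + (A * A * (17 * (C * C)) + (A * A′ * (A * A′) + 1 * (B * C * (B * C))))
            ≡ 16 * (A * C * (A * C)) + B * C * (B * C) + (A * A * (B * B + 1 * (A′ * A′)) + A * C * (A * C))
      l₃ = solve-∀

    descend₁₇ : ∀ {C} → Odd A → Odd B → B * B + 1 * (A′ * A′) ≡ C * C → A * A ≡ C * C + B′ * B′ → Triple₁₇ (A * B) (A * A′)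
    descend₁₇ {C} oA oB h g = triple (A * C) (B * C) (odd-* oA oB) (descend₁ 1 A A′ B B′ C h)
      (cancel-combination (cong₂ _+_ (cong (B * B *_) (sym g)) (cong₂ _*_ (sym BB′) (sym BB′))) (l₁ A B C A′ B′))

    -- A² = B² + C′² and CC′ = AA′ give (AC)² = (AA′)² + (BC)². With this, A²(B² + A′²) = 17A²C²
    -- turns into (AB)² = 16(AC)² + (BC)². Since B² + A′² is odd, so is C, and BC is the forbidden
    -- odd entry.
    no-17-class : ∀ {C C′} → Odd B → T (not (oddᵇ (A′ % 8))) → B * B + 1 * (A′ * A′) ≡ 17 * (C * C) → A * A
        ≡ B * B + C′ * C′ →
                  C * C′ ≡ A * A′ → ⊥
    no-17-class {C} {C′} oB eA′ h g CC′ = no-odd-17 (A * C) (B * C) (A * A′) (A * B) (odd-* oB oC) eq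
        (cancel-combination (cong₂ _+_ (cong (A * A *_) (sym h)) (sym eq)) (l₃ A B C A′))
      where
      eq : A * C * (A * C) ≡ A * A′ * (A * A′) + 1 * (B * C * (B * C))
      eq = cancel-combination (cong₂ _+_ (cong (C * C *_) (sym g)) (cong₂ _*_ (sym CC′) (sym CC′))) (l₂ A B C A′ C′)
      oC : Odd C
      oC = odd (consequence 8 3 (var 0F ⊠ var 0F ⊞ lit 1 ⊠ (var 1F ⊠ var 1F) ≗ lit 17 ⊠ (var 2F ⊠ var 2F) ∷ [])
        (λ { (b ∷ a ∷ c ∷ []) → oddᵇ b ∧ not (oddᵇ a) }) (λ { (b ∷ a ∷ c ∷ []) → oddᵇ c }) refl (B ∷ A′ ∷ C ∷ [])
                (residue oB ,ᵀ eA′) h)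

  T-∨ : ∀ {a b} → T (a ∨ b) → T a ⊎ T b
  T-∨ {true} p = inj₁ p
  T-∨ {false} p = inj₂ p

  T-∧ : ∀ {a b} → T (a ∧ b) → T a × T b
  T-∧ {true} p = tt , p

  -- An odd sum of two squares is 1 modulo 4, and A² - A′² ≡ 1 modulo 4 leaves only A odd and A′
  -- even.
  parities : ∀ {w A A′ B B′} → Odd w → w ≡ B * B + B′ * B′ → A * A ≡ w + A′ * A′ →
             Odd A × T (not (oddᵇ (A′ % 8))) × (Odd B ⊎ Odd B′)
  parities {w} {A} {A′} {B} {B′} (odd o) e f = odd (proj₁ p) , proj₂ p , Data.Sum.map odd odd (T-∨ (proj₂ q))
    where
    import Data.Sum
    q : T (w % 8 % 4 ≡ᵇ 1) × T (oddᵇ (B % 8) ∨ oddᵇ (B′ % 8))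
    q = T-∧ (consequence 8 3 (var 0F ≗ var 1F ⊠ var 1F ⊞ var 2F ⊠ var 2F ∷ [])
      (λ { (w ∷ _) → oddᵇ w }) (λ { (w ∷ b ∷ b′ ∷ []) → (w % 4 ≡ᵇ 1) ∧ (oddᵇ b ∨ oddᵇ b′) }) refl (w ∷ B ∷ B′ ∷ []) o e)
    p : T (oddᵇ (A % 8)) × T (not (oddᵇ (A′ % 8)))
    p = T-∧ (consequence 8 3 (var 1F ⊠ var 1F ≗ var 0F ⊞ var 2F ⊠ var 2F ∷ [])
      (λ { (w ∷ _) → w % 4 ≡ᵇ 1 }) (λ { (_ ∷ a ∷ a′ ∷ []) → oddᵇ a ∧ not (oddᵇ a′) }) refl (w ∷ A ∷ A′ ∷ []) (proj₁ q) f)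

  -- Here (v + u)/2 is C² or 17C²; in the second case, or symmetrically for (v − u)/2, the new solution
  -- has odd x and no-odd-17 applies.
  descent-step₁₇ : ∀ {x w v u} → Coprime w x → Odd w → v * v ≡ w * w + 1 * (x * x) → w * w ≡ u * u + 16 * (x * x) →
                   ∃ λ y → x ≡ 2 * y × ∃ λ w′ → Triple₁₇ w′ y
  descent-step₁₇ {x} {w} {v} {u} cop ow hv hu = even (even-leg {v} {w} {x} ow hv) cop hv hu
    where
    even : ∀ {x} → (∃ λ y → x ≡ 2 * y) → Coprime w x → v * v ≡ w * w + 1 * (x * x) → w * w ≡ u * u + 16 * (x * x) →
           ∃ λ y → x ≡ 2 * y × ∃ λ w′ → Triple₁₇ w′ y
    even (y , refl) cop hv hu = y , refl , gaps (odd-gap ou′ ow hv₄) (odd-gap {w} {u} ow ou hu₄)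
      where
      hv₄ : v * v ≡ w * w + 4 * (1 * (y * y))
      hv₄ = trans hv (cong (w * w +_) (quarter 1 y))
      hu₄ : w * w ≡ u * u + 4 * (16 * (y * y))
      hu₄ = trans hu (cong (u * u +_) (quarter 16 y))
      ou′ : Odd v
      ou′ = odd-root {v} {w} {1 * (y * y)} ow hv₄
      ou : Odd u
      ou = odd-root⁻ {w} {u} {16 * (y * y)} ow hu₄
      cop-u : Coprime u (2 * y)
      cop-u = coprime-step⁻ {w} {u} {2 * y} {16} hu cop
      gaps : (∃ λ a → v ≡ w + 2 * a) → (∃ λ b → w ≡ u + 2 * b) → ∃ λ w′ → Triple₁₇ w′ y
      gaps (a′ , v≡) (b′ , w≡) =
        -- The coprime pairs are, in this order, (v ± w)/2 with product y², (w ± u)/2 with product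
        -- 16y², and (v ± u)/2 with product 17y².
        finish (square-factors {n = y} (coprime-gap {w} {a′} {2 * y} {1} hv′ cop (λ _ _ → squarefree 1 refl))
                 (trans (gap-product w a′ (1 * (y * y)) (subst (λ v → v * v ≡ w * w + 4 * (1 * (y * y))) v≡ hv₄))
                         (ℕₚ.*-identityˡ (y * y))))
               (square-factors {n = 4 * y} (coprime-gap {u} {b′} {2 * y} {16} hu′ cop-u
                       (λ _ d∣u → odd-square-gap-coprime 1 ou d∣u (squarefree 1 refl) refl))
                 (trans (gap-product u b′ (16 * (y * y)) (subst (λ w → w * w ≡ u * u + 4 * (16 * (y * y))) w≡ hu₄)) (l y)))
               (prime-square-factors {n = y} prime-17 (coprime-gap {u} {b′ + a′} {2 * y} {17} hγ cop-u
                       (λ _ _ → squarefree 17 refl))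
                 (gap-product u (b′ + a′) (17 * (y * y)) (trans hγ (cong (u * u +_) (quarter 17 y)))))
        where
        l : ∀ y → 16 * (y * y) ≡ 4 * y * (4 * y)
        l = solve-∀
        hv′ : (w + 2 * a′) * (w + 2 * a′) ≡ w * w + 1 * (2 * y * (2 * y))
        hv′ = subst (λ v → v * v ≡ w * w + 1 * (2 * y * (2 * y))) v≡ hv
        hu′ : (u + 2 * b′) * (u + 2 * b′) ≡ u * u + 16 * (2 * y * (2 * y))
        hu′ = subst (λ w → w * w ≡ u * u + 16 * (2 * y * (2 * y))) w≡ hu
        hγ : (u + 2 * (b′ + a′)) * (u + 2 * (b′ + a′)) ≡ u * u + 17 * (2 * y * (2 * y))
        hγ = trans (cong (λ z → z * z) (trans (m u b′ a′) (trans (cong (_+ 2 * a′) (sym w≡)) (sym v≡))))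
               (trans hv (trans (cong (_+ 1 * (2 * y * (2 * y))) hu) (n u (2 * y))))
          where
          m : ∀ u b a → u + 2 * (b + a) ≡ u + 2 * b + 2 * a
          m = solve-∀
          n : ∀ u x → u * u + 16 * (x * x) + 1 * (x * x) ≡ u * u + 17 * (x * x)
          n = solve-∀
        finish : (∃₂ λ s t → w + a′ ≡ s * s × a′ ≡ t * t × s * t ≡ y) →
                 (∃₂ λ s t → u + b′ ≡ s * s × b′ ≡ t * t × s * t ≡ 4 * y) →
                 (∃₂ λ s t → u + (b′ + a′) ≡ 17 * (s * s) × b′ + a′ ≡ t * t × s * t ≡ y) ⊎
                 (∃₂ λ s t → u + (b′ + a′) ≡ s * s × b′ + a′ ≡ 17 * (t * t) × s * t ≡ y) → ∃ λ w′ → Triple₁₇ w′ y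
        finish (A , A′ , A≡ , A′≡ , AA′) (B , B′ , B≡ , B′≡ , BB′) = λ
          { (inj₁ (C , C′ , C≡ , C′≡ , CC′)) → case proj₂ (proj₂ par) of λ
              { (inj₁ oB) → ⊥-elim (no-17-class {A} {A′} {B} {B′} r {C} {C′} oB eA′ (trans f₁ C≡) (trans f₅ (cong
                      (B * B +_) C′≡)) (trans CC′ (sym AA′)))
              ; (inj₂ oB′) → A * B′ , subst (Triple₁₇ (A * B′)) AA′ (descend₁₇ {A} {A′} {B′} {B} r′ {C′} oA oB′
                      (trans f₃ C′≡) (trans f₄ (cong (_+ B * B) C′≡))) }
          ; (inj₂ (C , C′ , C≡ , C′≡ , CC′)) → case proj₂ (proj₂ par) of λ
              { (inj₁ oB) → A * B , subst (Triple₁₇ (A * B)) AA′ (descend₁₇ {A} {A′} {B} {B′} r {C} oA oB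
                      (trans f₁ C≡) (trans f₂ (cong (_+ B′ * B′) C≡)))
              ; (inj₂ oB′) → ⊥-elim (no-17-class {A} {A′} {B′} {B} r′ {C′} {C} oB′ eA′ (trans f₃ C′≡) (trans f₆ (cong
                      (B′ * B′ +_) C≡))
                               (trans (ℕₚ.*-comm C′ C) (trans CC′ (sym AA′)))) } }
          where
          e₀ : ∀ u b → u + 2 * b ≡ u + b + b
          e₀ = solve-∀
          par : Odd A × T (not (oddᵇ (A′ % 8))) × (Odd B ⊎ Odd B′)
          par = parities {w} {A} {A′} {B} {B′} ow (trans w≡ (trans (e₀ u b′) (cong₂ _+_ B≡ B′≡))) (trans (sym A≡)
                  (cong (w +_) A′≡))
          oA = proj₁ par
          eA′ = proj₁ (proj₂ par)
          r : B * B′ ≡ 4 * (A * A′)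
          r = trans BB′ (cong (4 *_) (sym AA′))
          r′ : B′ * B ≡ 4 * (A * A′)
          r′ = trans (ℕₚ.*-comm B′ B) r
          A²≡ : A * A ≡ u + 2 * b′ + a′
          A²≡ = trans (sym A≡) (cong (_+ a′) w≡)
          e₁ : ∀ u b a → u + b + 1 * a ≡ u + (b + a)
          e₁ = solve-∀
          e₂ : ∀ u b a → u + 2 * b + a ≡ u + (b + a) + b
          e₂ = solve-∀
          e₃ : ∀ b a → b + 1 * a ≡ b + a
          e₃ = solve-∀
          e₄ : ∀ u b a → u + 2 * b + a ≡ b + a + (u + b)
          e₄ = solve-∀
          f₁ : B * B + 1 * (A′ * A′) ≡ u + (b′ + a′)
          f₁ = trans (cong₂ (λ b a → b + 1 * a) (sym B≡) (sym A′≡)) (e₁ u b′ a′)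
          f₂ : A * A ≡ u + (b′ + a′) + B′ * B′
          f₂ = trans A²≡ (trans (e₂ u b′ a′) (cong (u + (b′ + a′) +_) B′≡))
          f₃ : B′ * B′ + 1 * (A′ * A′) ≡ b′ + a′
          f₃ = trans (cong₂ (λ b a → b + 1 * a) (sym B′≡) (sym A′≡)) (e₃ b′ a′)
          f₄ : A * A ≡ b′ + a′ + B * B
          f₄ = trans A²≡ (trans (e₄ u b′ a′) (cong (b′ + a′ +_) B≡))
          f₅ : A * A ≡ B * B + (b′ + a′)
          f₅ = trans f₄ (ℕₚ.+-comm (b′ + a′) (B * B))
          f₆ : A * A ≡ B′ * B′ + (u + (b′ + a′))
          f₆ = trans f₂ (ℕₚ.+-comm (u + (b′ + a′)) (B′ * B′))

  no-triple₁₇ : ∀ x w → x ≢ 0 → ¬ Triple₁₇ w x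
  no-triple₁₇ = infinite-descent {λ w x → Triple₁₇ w x}
    (λ { {g} {w} {x} g≢0 (triple v u ow hv hu) →
      let v₀ , hv₀ = square-scale₊ 1 {g} {w} {x} g≢0 (v , hv)
          u₀ , hu₀ = square-descale⁻ {16} {w} {x} {u} g≢0 hu
      in triple v₀ u₀ (proj₁ (odd-*⁻ {w} {g} ow)) hv₀ hu₀ })
    λ { {w} {x} cop (triple v u ow hv hu) → descent-step₁₇ {x} {w} {v} {u} cop ow hv hu }

  square-of-4* : ∀ {u n} → u * u ≡ n * (4 * 4) → ∃ λ s → u ≡ s * 4 × s * s ≡ n
  square-of-4* {u} {n} = square-descale n (λ ()) u

  -- As x² ≡ 1 modulo 8, the only squares with v² - w² ≡ 1 are v² ≡ 1 and w² ≡ 0 modulo 8.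
  leg-divisible-by-4 : ∀ {v w x} → Odd x → v * v ≡ w * w + 1 * (x * x) → ∃ λ s → w ≡ s * 4
  leg-divisible-by-4 {v} {w} {x} (odd ox) e = go (m%n≡0⇒n∣m (w % 8) 4 (ℕₚ.≡ᵇ⇒≡ (w % 8 % 4) 0
      (consequence 8 3 (var 0F ⊠ var 0F ≗ var 1F ⊠ var 1F ⊞ lit 1 ⊠ (var 2F ⊠ var 2F) ∷ [])
      (λ { (v ∷ w ∷ x ∷ []) → oddᵇ x }) (λ { (v ∷ w ∷ x ∷ []) → w % 4 ≡ᵇ 0 }) refl (v ∷ w ∷ x ∷ []) ox e)))
    where
    go : 4 ∣ w % 8 → ∃ λ s → w ≡ s * 4
    go 4∣ with ∣m∣n⇒∣m+n 4∣ (∣n⇒∣m*n (w / 8) (divides 2 refl))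
    ... | divides s eq = s , trans (m≡m%n+[m/n]*n w 8) eq

  no-17 : ∀ {w x} → x ≢ 0 → ¬ (Square (w * w + 1 * (x * x)) × ∃ λ u → w * w ≡ u * u + 16 * (x * x))
  no-17 {w} {x} x≢0 p = coprime-reduction {λ w x → Square (w * w + 1 * (x * x)) × ∃ λ u → w * w ≡ u * u + 16 * (x * x)}
    (λ { {g} {w} {x} g≢0 (sq , u , e) → square-scale₊ 1 {g} {w} {x} g≢0 sq , square-descale⁻ {16} {w} {x} {u} g≢0 e })
    (λ { {w} {x} cop x≢0 ((v , hv) , u , hu) → case odd-or-odd cop of λ
      { (inj₁ ow) → no-triple₁₇ x w x≢0 (triple v u ow hv hu)
      ; (inj₂ ox) → even {w} {x} {v} {u} (leg-divisible-by-4 {v} {w} {x} ox hv) ox hv hu } })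
    {w} {x} x≢0 p
    where
    even : ∀ {w x v u} → (∃ λ s → w ≡ s * 4) → Odd x → v * v ≡ w * w + 1 * (x * x) → w * w ≡ u * u + 16 * (x * x) → ⊥
    even {w} {x} {v} {u} (s , refl) ox hv hu =
      let r , hr = square-descale⁻ {1} {s} {x} {u} {4} (λ ()) (trans hu (cong (u * u +_) (l₁ x)))
      in no-odd-17 s x r v ox hr (trans hv (l₂ s x))
      where
      l₁ : ∀ x → 16 * (x * x) ≡ 1 * (x * 4 * (x * 4))
      l₁ = solve-∀
      l₂ : ∀ s x → s * 4 * (s * 4) + 1 * (x * x) ≡ 16 * (s * s) + x * x
      l₂ = solve-∀

  -- Conductor 15: w² + x² and w² + 16x²

  -- For X = (w/x)² the numbers X, X + k and X + 16k are squares: the image of doubling on Y² = X(X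
  -- + k)(X + 16k), the quadratic twist by k of X(X + 1)(X + 16).
  record Solution (k w x : ℕ) : Set where
    constructor solution
    field
      v u : ℕ
      first : v * v ≡ w * w + k * (x * x)
      second : u * u ≡ w * w + 16 * k * (x * x)

  descend : ∀ k {A A′ B B′ C} → B * B + k * (A′ * A′) ≡ C * C → A * A + k * (B′ * B′) ≡ C * C → B * B′ ≡ 4 * (A * A′) →
            Solution k (A * B) (A * A′)
  descend k {A} {A′} {B} {B′} {C} h₁ h₂ r = solution (A * C) (B * C) (descend₁ k A A′ B B′ C h₁) (descend₂ k A A′ B B′ C h₂ r)

  scale-solution : ∀ {k g w x} → g ≢ 0 → Solution k (w * g) (x * g) → Solution k w x
  scale-solution {k} {g} {w} {x} g≢0 (solution v u hv hu) =
    let v₀ , hv₀ = square-scale₊ k {g} {w} {x} g≢0 (v , hv)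
        u₀ , hu₀ = square-scale₊ (16 * k) {g} {w} {x} g≢0 (u , hu)
    in solution v₀ u₀ hv₀ hu₀

  T-≡ᵇ0 : ∀ {n} m .{{_ : NonZero m}} → T (n % m ≡ᵇ 0) → m ∣ n
  T-≡ᵇ0 {n} m p = m%n≡0⇒n∣m n m (ℕₚ.≡ᵇ⇒≡ (n % m) 0 p)

  -- Exactly one of A, A′ is odd. So B² - B′² = A² - A′² is odd and one of B, B′ is odd; BB′ = 4AA′
  -- ≡ 0 modulo 8 then puts a factor 8 into the other. Comparing the two differences modulo 4 shows
  -- which is which.
  parities₁₅ : ∀ {w A A′ B B′} → Odd w → A * A ≡ w + A′ * A′ → B * B + 1 * (A′ * A′) ≡ A * A + 1 * (B′ * B′) → B * B′
      ≡ 4 * (A * A′) →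
    (Odd A × Odd B × 8 ∣ B′) ⊎ (Odd A′ × Odd B′ × 8 ∣ B)
  parities₁₅ {w} {A} {A′} {B} {B′} (odd ow) eA eB eP = Data.Sum.map f f (T-∨ (consequence 8 4
      (var 2F ⊠ var 3F ≗ lit 4 ⊠ (var 0F ⊠ var 1F) ∷ var 2F ⊠ var 2F ⊞ lit 1 ⊠
              (var 1F ⊠ var 1F) ≗ var 0F ⊠ var 0F ⊞ lit 1 ⊠ (var 3F ⊠ var 3F) ∷ [])
      (λ { (a ∷ a′ ∷ _ ∷ _ ∷ []) → oddᵇ a xor oddᵇ a′ })
      (λ { (a ∷ a′ ∷ b ∷ b′ ∷ []) → (oddᵇ a ∧ oddᵇ b ∧ (b′ ≡ᵇ 0)) ∨ (oddᵇ a′ ∧ oddᵇ b′ ∧ (b ≡ᵇ 0)) })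
      refl (A ∷ A′ ∷ B ∷ B′ ∷ [])
      (consequence 8 3 (var 1F ⊠ var 1F ≗ var 0F ⊞ var 2F ⊠ var 2F ∷ [])
        (λ { (w ∷ _) → oddᵇ w }) (λ { (_ ∷ a ∷ a′ ∷ []) → oddᵇ a xor oddᵇ a′ }) refl (w ∷ A ∷ A′ ∷ []) ow eA)
      (eP , eB)))
    where
    f : ∀ {a b b′} → T (oddᵇ (a % 8) ∧ oddᵇ (b % 8) ∧ (b′ % 8 ≡ᵇ 0)) → Odd a × Odd b × 8 ∣ b′
    f {a} p = let o , q = T-∧ {oddᵇ (a % 8)} p ; o′ , d = T-∧ q in odd o , odd o′ , T-≡ᵇ0 8 d

  no-5-class : ∀ {A B′ C} → Odd A → 8 ∣ B′ → A * A + 1 * (B′ * B′) ≡ 5 * (C * C) → ⊥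
  no-5-class {A} {_} {C} (odd oA) (divides k refl) e = consequence 8 3
    (var 0F ⊠ var 0F ⊞ lit 1 ⊠ (var 1F ⊠ lit 8 ⊠ (var 1F ⊠ lit 8)) ≗ lit 5 ⊠ (var 2F ⊠ var 2F) ∷ [])
    (λ { (a ∷ _) → oddᵇ a }) (λ _ → false) refl (A ∷ k ∷ C ∷ []) oA e

  3∣-sum-of-squares : ∀ {X Y n} → X * X + 1 * (Y * Y) ≡ 3 * n → 3 ∣ Y
  3∣-sum-of-squares {X} {Y} {n} e = T-≡ᵇ0 3 (consequence 3 3 (var 0F ⊠ var 0F ⊞ lit 1 ⊠ (var 1F ⊠ var 1F) ≗ lit 3 ⊠ var 2F ∷ [])
    (λ _ → true) (λ { (_ ∷ y ∷ _) → y ≡ᵇ 0 }) refl (X ∷ Y ∷ n ∷ []) tt e)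

  OddSolution : ℕ → Set
  OddSolution x = ∃ λ w → Odd w × Solution 1 w x

  module _ {A A′ B B′ y w γ γ′ : ℕ} (ow : Odd w) (cop : Coprime (A * A) (A′ * A′)) (AA′ : A * A′ ≡ y) (BB′ : B * B′ ≡ 4 * y)
           (eA : A * A ≡ w + A′ * A′) (f₁ : B * B + 1 * (A′ * A′) ≡ γ) (f₂ : A * A + 1 * (B′ * B′) ≡ γ) where
    private
      r : B * B′ ≡ 4 * (A * A′)
      r = trans BB′ (cong (4 *_) (sym AA′))
      r′ : B′ * B ≡ 4 * (A′ * A)
      r′ = trans (ℕₚ.*-comm B′ B) (trans r (cong (4 *_) (ℕₚ.*-comm A A′)))
      par = parities₁₅ {w} {A} {A′} {B} {B′} ow eA (trans f₁ (sym f₂)) r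
      swap : ∀ {a b n} → a * a + 1 * (b * b) ≡ n → b * b + 1 * (a * a) ≡ n
      swap {a} {b} e = trans (l a b) e
        where
        l : ∀ a b → b * b + 1 * (a * a) ≡ a * a + 1 * (b * b)
        l = solve-∀
      unit : ∀ {C} → γ ≡ C * C → OddSolution y
      unit {C} e = case par of λ
        { (inj₁ (oA , oB , _)) → A * B , odd-* oA oB , subst (Solution 1 (A * B)) AA′ (descend 1 {A} {A′} {B} {B′} {C}
                (trans f₁ e) (trans f₂ e) r)
        ; (inj₂ (oA , oB , _)) → A′ * B′ , odd-* oA oB , subst (Solution 1 (A′ * B′)) (trans (ℕₚ.*-comm A′ A) AA′)
            (descend 1 {A′} {A} {B′} {B} {C} (swap {A} {B′} (trans f₂ e)) (swap {B} {A′} (trans f₁ e)) r′) }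
      five : ∀ {C} → γ ≡ 5 * (C * C) → ⊥
      five {C} e = case par of λ
        { (inj₁ (oA , _ , d)) → no-5-class {A} {B′} {C} oA d (trans f₂ e)
        ; (inj₂ (oA′ , _ , d)) → no-5-class {A′} {B} {C} oA′ d (swap {B} {A′} (trans f₁ e)) }
      three : ∀ {n} → γ ≡ 3 * n → ⊥
      three {n} e = case cop (∣m⇒∣m*n A (3∣-sum-of-squares {B′} {A} {n} (swap {A} {B′} (trans f₂ e))) , ∣m⇒∣m*n A′
              (3∣-sum-of-squares {B} {A′} {n} (trans f₁ e))) of λ ()

    -- Here γ is (u + v)/2. If 3 divided γ, both representations as a sum of two squares would
    -- consist of multiples of 3, against the coprimality of A and A′. Class 5 fails modulo 8, as
    -- one representation has an odd entry and a multiple of 8. So γ = C², and parity decides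
    -- whether the descent runs with (A , A′ , B , B′) or with both pairs exchanged.
    descend₁₅ : ∀ {n} → Coprime γ γ′ → γ * γ′ ≡ 3 * (5 * (n * n)) → OddSolution y
    descend₁₅ {n} cγ e = go (prime-split {3} {γ} {γ′} prime-3 e)
      where
      go : (∃ λ a → γ ≡ 3 * a × a * γ′ ≡ 5 * (n * n)) ⊎ (∃ λ b → γ′ ≡ 3 * b × γ * b ≡ 5 * (n * n)) → OddSolution y
      go (inj₁ (a , e , _)) = ⊥-elim (three {a} e)
      go (inj₂ (b , e , e′)) = case prime-square-factors {5} {γ} {b} {n} prime-5
          (Coprimality.sym (coprime-restrict (Coprimality.sym cγ) (subst (b ∣_) (sym e) (n∣m*n 3)))) e′ of λ
        { (inj₁ (C , _ , e , _)) → ⊥-elim (five {C} e)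
        ; (inj₂ (C , _ , e , _)) → unit {C} e }

  descent-step₁₅ : ∀ {x w v u} → Coprime w x → Odd w → v * v ≡ w * w + 1 * (x * x) → u * u ≡ w * w + 16 * (x * x) →
                   ∃ λ y → x ≡ 2 * y × OddSolution y
  descent-step₁₅ {x} {w} {v} {u} cop ow hv hu = even (even-leg {v} {w} {x} ow hv) cop hv hu
    where
    even : ∀ {x} → (∃ λ y → x ≡ 2 * y) → Coprime w x → v * v ≡ w * w + 1 * (x * x) → u * u ≡ w * w + 16 * (x * x) →
           ∃ λ y → x ≡ 2 * y × OddSolution y
    even (y , refl) cop hv hu = y , refl , gaps (odd-gap ov ow hv₄) (odd-gap ou ov hγ₄)
      where
      hv₄ : v * v ≡ w * w + 4 * (1 * (y * y))
      hv₄ = trans hv (cong (w * w +_) (quarter 1 y))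
      hu₄ : u * u ≡ w * w + 4 * (16 * (y * y))
      hu₄ = trans hu (cong (w * w +_) (quarter 16 y))
      hγ : u * u ≡ v * v + 15 * (2 * y * (2 * y))
      hγ = trans hu (trans (n w (2 * y)) (cong (_+ 15 * (2 * y * (2 * y))) (sym hv)))
        where
        n : ∀ w x → w * w + 16 * (x * x) ≡ w * w + 1 * (x * x) + 15 * (x * x)
        n = solve-∀
      hγ₄ : u * u ≡ v * v + 4 * (15 * (y * y))
      hγ₄ = trans hγ (cong (v * v +_) (quarter 15 y))
      ov : Odd v
      ov = odd-root {v} {w} {1 * (y * y)} ow hv₄
      ou : Odd u
      ou = odd-root {u} {w} {16 * (y * y)} ow hu₄
      cop-v : Coprime v (2 * y)
      cop-v = coprime-step {v} {w} {2 * y} {1} hv cop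
      gaps : (∃ λ a → v ≡ w + 2 * a) → (∃ λ b → u ≡ v + 2 * b) → OddSolution y
      gaps (a′ , v≡) (g′ , u≡) =
        finish (square-factors {n = y} cop₁
                 (trans (gap-product w a′ (1 * (y * y)) (subst (λ v → v * v ≡ w * w + 4 * (1 * (y * y))) v≡ hv₄))
                         (ℕₚ.*-identityˡ (y * y))))
               (square-factors {n = 4 * y} (coprime-gap {w} {a′ + g′} {2 * y} {16} hu′ cop
                       (λ _ d∣w → odd-square-gap-coprime 1 ow d∣w (squarefree 1 refl) refl))
                 (trans (gap-product w (a′ + g′) (16 * (y * y)) (trans hu′ (cong (w * w +_) (quarter 16 y)))) (l y)))
        where
        l : ∀ y → 16 * (y * y) ≡ 4 * y * (4 * y)
        l = solve-∀
        m : ∀ w a b → w + 2 * (a + b) ≡ w + 2 * a + 2 * b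
        m = solve-∀
        cop₁ : Coprime (w + a′) a′
        cop₁ = coprime-gap {w} {a′} {2 * y} {1} (subst (λ v → v * v ≡ w * w + 1 * (2 * y * (2 * y))) v≡ hv) cop
                (λ _ _ → squarefree 1 refl)
        hu′ : (w + 2 * (a′ + g′)) * (w + 2 * (a′ + g′)) ≡ w * w + 16 * (2 * y * (2 * y))
        hu′ = trans (cong (λ z → z * z) (trans (m w a′ g′) (trans (cong (_+ 2 * g′) (sym v≡)) (sym u≡)))) hu
        hγ′ : (v + 2 * g′) * (v + 2 * g′) ≡ v * v + 15 * (2 * y * (2 * y))
        hγ′ = subst (λ u → u * u ≡ v * v + 15 * (2 * y * (2 * y))) u≡ hγ
        finish : (∃₂ λ s t → w + a′ ≡ s * s × a′ ≡ t * t × s * t ≡ y) →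
                 (∃₂ λ s t → w + (a′ + g′) ≡ s * s × a′ + g′ ≡ t * t × s * t ≡ 4 * y) → OddSolution y
        finish (A , A′ , A≡ , A′≡ , AA′) (B , B′ , B≡ , B′≡ , BB′) =
          descend₁₅ {A} {A′} {B} {B′} {y} {w} {v + g′} {g′} ow (subst₂ Coprime A≡ A′≡ cop₁) AA′ BB′
            (trans (sym A≡) (cong (w +_) A′≡))
            (trans (cong₂ (λ b a → b + 1 * a) (sym B≡) (sym A′≡)) (trans (e₁ w a′ g′) (cong (_+ g′) (sym v≡))))
            (trans (cong₂ (λ a b → a + 1 * b) (sym A≡) (sym B′≡)) (trans (e₂ w a′ g′) (cong (_+ g′) (sym v≡))))
            {y} (coprime-gap {v} {g′} {2 * y} {15} hγ′ cop-v (λ _ _ → squarefree 15 refl))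
            (trans (gap-product v g′ (15 * (y * y)) (trans hγ′ (cong (v * v +_) (quarter 15 y)))) (e₃ y))
          where
          e₁ : ∀ w a g → w + (a + g) + 1 * a ≡ w + 2 * a + g
          e₁ = solve-∀
          e₂ : ∀ w a g → w + a + 1 * (a + g) ≡ w + 2 * a + g
          e₂ = solve-∀
          e₃ : ∀ y → 15 * (y * y) ≡ 3 * (5 * (y * y))
          e₃ = solve-∀

  no-odd-solution₁₅ : ∀ x w → x ≢ 0 → ¬ (Odd w × Solution 1 w x)
  no-odd-solution₁₅ = infinite-descent {λ w x → Odd w × Solution 1 w x}
    (λ { {g} {w} g≢0 (o , s) → proj₁ (odd-*⁻ {w} {g} o) , scale-solution g≢0 s })
    λ { {w} {x} cop (ow , solution v u hv hu) → descent-step₁₅ {x} {w} {v} {u} cop ow hv hu }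

  -- If x is odd then w = 4s, and (x , s) is a solution with odd first entry: on X(X + 1)(X + 16)
  -- this is X ↦ 16/X, translation by the 2-torsion point (0, 0). Since it exchanges the two
  -- coordinates up to a factor, neither may vanish; w = 0 is a genuine solution.
  no-15 : ∀ {w x} → w ≢ 0 → x ≢ 0 → ¬ Solution 1 w x
  no-15 {w} {x} w≢0 x≢0 sol = coprime-reduction {λ w x → w ≢ 0 × Solution 1 w x}
    (λ { {g} {w} g≢0 (n , s) → (λ { refl → n refl }) , scale-solution g≢0 s })
    (λ { {w} {x} cop x≢0 (w≢0 , solution v u hv hu) → case odd-or-odd cop of λ
      { (inj₁ ow) → no-odd-solution₁₅ x w x≢0 (ow , solution v u hv hu)
      ; (inj₂ ox) → even {w} {x} {v} {u} (leg-divisible-by-4 {v} {w} {x} ox hv) ox w≢0 hv hu } })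
    x≢0 (w≢0 , sol)
    where
    even : ∀ {w x v u} → (∃ λ s → w ≡ s * 4) → Odd x → w ≢ 0 → v * v ≡ w * w + 1 * (x * x) → u * u ≡ w * w + 16 * (x * x) → ⊥
    even {w} {x} {v} {u} (s , refl) ox w≢0 hv hu =
      let u₀ , _ , hu₀ = square-of-4* {u} {x * x + 1 * (s * s)} (trans hu (l₁ s x))
      in no-odd-solution₁₅ s x (λ { refl → w≢0 refl }) (ox , solution u₀ v hu₀ (trans hv (l₂ s x)))
      where
      l₁ : ∀ s x → s * 4 * (s * 4) + 16 * (x * x) ≡ (x * x + 1 * (s * s)) * (4 * 4)
      l₁ = solve-∀
      l₂ : ∀ s x → s * 4 * (s * 4) + 1 * (x * x) ≡ x * x + 16 * (s * s)
      l₂ = solve-∀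

  -- The twist by 5, of conductor 75: w² + 5x² and w² + 80x²

  -- Suppose w = 2k and x is odd. The first equation modulo 8 makes k odd; then u = 2l and l² = k² +
  -- 20x² ≡ 5 modulo 8, which is impossible.
  odd-leg₇₅ : ∀ {v u w x} → Coprime w x → v * v ≡ w * w + 5 * (x * x) → u * u ≡ w * w + 80 * (x * x) → Odd w
  odd-leg₇₅ {v} {u} {w} {x} cop hv hu = case odd-or-odd cop of λ
    { (inj₁ ow) → ow
    ; (inj₂ ox) → case even-or-odd w of λ { (inj₂ ow) → ow ; (inj₁ (k , w≡)) → ⊥-elim (even k w≡ ox) } }
    where
    even : ∀ k → w ≡ 2 * k → Odd x → ⊥
    even k refl ox = go (even-or-odd u)
      where
      ok : Odd k
      ok = odd (consequence 8 3 (var 0F ⊠ var 0F ≗ lit 2 ⊠ var 1F ⊠ (lit 2 ⊠ var 1F) ⊞ lit 5 ⊠ (var 2F ⊠ var 2F) ∷ [])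
        (λ { (_ ∷ _ ∷ x ∷ []) → oddᵇ x }) (λ { (_ ∷ k ∷ _) → oddᵇ k }) refl (v ∷ k ∷ x ∷ []) (residue ox) hv)
      hu₄ : u * u ≡ 4 * (k * k + 20 * (x * x))
      hu₄ = trans hu (l k x)
        where
        l : ∀ k x → 2 * k * (2 * k) + 80 * (x * x) ≡ 4 * (k * k + 20 * (x * x))
        l = solve-∀
      go : (∃ λ l → u ≡ 2 * l) ⊎ Odd u → ⊥
      go (inj₁ (l , u≡)) = consequence 8 3 (var 0F ⊠ var 0F ≗ var 1F ⊠ var 1F ⊞ lit 20 ⊠ (var 2F ⊠ var 2F) ∷ [])
        (λ { (_ ∷ k ∷ x ∷ []) → oddᵇ k ∧ oddᵇ x }) (λ _ → false) refl (l ∷ k ∷ x ∷ []) (residue ok ,ᵀ residue ox)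
        (ℕₚ.*-cancelˡ-≡ (l * l) (k * k + 20 * (x * x)) 4 (trans (m l) (trans (sym (cong₂ _*_ u≡ u≡)) hu₄)))
        where
        m : ∀ l → 4 * (l * l) ≡ 2 * l * (2 * l)
        m = solve-∀
      go (inj₂ ou) = consequence 8 2 (var 0F ⊠ var 0F ≗ lit 4 ⊠ var 1F ∷ []) (λ { (u ∷ _) → oddᵇ u }) (λ _ → false) refl
        (u ∷ k * k + 20 * (x * x) ∷ []) (residue ou) hu₄

  even-leg₇₅ : ∀ {v w x} → Odd w → v * v ≡ w * w + 5 * (x * x) → ∃ λ y → x ≡ 2 * y
  even-leg₇₅ {v} {w} {x} ow e = case even-or-odd x of λ
    { (inj₁ p) → p
    ; (inj₂ ox) → ⊥-elim (consequence 8 3 (var 0F ⊠ var 0F ≗ var 1F ⊠ var 1F ⊞ lit 5 ⊠ (var 2F ⊠ var 2F) ∷ [])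
        (λ { (v ∷ w ∷ x ∷ []) → oddᵇ w ∧ oddᵇ x }) (λ _ → false) refl (v ∷ w ∷ x ∷ []) (residue ow ,ᵀ residue ox) e) }

  -- This treats the case where the factor 5 lies on different sides in (v ± w)/2 and (u ± w)/2.
  -- Modulo 3 the four squares add up to 0, so none or exactly three of the numbers are units. Three
  -- units would make exactly one of AA′ and BB′ divisible by 3, whereas AA′ ≡ BB′.
  mixed-classes : ∀ {A A′ B B′} → Coprime A A′ → Coprime B B′ → A * A + 1 * (B′ * B′) ≡ 5 * (A′ * A′ + 1 * (B * B)) →
                  (B * B′ ≡ 4 * (A * A′)) ⊎ (4 * (B * B′) ≡ A * A′) → ⊥
  mixed-classes {A} {A′} {B} {B′} cA cB e p = contradict (T-∨ (both p))
    where
    post : Vec ℕ 4 → Bool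
    post (a ∷ a′ ∷ b ∷ b′ ∷ []) = ((a ≡ᵇ 0) ∧ (a′ ≡ᵇ 0)) ∨ ((b ≡ᵇ 0) ∧ (b′ ≡ᵇ 0))
    both : (B * B′ ≡ 4 * (A * A′)) ⊎ (4 * (B * B′) ≡ A * A′) → T (post (Mod.residues 3 (A ∷ A′ ∷ B ∷ B′ ∷ [])))
    both (inj₁ r) = consequence 3 4
      (var 0F ⊠ var 0F ⊞ lit 1 ⊠ (var 3F ⊠ var 3F) ≗ lit 5 ⊠ (var 1F ⊠ var 1F ⊞ lit 1 ⊠
              (var 2F ⊠ var 2F)) ∷ var 2F ⊠ var 3F ≗ lit 4 ⊠ (var 0F ⊠ var 1F) ∷ [])
      (λ _ → true) post refl (A ∷ A′ ∷ B ∷ B′ ∷ []) tt (e , r)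
    both (inj₂ r) = consequence 3 4
      (var 0F ⊠ var 0F ⊞ lit 1 ⊠ (var 3F ⊠ var 3F) ≗ lit 5 ⊠ (var 1F ⊠ var 1F ⊞ lit 1 ⊠ (var 2F ⊠ var 2F)) ∷ lit 4 ⊠
              (var 2F ⊠ var 3F) ≗ var 0F ⊠ var 1F ∷ [])
      (λ _ → true) post refl (A ∷ A′ ∷ B ∷ B′ ∷ []) tt (e , r)
    common : ∀ {a b} → Coprime a b → T ((a % 3 ≡ᵇ 0) ∧ (b % 3 ≡ᵇ 0)) → ⊥
    common {a} {b} c t = let p , q = T-∧ {a % 3 ≡ᵇ 0} t in case c (T-≡ᵇ0 3 p , T-≡ᵇ0 3 q) of λ ()
    contradict : _ ⊎ _ → ⊥
    contradict (inj₁ t) = common cA t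
    contradict (inj₂ t) = common cB t

  -- 3 is not a square modulo 5, so 5 divides X and Z; then 25 divides 5Y².
  5∣-of-3-class : ∀ {X Y Z} → X * X + 5 * (Y * Y) ≡ 3 * (Z * Z) → 5 ∣ X × 5 ∣ Y
  5∣-of-3-class {X} {Y} {Z} e = go {X} {Y} {Z} (T-≡ᵇ0 5 (proj₁ t)) (T-≡ᵇ0 5 (proj₂ t)) e
    where
    t = T-∧ {X % 5 ≡ᵇ 0} {Z % 5 ≡ᵇ 0} (consequence 5 3 (var 0F ⊠ var 0F ⊞ lit 5 ⊠ (var 1F ⊠ var 1F) ≗ lit 3 ⊠
            (var 2F ⊠ var 2F) ∷ [])
      (λ _ → true) (λ { (x ∷ y ∷ z ∷ []) → (x ≡ᵇ 0) ∧ (z ≡ᵇ 0) }) refl (X ∷ Y ∷ Z ∷ []) tt e)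
    go : ∀ {X Y Z} → 5 ∣ X → 5 ∣ Z → X * X + 5 * (Y * Y) ≡ 3 * (Z * Z) → 5 ∣ X × 5 ∣ Y
    go {Y = Y} (divides i refl) (divides j refl) e = divides i refl ,
      T-≡ᵇ0 5 (consequence 5 3 (var 0F ⊠ var 0F ⊞ lit 5 ⊠ (var 1F ⊠ var 1F) ≗ lit 15 ⊠ (var 2F ⊠ var 2F) ∷ [])
              (λ _ → true) (λ { (y ∷ _) → y ≡ᵇ 0 }) refl (Y ∷ i ∷ j ∷ []) tt
        (ℕₚ.*-cancelˡ-≡ (Y * Y + 5 * (i * i)) (15 * (j * j)) 5 (trans (l Y i) (trans e (r j)))))
      where
      l : ∀ Y i → 5 * (Y * Y + 5 * (i * i)) ≡ i * 5 * (i * 5) + 5 * (Y * Y)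
      l = solve-∀
      r : ∀ j → 3 * (j * 5 * (j * 5)) ≡ 5 * (15 * (j * j))
      r = solve-∀

  descend₇₅ : ∀ {A A′ B B′ n y γ γ′} → Coprime A A′ → A * A′ ≡ y → B * B′ ≡ 4 * y →
              B * B + 5 * (A′ * A′) ≡ γ → A * A + 5 * (B′ * B′) ≡ γ →
              (∃₂ λ s t → γ ≡ 3 * (s * s) × γ′ ≡ t * t × s * t ≡ n) ⊎ (∃₂ λ s t → γ ≡ s * s × γ′ ≡ 3 * (t * t) × s * t ≡ n) →
              ∃ λ w → Solution 5 w y
  descend₇₅ {A} {A′} {B} {B′} cA AA′ BB′ f₁ f₂ (inj₁ (C , _ , e , _)) =
    case cA (proj₁ (5∣-of-3-class {A} {B′} {C} (trans f₂ e)) , proj₂ (5∣-of-3-class {B} {A′} {C} (trans f₁ e))) of λ ()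
  descend₇₅ {A} {A′} {B} {B′} cA AA′ BB′ f₁ f₂ (inj₂ (C , _ , e , _)) =
    A * B , subst (Solution 5 (A * B)) AA′ (descend 5 {A} {A′} {B} {B′} {C} (trans f₁ e) (trans f₂ e) (trans BB′ (cong
            (4 *_) (sym AA′))))

  coprime-divisors : ∀ {a b m n} → a ∣ m → b ∣ n → Coprime m n → Coprime a b
  coprime-divisors a∣m b∣n c (d∣a , d∣b) = c (∣-trans d∣a a∣m , ∣-trans d∣b b∣n)

  -- 75 is not squarefree, which leaves d = 5 to be excluded: it would divide v, hence w, and then
  -- 25 would divide the coefficient 5.
  gap-coprime₇₅ : ∀ {v w x d} → v * v ≡ w * w + 5 * (x * x) → Coprime w x → d ∣ v → d * d ∣ 75 → d ≡ 1
  gap-coprime₇₅ {v} {w} {x} {d} hv cop d∣v dd∣75 = go (one-or-five (ℕₚ.≤-trans (d≤d*d d) (∣⇒≤ dd∣75)) dd∣75) d∣v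
    where
    d≤d*d : ∀ d → d ≤ d * d
    d≤d*d zero = z≤n
    d≤d*d (suc d) = ℕₚ.m≤m*n (suc d) (suc d)
    one-or-five : ∀ {d} → d ≤ 75 → d * d ∣ 75 → d ≡ 1 ⊎ d ≡ 5
    one-or-five {d} d≤ dd∣ = go (d * d ∣? 75) refl
      where
      go : (q : Dec (d * d ∣ 75)) → does q ≡ does (d * d ∣? 75) → d ≡ 1 ⊎ d ≡ 5
      go (no ¬p) _ = ⊥-elim (¬p dd∣)
      go (yes _) e = Data.Sum.map (ℕₚ.≡ᵇ⇒≡ d 1) (ℕₚ.≡ᵇ⇒≡ d 5) (T-∨ (subst T (sym (trans (cong (λ b → if b then
              (d ≡ᵇ 1) ∨ (d ≡ᵇ 5) else true) e)
        (below-sound 76 (λ d → if does (d * d ∣? 75) then (d ≡ᵇ 1) ∨ (d ≡ᵇ 5) else true) refl {d} (s≤s d≤)))) tt))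
    go : d ≡ 1 ⊎ d ≡ 5 → d ∣ v → d ≡ 1
    go (inj₁ d≡1) _ = d≡1
    go (inj₂ d≡5) d∣v = ⊥-elim (case squarefree 5 refl {5} (common-divisor² {v} {w} {x} {5} hv cop 5∣v 5∣w) of λ ())
      where
      5∣v : 5 ∣ v
      5∣v = subst (_∣ v) d≡5 d∣v
      5∣w : 5 ∣ w
      5∣w = case euclidsLemma w w prime-5 (∣m+n∣m⇒∣n (subst (5 ∣_) (trans hv (ℕₚ.+-comm (w * w) _)) (∣m⇒∣m*n v 5∣v))
              (m∣m*n (x * x))) of λ
        { (inj₁ p) → p ; (inj₂ p) → p }

  descent-step₇₅ : ∀ {x w v u} → Coprime w x → v * v ≡ w * w + 5 * (x * x) → u * u ≡ w * w + 80 * (x * x) →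
                   ∃ λ y → x ≡ 2 * y × ∃ λ w′ → Solution 5 w′ y
  descent-step₇₅ {x} {w} {v} {u} cop hv hu = even (even-leg₇₅ {v} {w} {x} ow hv) cop hv hu
    where
    ow : Odd w
    ow = odd-leg₇₅ {v} {u} {w} {x} cop hv hu
    even : ∀ {x} → (∃ λ y → x ≡ 2 * y) → Coprime w x → v * v ≡ w * w + 5 * (x * x) → u * u ≡ w * w + 80 * (x * x) →
           ∃ λ y → x ≡ 2 * y × ∃ λ w′ → Solution 5 w′ y
    even (y , refl) cop hv hu = y , refl , gaps (odd-gap ov ow hv₄) (odd-gap ou ov hγ₄)
      where
      hv₄ : v * v ≡ w * w + 4 * (5 * (y * y))
      hv₄ = trans hv (cong (w * w +_) (quarter 5 y))
      hu₄ : u * u ≡ w * w + 4 * (80 * (y * y))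
      hu₄ = trans hu (cong (w * w +_) (quarter 80 y))
      hγ : u * u ≡ v * v + 75 * (2 * y * (2 * y))
      hγ = trans hu (trans (n w (2 * y)) (cong (_+ 75 * (2 * y * (2 * y))) (sym hv)))
        where
        n : ∀ w x → w * w + 80 * (x * x) ≡ w * w + 5 * (x * x) + 75 * (x * x)
        n = solve-∀
      hγ₄ : u * u ≡ v * v + 4 * (75 * (y * y))
      hγ₄ = trans hγ (cong (v * v +_) (quarter 75 y))
      ov : Odd v
      ov = odd-root {v} {w} {5 * (y * y)} ow hv₄
      ou : Odd u
      ou = odd-root {u} {w} {80 * (y * y)} ow hu₄
      cop-v : Coprime v (2 * y)
      cop-v = coprime-step {v} {w} {2 * y} {5} hv cop
      gaps : (∃ λ a → v ≡ w + 2 * a) → (∃ λ b → u ≡ v + 2 * b) → ∃ λ w′ → Solution 5 w′ y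
      gaps (a′ , v≡) (g′ , u≡) =
        finish (prime-square-factors {n = y} prime-5 cop₁
                 (gap-product w a′ (5 * (y * y)) (subst (λ v → v * v ≡ w * w + 4 * (5 * (y * y))) v≡ hv₄)))
               (prime-square-factors {n = 4 * y} prime-5 cop₂
                 (trans (gap-product w (a′ + g′) (80 * (y * y)) (trans hu′ (cong (w * w +_) (quarter 80 y)))) (l₂ y)))
               (prime-square-factors {n = 5 * y} prime-3 (coprime-gap {v} {g′} {2 * y} {75} hγ′ cop-v
                       (λ {d} _ d∣v → gap-coprime₇₅ {v} {w} {2 * y} {d} hv cop d∣v))
                 (trans (gap-product v g′ (75 * (y * y)) (trans hγ′ (cong (v * v +_) (quarter 75 y)))) (l₃ y)))
        where
        l₂ : ∀ y → 80 * (y * y) ≡ 5 * (4 * y * (4 * y))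
        l₂ = solve-∀
        l₃ : ∀ y → 75 * (y * y) ≡ 3 * (5 * y * (5 * y))
        l₃ = solve-∀
        m : ∀ w a b → w + 2 * (a + b) ≡ w + 2 * a + 2 * b
        m = solve-∀
        hu′ : (w + 2 * (a′ + g′)) * (w + 2 * (a′ + g′)) ≡ w * w + 80 * (2 * y * (2 * y))
        hu′ = trans (cong (λ z → z * z) (trans (m w a′ g′) (trans (cong (_+ 2 * g′) (sym v≡)) (sym u≡)))) hu
        hγ′ : (v + 2 * g′) * (v + 2 * g′) ≡ v * v + 75 * (2 * y * (2 * y))
        hγ′ = subst (λ u → u * u ≡ v * v + 75 * (2 * y * (2 * y))) u≡ hγ
        cop₁ : Coprime (w + a′) a′
        cop₁ = coprime-gap {w} {a′} {2 * y} {5} (subst (λ v → v * v ≡ w * w + 5 * (2 * y * (2 * y))) v≡ hv) cop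
                (λ _ _ → squarefree 5 refl)
        cop₂ : Coprime (w + (a′ + g′)) (a′ + g′)
        cop₂ = coprime-gap {w} {a′ + g′} {2 * y} {80} hu′ cop (λ _ d∣w → odd-square-gap-coprime 5 ow d∣w (squarefree 5 refl) refl)
        γ₁ : w + (a′ + g′) + a′ ≡ v + g′
        γ₁ = trans (e w a′ g′) (cong (_+ g′) (sym v≡))
          where
          e : ∀ w a g → w + (a + g) + a ≡ w + 2 * a + g
          e = solve-∀
        γ₂ : w + a′ + (a′ + g′) ≡ v + g′
        γ₂ = trans (e w a′ g′) (cong (_+ g′) (sym v≡))
          where
          e : ∀ w a g → w + a + (a + g) ≡ w + 2 * a + g
          e = solve-∀
        Factors : (a b p n : ℕ) → Set
        Factors a b p n = (∃₂ λ s t → a ≡ p * (s * s) × b ≡ t * t × s * t ≡ n) ⊎ (∃₂ λ s t → a ≡ s * s × b ≡ p *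
                (t * t) × s * t ≡ n)
        square∣ : ∀ {a s} → a ≡ s * s → s ∣ a
        square∣ {_} {s} e = divides s e
        multiple∣ : ∀ {a s} p → a ≡ p * (s * s) → s ∣ a
        multiple∣ {_} {s} p e = divides (p * s) (trans e (sym (ℕₚ.*-assoc p s s)))
        mixed₁ : w + a′ + 1 * (a′ + g′) ≡ a′ + (w + (a′ + g′))
        mixed₁ = e w a′ g′
          where
          e : ∀ w a g → w + a + 1 * (a + g) ≡ a + (w + (a + g))
          e = solve-∀
        mixed₂ : w + (a′ + g′) + 1 * a′ ≡ a′ + g′ + (w + a′)
        mixed₂ = e w a′ g′
          where
          e : ∀ w a g → w + (a + g) + 1 * a ≡ a + g + (w + a)
          e = solve-∀
        distribute : ∀ m n → 5 * m + 5 * n ≡ 5 * (m + 1 * n)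
        distribute = solve-∀
        -- The cases record on which side the factor 5 lies in (v ± w)/2 and in (u ± w)/2. Equal
        -- sides descend; opposite sides contradict `mixed-classes`.
        finish : Factors (w + a′) a′ 5 y → Factors (w + (a′ + g′)) (a′ + g′) 5 (4 * y) →
            Factors (v + g′) g′ 3 (5 * y) → ∃ λ w′ → Solution 5 w′ y
        finish (inj₂ (A , A′ , A≡ , A′≡ , AA′)) (inj₂ (B , B′ , B≡ , B′≡ , BB′)) =
          descend₇₅ {A} {A′} {B} {B′} {5 * y} {y} {v + g′} {g′} (coprime-divisors (square∣ A≡) (multiple∣ 5 A′≡) cop₁) AA′ BB′
            (trans (cong₂ _+_ (sym B≡) (sym A′≡)) γ₁) (trans (cong₂ _+_ (sym A≡) (sym B′≡)) γ₂)
        finish (inj₁ (A , A′ , A≡ , A′≡ , AA′)) (inj₁ (B , B′ , B≡ , B′≡ , BB′)) =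
          descend₇₅ {A′} {A} {B′} {B} {5 * y} {y} {v + g′} {g′} (Coprimality.sym (coprime-divisors (multiple∣ 5 A≡)
                  (square∣ A′≡) cop₁))
            (trans (ℕₚ.*-comm A′ A) AA′) (trans (ℕₚ.*-comm B′ B) BB′)
            (trans (cong₂ _+_ (sym B′≡) (sym A≡)) (trans (ℕₚ.+-comm (a′ + g′) (w + a′)) γ₂))
            (trans (cong₂ _+_ (sym A′≡) (sym B≡)) (trans (ℕₚ.+-comm a′ (w + (a′ + g′))) γ₁))
        finish (inj₂ (A , A′ , A≡ , A′≡ , AA′)) (inj₁ (B , B′ , B≡ , B′≡ , BB′)) _ = ⊥-elim (mixed-classes {A} {A′} {B} {B′}
          (coprime-divisors (square∣ A≡) (multiple∣ 5 A′≡) cop₁) (coprime-divisors (multiple∣ 5 B≡) (square∣ B′≡) cop₂)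
          (trans (cong₂ (λ a b → a + 1 * b) (sym A≡) (sym B′≡)) (trans mixed₁ (trans (cong₂ _+_ A′≡ B≡) (distribute
                  (A′ * A′) (B * B)))))
          (inj₁ (trans BB′ (cong (4 *_) (sym AA′)))))
        finish (inj₁ (A , A′ , A≡ , A′≡ , AA′)) (inj₂ (B , B′ , B≡ , B′≡ , BB′)) _ = ⊥-elim (mixed-classes {B} {B′} {A} {A′}
          (coprime-divisors (square∣ B≡) (multiple∣ 5 B′≡) cop₂) (coprime-divisors (multiple∣ 5 A≡) (square∣ A′≡) cop₁)
          (trans (cong₂ (λ a b → a + 1 * b) (sym B≡) (sym A′≡)) (trans mixed₂ (trans (cong₂ _+_ B′≡ A≡) (distribute
                  (B′ * B′) (A * A)))))
          (inj₂ (trans (cong (4 *_) AA′) (sym BB′))))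

  no-75 : ∀ {w x} → x ≢ 0 → ¬ Solution 5 w x
  no-75 {w} {x} = infinite-descent {λ w x → Solution 5 w x} scale-solution
    (λ { {w} {x} cop (solution v u hv hu) → descent-step₇₅ {x} {w} {v} {u} cop hv hu }) x w

open Descent
open Mod using (consequence)
import Data.Integer as ℤ
open ℤ using (ℤ; +_; -[1+_]; ∣_∣)
import Data.Integer.Properties as ℤₚ
import Data.Integer.Tactic.RingSolver as ℤ-Solver
open import Data.Rational using (mkℚ; _+_; _*_; _-_; -_; 1/_; toℚᵘ; ↥_; ↧_; ↧ₙ_; ≢-nonZero)
import Data.Rational.Properties as ℚₚ
import Data.Rational.Unnormalised as ℚᵘ
import Data.Rational.Unnormalised.Properties as ℚᵘₚ
import Tactic.RingSolver.Core.AlmostCommutativeRing as ACR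
open import Tactic.RingSolver using (solve-∀; solve)

-- From rational to natural solutions

ringℚ : ACR.AlmostCommutativeRing _ _
ringℚ = ACR.fromCommutativeRing ℚₚ.+-*-commutativeRing (λ x → dec⇒maybe (0ℚ ℚₚ.≟ x))

κᵘ : ∀ z → toℚᵘ (κ z) ℚᵘ.≃ ℚᵘ.mkℚᵘ z 0
κᵘ z = ℚₚ.toℚᵘ-fromℚᵘ (ℚᵘ.mkℚᵘ z 0)

κ-injective : ∀ {a b} → κ a ≡ κ b → a ≡ b
κ-injective {a} {b} e with ℚᵘₚ.≃-trans (ℚᵘₚ.≃-sym (κᵘ a)) (ℚᵘₚ.≃-trans (ℚᵘₚ.≃-reflexive (cong toℚᵘ e)) (κᵘ b))
... | ℚᵘ.*≡* p = trans (sym (ℤₚ.*-identityʳ a)) (trans p (ℤₚ.*-identityʳ b))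

κ-+ : ∀ a b → κ (a ℤ.+ b) ≡ κ a + κ b
κ-+ a b = ℚₚ.toℚᵘ-injective (ℚᵘₚ.≃-trans (κᵘ (a ℤ.+ b)) (ℚᵘₚ.≃-trans
  (ℚᵘ.*≡* (cong (ℤ._* + 1) (cong₂ ℤ._+_ (sym (ℤₚ.*-identityʳ a)) (sym (ℤₚ.*-identityʳ b)))))
  (ℚᵘₚ.≃-sym (ℚᵘₚ.≃-trans (ℚₚ.toℚᵘ-homo-+ (κ a) (κ b)) (ℚᵘₚ.+-cong (κᵘ a) (κᵘ b))))))

κ-* : ∀ a b → κ (a ℤ.* b) ≡ κ a * κ b
κ-* a b = ℚₚ.toℚᵘ-injective (ℚᵘₚ.≃-trans (κᵘ (a ℤ.* b))
  (ℚᵘₚ.≃-sym (ℚᵘₚ.≃-trans (ℚₚ.toℚᵘ-homo-* (κ a) (κ b)) (ℚᵘₚ.*-cong (κᵘ a) (κᵘ b)))))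

*-denominator : ∀ q → q * κ (↧ q) ≡ κ (↥ q)
*-denominator q@(mkℚ n d-1 _) = ℚₚ.toℚᵘ-injective (ℚᵘₚ.≃-trans (ℚₚ.toℚᵘ-homo-* q (κ (↧ q)))
  (ℚᵘₚ.≃-trans (ℚᵘₚ.*-cong (ℚᵘₚ.≃-refl {toℚᵘ q}) (κᵘ (↧ q))) (ℚᵘₚ.≃-trans
    (ℚᵘ.*≡* (trans (ℤₚ.*-identityʳ _) (cong (λ z → n ℤ.* + z) (sym (ℕₚ.*-identityʳ (suc d-1))))))
    (ℚᵘₚ.≃-sym (κᵘ n)))))

zero-product : ∀ p q → p * q ≡ 0ℚ → p ≡ 0ℚ ⊎ q ≡ 0ℚ
zero-product p q e with p ℚₚ.≟ 0ℚ
... | yes p≡0 = inj₁ p≡0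
... | no p≢0 = inj₂ (trans (sym (ℚₚ.*-identityˡ q)) (trans (cong (_* q) (sym (ℚₚ.*-inverseˡ p)))
                 (trans (ℚₚ.*-assoc (1/ p) p q) (trans (cong (1/ p *_) e) (ℚₚ.*-zeroʳ (1/ p))))))
  where instance _ = ≢-nonZero p≢0

difference-zero : ∀ {a b} → a - b ≡ 0ℚ → a ≡ b
difference-zero {a} {b} e = trans (l a b) (trans (cong (_+ b) e) (ℚₚ.+-identityˡ b))
  where
  l : ∀ a b → a ≡ a - b + b
  l = solve-∀ ringℚ

difference-zero⁻ : ∀ {a b} → a ≡ b → a - b ≡ 0ℚ
difference-zero⁻ {a} refl = ℚₚ.+-inverseʳ a

multiple : ∀ {a b} c → a ≡ b → c * (a - b) ≡ 0ℚ
multiple c h = trans (cong (c *_) (difference-zero⁻ h)) (ℚₚ.*-zeroʳ c)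

zero-sum : ∀ {a b} → a ≡ 0ℚ → b ≡ 0ℚ → a + b ≡ 0ℚ
zero-sum h h′ = trans (cong₂ _+_ h h′) (ℚₚ.+-identityˡ 0ℚ)

-- Together with `multiple` and `zero-sum` this proves a consequence of polynomial equations aᵢ = bᵢ
-- from cofactors cᵢ: the identity L - R = Σ cᵢ(aᵢ - bᵢ) is left to the ring solver. The cofactors
-- in the lemmas below are such ideal-membership certificates.
equal-up-to : ∀ {L R Z} → Z ≡ 0ℚ → L - R ≡ Z → L ≡ R
equal-up-to z e = difference-zero (trans e z)

record Integral (d : ℤ) (q : ℚ) : Set where
  constructor _,_
  field
    numerator : ℤ
    clears : q * κ d ≡ κ numerator
  size : ℕ
  size = ∣ numerator ∣
open Integral using (size)

integral-*ʳ : ∀ {d q} e → Integral d q → Integral (d ℤ.* e) q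
integral-*ʳ {d} {q} e (n , h) = n ℤ.* e , trans (cong (q *_) (κ-* d e)) (trans (sym (ℚₚ.*-assoc q (κ d) (κ e)))
  (trans (cong (_* κ e) h) (sym (κ-* n e))))

integral-*ˡ : ∀ {d q} e → Integral d q → Integral (e ℤ.* d) q
integral-*ˡ {d} {q} e h = subst (λ z → Integral z q) (ℤₚ.*-comm d e) (integral-*ʳ e h)

integral : ∀ q → Integral (↧ q) q
integral q = ↥ q , *-denominator q

*-≢0 : ∀ {a b : ℤ} → a ≢ + 0 → b ≢ + 0 → a ℤ.* b ≢ + 0
*-≢0 {a} na nb e = case ℤₚ.i*j≡0⇒i≡0∨j≡0 a e of λ { (inj₁ p) → na p ; (inj₂ p) → nb p }

Cleared : ℚ → ℚ → ℚ → ℚ → Set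
Cleared a b c d = ∃ λ e → e ≢ + 0 × Integral e a × Integral e b × Integral e c × Integral e d

common-denominator : ∀ a b c d → Cleared a b c d
common-denominator a b c d = (↧ a ℤ.* ↧ b) ℤ.* (↧ c ℤ.* ↧ d) , *-≢0 (*-≢0 (n a) (n b)) (*-≢0 (n c) (n d)) ,
  integral-*ʳ (↧ c ℤ.* ↧ d) (integral-*ʳ (↧ b) (integral a)) , integral-*ʳ (↧ c ℤ.* ↧ d) (integral-*ˡ (↧ a) (integral b)) ,
  integral-*ˡ (↧ a ℤ.* ↧ b) (integral-*ʳ (↧ d) (integral c)) , integral-*ˡ (↧ a ℤ.* ↧ b) (integral-*ˡ (↧ c) (integral d))
  where
  n : ∀ q → ↧ q ≢ + 0
  n q ()

square-∣∣ : ∀ z → z ℤ.* z ≡ + (∣ z ∣ ℕ.* ∣ z ∣)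
square-∣∣ (+ n) = sym (ℤₚ.pos-* n n)
square-∣∣ -[1+ n ] = refl

-- Multiplying by the common denominator `e` makes the numbers integral. Only their squares occur,
-- so absolute values may replace them.
transfer : ∀ {e X Y Z} k → X * X ≡ Y * Y + κ (+ k) * (Z * Z) → (x : Integral e X) (y : Integral e Y) (z : Integral e Z) →
           size x ℕ.* size x ≡ size y ℕ.* size y ℕ.+ k ℕ.* (size z ℕ.* size z)
transfer {e} {X} {Y} {Z} k h (x , hx) (y , hy) (z , hz) = ℤₚ.+-injective (trans (sym (square-∣∣ x)) (trans ints
    (trans (cong₂ ℤ._+_ (square-∣∣ y) (cong (+ k ℤ.*_) (square-∣∣ z)))
      (trans (cong (λ t → + (∣ y ∣ ℕ.* ∣ y ∣) ℤ.+ t) (sym (ℤₚ.pos-* k _))) (sym (ℤₚ.pos-+ (∣ y ∣ ℕ.* ∣ y ∣) _))))))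
  where
  scale : ∀ X Y Z k e → X * e * (X * e) - (Y * e * (Y * e) + k * (Z * e * (Z * e))) ≡ e * e * (X * X - (Y * Y + k * (Z * Z)))
  scale = solve-∀ ringℚ
  rats : κ x * κ x ≡ κ y * κ y + κ (+ k) * (κ z * κ z)
  rats = subst₂ (λ a b → a ≡ b) (cong₂ _*_ hx hx) (cong₂ _+_ (cong₂ _*_ hy hy) (cong (κ (+ k) *_) (cong₂ _*_ hz hz)))
    (equal-up-to (multiple (κ e * κ e) h) (scale X Y Z (κ (+ k)) (κ e)))
  ints : x ℤ.* x ≡ y ℤ.* y ℤ.+ + k ℤ.* (z ℤ.* z)
  ints = κ-injective (trans (κ-* x x) (trans rats (sym (trans (κ-+ (y ℤ.* y) _)
    (cong₂ _+_ (κ-* y y) (trans (κ-* (+ k) (z ℤ.* z)) (cong (κ (+ k) *_) (κ-* z z))))))))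

size-zero : ∀ {e q} → e ≢ + 0 → (i : Integral e q) → size i ≡ 0 → q ≡ 0ℚ
size-zero {e} {q} e≢0 (n , h) z with ℤₚ.∣i∣≡0⇒i≡0 {n} z
... | refl = case zero-product q (κ e) h of λ { (inj₁ p) → p ; (inj₂ p) → ⊥-elim (e≢0 (κ-injective p)) }

no-17ℚ : ∀ W x V U → V * V ≡ W * W + κ (+ 1) * (x * x) → W * W ≡ U * U + κ (+ 16) * (x * x) → x ≡ 0ℚ
no-17ℚ W x V U hv hu = go (common-denominator W x V U)
  where
  go : Cleared W x V U → x ≡ 0ℚ
  go (e , e≢0 , w , n , v , u) = case size n ℕₚ.≟ 0 of λ
    { (yes z) → size-zero e≢0 n z
    ; (no n≢0) → ⊥-elim (no-17 {size w} {size n} n≢0 ((size v , transfer 1 hv v w n) , size u , transfer 16 hu w u n)) }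

no-75ℚ : ∀ W x V U → V * V ≡ W * W + κ (+ 5) * (x * x) → U * U ≡ W * W + κ (+ 80) * (x * x) → x ≡ 0ℚ
no-75ℚ W x V U hv hu = go (common-denominator W x V U)
  where
  go : Cleared W x V U → x ≡ 0ℚ
  go (e , e≢0 , w , n , v , u) = case size n ℕₚ.≟ 0 of λ
    { (yes z) → size-zero e≢0 n z
    ; (no n≢0) → ⊥-elim (no-75 {size w} {size n} n≢0 (solution (size v) (size u) (transfer 5 hv v w n) (transfer 80 hu u w n))) }

no-15ℚ : ∀ W x V U → V * V ≡ W * W + κ (+ 1) * (x * x) → U * U ≡ W * W + κ (+ 16) * (x * x) → W ≡ 0ℚ ⊎ x ≡ 0ℚ
no-15ℚ W x V U hv hu = go (common-denominator W x V U)
  where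
  go : Cleared W x V U → W ≡ 0ℚ ⊎ x ≡ 0ℚ
  go (e , e≢0 , w , n , v , u) = case size n ℕₚ.≟ 0 of λ
    { (yes z) → inj₂ (size-zero e≢0 n z)
    ; (no n≢0) → case size w ℕₚ.≟ 0 of λ
      { (yes z) → inj₁ (size-zero e≢0 w z)
      ; (no w≢0) → ⊥-elim (no-15 {size w} {size n} w≢0 n≢0 (solution (size v) (size u) (transfer 1 hv v w n)
              (transfer 16 hu u w n))) } }

-- In lowest or any other terms, a² = n b² makes b² divide a², hence b divide a. The result also
-- carries the sign of n, which settles the negative cases.
integer-square : ∀ {r n} → r * r ≡ κ n → ∃ λ m → n ≡ + (m ℕ.* m)
integer-square {r} {n} h = go (∣-from-squares (↧ₙ r) ∣ ↥ r ∣ (divides ∣ n ∣ abs))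
  where
  l : ∀ r n d → r * d * (r * d) - n * (d * d) ≡ d * d * (r * r - n)
  l = solve-∀ ringℚ
  ints : ↥ r ℤ.* ↥ r ≡ n ℤ.* (↧ r ℤ.* ↧ r)
  ints = κ-injective (trans (κ-* (↥ r) (↥ r)) (trans (cong₂ _*_ (sym (*-denominator r)) (sym (*-denominator r)))
    (trans (equal-up-to (multiple (κ (↧ r) * κ (↧ r)) h) (l r (κ n) (κ (↧ r)))) (sym (trans (κ-* n _) (cong (κ n *_)
            (κ-* (↧ r) (↧ r))))))))
  abs : ∣ ↥ r ∣ ℕ.* ∣ ↥ r ∣ ≡ ∣ n ∣ ℕ.* (↧ₙ r ℕ.* ↧ₙ r)
  abs = trans (sym (ℤₚ.abs-* (↥ r) (↥ r))) (trans (cong ∣_∣ ints) (trans (ℤₚ.abs-* n (↧ r ℤ.* ↧ r)) (cong (∣ n ∣ ℕ.*_)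
          (ℤₚ.abs-* (↧ r) (↧ r)))))
  rearrange : ∀ k d → k ℕ.* d ℕ.* (k ℕ.* d) ≡ k ℕ.* k ℕ.* (d ℕ.* d)
  rearrange = ℕ-Solver.solve-∀
  go : ↧ₙ r ∣ ∣ ↥ r ∣ → ∃ λ m → n ≡ + (m ℕ.* m)
  go (divides k eq) = k , ℤₚ.*-cancelʳ-≡ n (+ (k ℕ.* k)) (↧ r ℤ.* ↧ r) (trans (sym ints) (trans (square-∣∣ (↥ r))
    (trans (cong +_ (trans (cong₂ ℕ._*_ eq eq) (rearrange k (↧ₙ r)))) (ℤₚ.pos-* (k ℕ.* k) _))))

non-square-mod-3 : ∀ {r n} → T (n ℕ.% 3 ℕ.≡ᵇ 2) → r * r ≢ κ (+ n)
non-square-mod-3 {r} {n} n2 h = go (integer-square {r} h)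
  where
  go : (∃ λ m → + n ≡ + (m ℕ.* m)) → ⊥
  go (m , e) = consequence 3 2 (var 0F ≗ var 1F ⊠ var 1F ∷ []) (λ { (n ∷ _) → n ℕ.≡ᵇ 2 }) (λ _ → false) refl
          (n ∷ m ∷ []) n2 (ℤₚ.+-injective e)

square-not-negative : ∀ {r n} → r * r ≢ κ -[1+ n ]
square-not-negative {r} {n} h = go (integer-square {r} h)
  where
  go : (∃ λ m → -[1+ n ] ≡ + (m ℕ.* m)) → ⊥
  go (_ , ())

not-minus-3 : ∀ r → r * r + κ (+ 3) ≢ 0ℚ
not-minus-3 r e = square-not-negative {r} {2} (difference-zero (trans (l r) e))
  where
  l : ∀ r → r * r - κ -[1+ 2 ] ≡ r * r + κ (+ 3)
  l = solve-∀ ringℚ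

not-minus-15 : ∀ r → r * r + κ (+ 15) ≢ 0ℚ
not-minus-15 r e = square-not-negative {r} {14} (difference-zero (trans (l r) e))
  where
  l : ∀ r → r * r - κ -[1+ 14 ] ≡ r * r + κ (+ 15)
  l = solve-∀ ringℚ

-- Rational points on y² = f₁ and on its twist by 5

units : ∀ q → q * q - κ (+ 1) ≡ 0ℚ → IsPM (κ (+ 1)) q
units q e = case zero-product (q - κ (+ 1)) (q - - κ (+ 1)) (trans (l q) e) of λ
  { (inj₁ p) → inj₁ (difference-zero p) ; (inj₂ p) → inj₂ (difference-zero p) }
  where
  l : ∀ q → (q - κ (+ 1)) * (q - - κ (+ 1)) ≡ q * q - κ (+ 1)
  l = solve-∀ ringℚ

sqrt-5 : ∀ q → κ (+ 5) * q * q - κ (+ 1) ≡ κ (+ 0) → κ (+ 5) * q * (κ (+ 5) * q) ≡ κ (+ 5)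
sqrt-5 q h₁ = equal-up-to (multiple (κ (+ 5)) h₁) (solve (q List.∷ List.[]) ringℚ)

f₁-nonzero : ∀ q → (κ (+ 5) * q * q - κ (+ 1)) * (q * q + κ (+ 3)) ≢ 0ℚ
f₁-nonzero q e = case zero-product (κ (+ 5) * q * q - κ (+ 1)) (q * q + κ (+ 3)) e of λ
  { (inj₁ p) → non-square-mod-3 {κ (+ 5) * q} {5} tt (sqrt-5 q p)
  ; (inj₂ p) → not-minus-3 q p }

-- On X(X − 1)(X + 15) the double of the point over X = 5q² has abscissa X₂ with X₂ − 1 = (W/x)², X₂ = (V/x)²
-- and X₂ + 15 = (U/x)², where W = (q² − 1)(5q² + 3), x = 2qy, V = 5q⁴ + 3 and U = 5q⁴ + 30q² − 3.
E₁-first : ∀ q y → y * y ≡ (κ (+ 5) * q * q - κ (+ 1)) * (q * q + κ (+ 3)) →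
    (κ (+ 5) * q * q * q * q + κ (+ 3)) * (κ (+ 5) * q * q * q * q + κ (+ 3))
    ≡ (q * q - κ (+ 1)) * (κ (+ 5) * q * q + κ (+ 3)) * ((q * q - κ (+ 1)) * (κ (+ 5) * q * q + κ (+ 3)))
    + κ (+ 1) * (κ (+ 2) * q * y * (κ (+ 2) * q * y))
E₁-first q y h₁ = equal-up-to (multiple (- (κ (+ 4) * q * q)) h₁) (solve (q List.∷ y List.∷ List.[]) ringℚ)

E₁-second : ∀ q y → y * y ≡ (κ (+ 5) * q * q - κ (+ 1)) * (q * q + κ (+ 3)) →
    (κ (+ 5) * q * q * q * q + κ (+ 30) * q * q - κ (+ 3)) * (κ (+ 5) * q * q * q * q + κ (+ 30) * q * q - κ (+ 3))
    ≡ (q * q - κ (+ 1)) * (κ (+ 5) * q * q + κ (+ 3)) * ((q * q - κ (+ 1)) * (κ (+ 5) * q * q + κ (+ 3)))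
    + κ (+ 16) * (κ (+ 2) * q * y * (κ (+ 2) * q * y))
E₁-second q y h₁ = equal-up-to (multiple (- (κ (+ 64) * q * q)) h₁) (solve (q List.∷ y List.∷ List.[]) ringℚ)

5q²+3 : ∀ q → κ (+ 5) * q * q + κ (+ 3) ≡ κ (+ 0) → κ (+ 5) * q * (κ (+ 5) * q) + κ (+ 15) ≡ κ (+ 0)
5q²+3 q h₁ = equal-up-to (multiple (κ (+ 5)) h₁) (solve (q List.∷ List.[]) ringℚ)

E₁-at-0 : ∀ q y → y * y ≡ (κ (+ 5) * q * q - κ (+ 1)) * (q * q + κ (+ 3)) → q ≡ κ (+ 0) → y * y + κ (+ 3) ≡ κ (+ 0)
E₁-at-0 q y h₁ h₂ = equal-up-to (zero-sum (multiple (κ (+ 1)) h₁) (multiple (q * (κ (+ 5) * q * q + κ (+ 14))) h₂))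
    (solve (q List.∷ y List.∷ List.[]) ringℚ)

E₁-points : ∀ q y → y * y ≡ (κ (+ 5) * q * q - κ (+ 1)) * (q * q + κ (+ 3)) → IsPM (κ (+ 1)) q
E₁-points q y h = case no-15ℚ ((q * q - κ (+ 1)) * (κ (+ 5) * q * q + κ (+ 3))) (κ (+ 2) * q * y)
        (κ (+ 5) * q * q * q * q + κ (+ 3)) (κ (+ 5) * q * q * q * q + κ (+ 30) * q * q - κ (+ 3)) (E₁-first q y h)
        (E₁-second q y h) of λ
  { (inj₁ e) → case zero-product (q * q - κ (+ 1)) (κ (+ 5) * q * q + κ (+ 3)) e of λ
      { (inj₁ p) → units q p
      ; (inj₂ p) → ⊥-elim (not-minus-15 (κ (+ 5) * q) (5q²+3 q p)) }
  ; (inj₂ e) → ⊥-elim (case zero-product (κ (+ 2) * q) y e of λ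
      { (inj₁ e′) → case zero-product (κ (+ 2)) q e′ of λ { (inj₂ q≡0) → not-minus-3 y (E₁-at-0 q y h q≡0) }
      ; (inj₂ y≡0) → f₁-nonzero q (trans (sym h) (trans (cong (y *_) y≡0) (ℚₚ.*-zeroʳ y))) }) }

-- The doubling identity scaled by 25: the difference 4q²f₁ is now 20q²y², and 25 · 20q²y² =
-- 5(10qy)². The companion with 80 arises in the same way.
E₁-twist-first : ∀ q y → κ (+ 5) * (y * y) ≡ (κ (+ 5) * q * q - κ (+ 1)) * (q * q + κ (+ 3)) →
    κ (+ 5) * (κ (+ 5) * q * q * q * q + κ (+ 3)) * (κ (+ 5) * (κ (+ 5) * q * q * q * q + κ (+ 3)))
    ≡ κ (+ 5) * ((q * q - κ (+ 1)) * (κ (+ 5) * q * q + κ (+ 3))) * (κ (+ 5) * ((q * q - κ (+ 1)) * (κ (+ 5) * q * q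
    + κ (+ 3)))) + κ (+ 5) * (κ (+ 10) * q * y * (κ (+ 10) * q * y))
E₁-twist-first q y h₁ = equal-up-to (multiple (- (κ (+ 100) * q * q)) h₁) (solve (q List.∷ y List.∷ List.[]) ringℚ)

E₁-twist-second : ∀ q y → κ (+ 5) * (y * y) ≡ (κ (+ 5) * q * q - κ (+ 1)) * (q * q + κ (+ 3)) →
    κ (+ 5) * (κ (+ 5) * q * q * q * q + κ (+ 30) * q * q - κ (+ 3)) * (κ (+ 5) * (κ (+ 5) * q * q * q * q
    + κ (+ 30) * q * q - κ (+ 3)))
    ≡ κ (+ 5) * ((q * q - κ (+ 1)) * (κ (+ 5) * q * q + κ (+ 3))) * (κ (+ 5) * ((q * q - κ (+ 1)) * (κ (+ 5) * q * q
    + κ (+ 3)))) + κ (+ 80) * (κ (+ 10) * q * y * (κ (+ 10) * q * y))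
E₁-twist-second q y h₁ = equal-up-to (multiple (- (κ (+ 1600) * q * q)) h₁) (solve (q List.∷ y List.∷ List.[]) ringℚ)

E₁-twist-at-0 : ∀ q y → κ (+ 5) * (y * y) ≡ (κ (+ 5) * q * q - κ (+ 1)) * (q * q + κ (+ 3)) → q ≡ κ (+ 0) →
    κ (+ 5) * y * (κ (+ 5) * y) + κ (+ 15) ≡ κ (+ 0)
E₁-twist-at-0 q y h₁ h₂ = equal-up-to (zero-sum (multiple (κ (+ 5)) h₁)
    (multiple (κ (+ 5) * q * (κ (+ 5) * q * q + κ (+ 14))) h₂)) (solve (q List.∷ y List.∷ List.[]) ringℚ)

E₁-twist-points : ∀ q y → κ (+ 5) * (y * y) ≢ (κ (+ 5) * q * q - κ (+ 1)) * (q * q + κ (+ 3))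
E₁-twist-points q y h = case zero-product (κ (+ 10) * q) y (no-75ℚ (κ (+ 5) * ((q * q - κ (+ 1)) *
        (κ (+ 5) * q * q + κ (+ 3)))) (κ (+ 10) * q * y) (κ (+ 5) * (κ (+ 5) * q * q * q * q + κ (+ 3))) (κ (+ 5) *
        (κ (+ 5) * q * q * q * q + κ (+ 30) * q * q - κ (+ 3)))
    (E₁-twist-first q y h) (E₁-twist-second q y h)) of λ
  { (inj₁ e′) → case zero-product (κ (+ 10)) q e′ of λ { (inj₂ q≡0) → not-minus-15 (κ (+ 5) * y) (E₁-twist-at-0 q y h q≡0) }
  ; (inj₂ y≡0) → f₁-nonzero q (trans (sym h) (trans (cong (λ t → κ (+ 5) * (y * t)) y≡0) (trans (cong (κ (+ 5) *_)
          (ℚₚ.*-zeroʳ y)) (ℚₚ.*-zeroʳ (κ (+ 5)))))) }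

-- Rational points on z² = f₂

-- Put P = 2(q² + 1) + z, D = q² - 1, S = 8q - D. Then 4(q² + 1)² - f₂ = DS, so P² + DS = 4(q² +
-- 1)P. Also 16(q² + 1)² = 16D² + (8q)² = 17D² + 2DS + S². Squaring the former and inserting the
-- latter yields P²(P² - 17D²) = S²(P² - D²). So X = (P² - D²)/D² is the abscissa of a point on X(X
-- + 1)(X - 16) when D ≠ 0.
E₂-relation : ∀ q z → z * z
    ≡ κ (+ 5) * q * q * q * q - κ (+ 8) * q * q * q + κ (+ 6) * q * q + κ (+ 8) * q + κ (+ 5) →
    ((κ (+ 2) * (q * q + κ (+ 1)) + z) * (κ (+ 2) * (q * q + κ (+ 1)) + z) - (q * q - κ (+ 1)) * (q * q - κ (+ 1))
    + (q * q - κ (+ 1)) * (q * q - κ (+ 1))) * ((κ (+ 2) * (q * q + κ (+ 1)) + z) * (κ (+ 2) * (q * q + κ (+ 1)) + z)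
    - (q * q - κ (+ 1)) * (q * q - κ (+ 1)) - κ (+ 16) * ((q * q - κ (+ 1)) * (q * q - κ (+ 1))))
    ≡ (κ (+ 8) * q - (q * q - κ (+ 1))) * (κ (+ 8) * q - (q * q - κ (+ 1))) * ((κ (+ 2) * (q * q + κ (+ 1))
    + z) * (κ (+ 2) * (q * q + κ (+ 1)) + z) - (q * q - κ (+ 1)) * (q * q - κ (+ 1)))
E₂-relation q z h₁ = equal-up-to
    (multiple (z * z + κ (+ 8) * (q * q + κ (+ 1)) * z + κ (+ 16) * (q * q + κ (+ 1)) * (q * q + κ (+ 1)) -
            (κ (+ 5) * q * q * q * q - κ (+ 8) * q * q * q + κ (+ 6) * q * q + κ (+ 8) * q + κ (+ 5))) h₁)
    (solve (q List.∷ z List.∷ List.[]) ringℚ)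

-- Doubling the point over X = x/d² on X(X + 1)(X − 16).
double-first : ∀ x d s → (x + d * d) * (x - κ (+ 16) * (d * d)) ≡ s * s * x →
    (x * x + κ (+ 2) * x * (d * d) - κ (+ 16) * (d * d * (d * d))) * (x * x + κ (+ 2) * x * (d * d)
    - κ (+ 16) * (d * d * (d * d)))
    ≡ (x * x + κ (+ 16) * (d * d * (d * d))) * (x * x + κ (+ 16) * (d * d * (d * d)))
    + κ (+ 1) * (κ (+ 2) * s * d * x * (κ (+ 2) * s * d * x))
double-first x d s h₁ = equal-up-to (multiple (κ (+ 4) * x * (d * d)) h₁) (solve (x List.∷ d List.∷ s List.∷ List.[]) ringℚ)

double-second : ∀ x d s → (x + d * d) * (x - κ (+ 16) * (d * d)) ≡ s * s * x →
    (x * x + κ (+ 16) * (d * d * (d * d))) * (x * x + κ (+ 16) * (d * d * (d * d)))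
    ≡ (x * x - κ (+ 32) * x * (d * d) - κ (+ 16) * (d * d * (d * d))) * (x * x - κ (+ 32) * x * (d * d)
    - κ (+ 16) * (d * d * (d * d))) + κ (+ 16) * (κ (+ 2) * s * d * x * (κ (+ 2) * s * d * x))
double-second x d s h₁ = equal-up-to (multiple (κ (+ 64) * x * (d * d)) h₁)
    (solve (x List.∷ d List.∷ s List.∷ List.[]) ringℚ)

double-zero : ∀ x d s → (x + d * d) * (x - κ (+ 16) * (d * d)) ≡ s * s * x → x ≡ κ (+ 0) →
    κ (+ 16) * (d * d * (d * d)) ≡ κ (+ 0)
double-zero x d s h₁ h₂ = equal-up-to (zero-sum (multiple (- κ (+ 1)) h₁)
    (multiple (x - κ (+ 15) * (d * d) - s * s) h₂)) (solve (x List.∷ d List.∷ s List.∷ List.[]) ringℚ)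

sqrt-17 : ∀ q → κ (+ 8) * q - (q * q - κ (+ 1)) ≡ κ (+ 0) → (q - κ (+ 4)) * (q - κ (+ 4)) ≡ κ (+ 17)
sqrt-17 q h₁ = equal-up-to (multiple (- κ (+ 1)) h₁) (solve (q List.∷ List.[]) ringℚ)

double-degenerate : ∀ x d s → (x + d * d) * (x - κ (+ 16) * (d * d)) ≡ s * s * x → s ≡ 0ℚ ⊎ d ≡ 0ℚ
double-degenerate x d s h = case zero-product (κ (+ 2) * s * d) x (no-17ℚ (x * x + κ (+ 16) * (d * d * (d * d)))
        (κ (+ 2) * s * d * x) (x * x + κ (+ 2) * x * (d * d) - κ (+ 16) * (d * d * (d * d))) (x * x - κ (+ 32) * x *
        (d * d) - κ (+ 16) * (d * d * (d * d))) (double-first x d s h) (double-second x d s h)) of λ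
  { (inj₁ e) → case zero-product (κ (+ 2) * s) d e of λ
      { (inj₁ e′) → case zero-product (κ (+ 2)) s e′ of λ { (inj₂ s≡0) → inj₁ s≡0 }
      ; (inj₂ d≡0) → inj₂ d≡0 }
  ; (inj₂ x≡0) → inj₂ (case zero-product (κ (+ 16)) (d * d * (d * d)) (double-zero x d s h x≡0) of λ
      { (inj₂ e) → case zero-product (d * d) (d * d) e of λ { (inj₁ e′) → root e′ ; (inj₂ e′) → root e′ } }) }
  where
  root : d * d ≡ 0ℚ → d ≡ 0ℚ
  root e = case zero-product d d e of λ { (inj₁ p) → p ; (inj₂ p) → p }

E₂-points : ∀ q z → z * z ≡ κ (+ 5) * q * q * q * q - κ (+ 8) * q * q * q + κ (+ 6) * q * q + κ (+ 8) * q + κ (+ 5) →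
    IsPM (κ (+ 1)) q
E₂-points q z h = case double-degenerate ((κ (+ 2) * (q * q + κ (+ 1)) + z) * (κ (+ 2) * (q * q + κ (+ 1)) + z) -
        (q * q - κ (+ 1)) * (q * q - κ (+ 1))) (q * q - κ (+ 1)) (κ (+ 8) * q - (q * q - κ (+ 1)))
        (E₂-relation q z h) of λ
  { (inj₁ s≡0) → ⊥-elim (non-square-mod-3 {q - κ (+ 4)} {17} tt (sqrt-17 q s≡0))
  ; (inj₂ d≡0) → units q d≡0 }

-- The parabola through two conjugate points and (1, 4)

-- f = 5t⁴ + pt³ + ct² - pt + (11 - c) is the general quartic with leading coefficient 5 and f(1) =
-- f(-1) = 16. Let m = t² - st + n and g = αt + β + γm. Once m divides f - (αt + β)², it divides f -
-- g², say f - g² = mQ with Q = (5 - γ²)t² + (p + 5s - 2γα + γ²s)t + Q(0). Then g(1) = 4 gives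
-- m(1)Q(1) = 0.
chord-sum : ∀ p c s n α β γ → α + β + γ * (κ (+ 1) - s + n) ≡ κ (+ 4) →
    s * (c - α * α + s * (p + κ (+ 5) * s) - κ (+ 5) * n) - n * (p + κ (+ 5) * s) - p - κ (+ 2) * α * β ≡ κ (+ 0) →
    κ (+ 11) - c - β * β - n * (c - α * α + s * (p + κ (+ 5) * s) - κ (+ 5) * n) ≡ κ (+ 0) →
    (κ (+ 1) - s + n) * (κ (+ 5) - γ * γ + (p + κ (+ 5) * s - κ (+ 2) * γ * α + γ * γ * s) + (c - α * α + s * (p
    + κ (+ 5) * s) - κ (+ 5) * n - κ (+ 2) * γ * β - γ * γ * n))
    ≡ κ (+ 0)
chord-sum p c s n α β γ h₁ h₂ h₃ = equal-up-to (zero-sum (zero-sum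
    (multiple (- (α + β + γ * (κ (+ 1) - s + n) + κ (+ 4))) h₁) (multiple (- κ (+ 1)) h₂)) (multiple (- κ (+ 1)) h₃))
    (solve (p List.∷ c List.∷ s List.∷ n List.∷ α List.∷ β List.∷ γ List.∷ List.[]) ringℚ)

-- Since Q(1) = 0, the other root of Q is r = Q(0)/(5 - γ²) by Vieta, and f - g² vanishes there.
chord-point : ∀ p c s n α β γ r →
    κ (+ 5) - γ * γ + (p + κ (+ 5) * s - κ (+ 2) * γ * α + γ * γ * s) + (c - α * α + s * (p + κ (+ 5) * s)
    - κ (+ 5) * n - κ (+ 2) * γ * β - γ * γ * n)
    ≡ κ (+ 0) → (κ (+ 5) - γ * γ) * r
    ≡ c - α * α + s * (p + κ (+ 5) * s) - κ (+ 5) * n - κ (+ 2) * γ * β - γ * γ * n →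
    s * (c - α * α + s * (p + κ (+ 5) * s) - κ (+ 5) * n) - n * (p + κ (+ 5) * s) - p - κ (+ 2) * α * β ≡ κ (+ 0) →
    κ (+ 11) - c - β * β - n * (c - α * α + s * (p + κ (+ 5) * s) - κ (+ 5) * n) ≡ κ (+ 0) →
    (α * r + β + γ * (r * r - s * r + n)) * (α * r + β + γ * (r * r - s * r + n))
    ≡ κ (+ 5) * r * r * r * r + p * r * r * r + c * r * r - p * r + (κ (+ 11) - c)
chord-point p c s n α β γ r h₁ h₂ h₃ h₄ = equal-up-to (zero-sum (zero-sum (zero-sum
    (multiple (- ((r * r - s * r + n) * r)) h₁) (multiple (- ((r * r - s * r + n) * (r - κ (+ 1)))) h₂))
    (multiple (- r) h₃)) (multiple (- κ (+ 1)) h₄))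
    (solve (p List.∷ c List.∷ s List.∷ n List.∷ α List.∷ β List.∷ γ List.∷ r List.∷ List.[]) ringℚ)

double-root : ∀ p c s n α β γ r →
    κ (+ 5) - γ * γ + (p + κ (+ 5) * s - κ (+ 2) * γ * α + γ * γ * s) + (c - α * α + s * (p + κ (+ 5) * s)
    - κ (+ 5) * n - κ (+ 2) * γ * β - γ * γ * n)
    ≡ κ (+ 0) → (κ (+ 5) - γ * γ) * r
    ≡ c - α * α + s * (p + κ (+ 5) * s) - κ (+ 5) * n - κ (+ 2) * γ * β - γ * γ * n → r ≡ κ (+ 1) →
    p + κ (+ 5) * s - κ (+ 2) * γ * α + γ * γ * s + κ (+ 2) * (κ (+ 5) - γ * γ) ≡ κ (+ 0)
double-root p c s n α β γ r h₁ h₂ h₃ = equal-up-to (zero-sum (zero-sum (multiple (κ (+ 1)) h₁)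
    (multiple (κ (+ 1)) h₂)) (multiple (- (κ (+ 5) - γ * γ)) h₃))
    (solve (p List.∷ c List.∷ s List.∷ n List.∷ α List.∷ β List.∷ γ List.∷ r List.∷ List.[]) ringℚ)

root-at-1 : ∀ p c s n α β γ r → (κ (+ 5) - γ * γ) * r
    ≡ c - α * α + s * (p + κ (+ 5) * s) - κ (+ 5) * n - κ (+ 2) * γ * β - γ * γ * n → r ≡ κ (+ 1) →
    c - α * α + s * (p + κ (+ 5) * s) - κ (+ 5) * n - κ (+ 2) * γ * β - γ * γ * n ≡ κ (+ 5) - γ * γ
root-at-1 p c s n α β γ r h₁ h₂ = equal-up-to (zero-sum (multiple (- κ (+ 1)) h₁) (multiple (κ (+ 5) - γ * γ) h₂))
    (solve (p List.∷ c List.∷ s List.∷ n List.∷ α List.∷ β List.∷ γ List.∷ r List.∷ List.[]) ringℚ)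

-- A double root of f - g² at 1 makes the derivatives agree: 8h = f′(1) = 2 · 4 · g′(1), where g′(1)
-- = α + γ(2 - s).
tangent-slope : ∀ p c s n α β γ h → κ (+ 8) * h ≡ κ (+ 20) + κ (+ 2) * p + κ (+ 2) * c → α + β + γ * (κ (+ 1) - s + n)
    ≡ κ (+ 4) →
    κ (+ 5) - γ * γ + (p + κ (+ 5) * s - κ (+ 2) * γ * α + γ * γ * s) + (c - α * α + s * (p + κ (+ 5) * s)
    - κ (+ 5) * n - κ (+ 2) * γ * β - γ * γ * n)
    ≡ κ (+ 0) → p + κ (+ 5) * s - κ (+ 2) * γ * α + γ * γ * s + κ (+ 2) * (κ (+ 5) - γ * γ) ≡ κ (+ 0) →
    s * (c - α * α + s * (p + κ (+ 5) * s) - κ (+ 5) * n) - n * (p + κ (+ 5) * s) - p - κ (+ 2) * α * β ≡ κ (+ 0) →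
    κ (+ 8) * (h - (α + γ * (κ (+ 2) - s))) ≡ κ (+ 0)
tangent-slope p c s n α β γ h h₁ h₂ h₃ h₄ h₅ = equal-up-to (zero-sum (zero-sum (zero-sum (zero-sum
    (multiple (κ (+ 1)) h₁) (multiple (κ (+ 2) * (α + γ * (κ (+ 2) - s))) h₂)) (multiple (κ (+ 2) - s) h₃))
    (multiple (κ (+ 1) - s + n) h₄)) (multiple (κ (+ 1)) h₅))
    (solve (p List.∷ c List.∷ s List.∷ n List.∷ α List.∷ β List.∷ γ List.∷ h List.∷ List.[]) ringℚ)

-- Now f - g² = (5 - γ²)(t - 1)²m, and g = 4 + hu + γu² for u = t - 1. This compares the
-- coefficients of u³; `tangent₂` compares those of u².
tangent₁ : ∀ p c s n α β γ h → h - (α + γ * (κ (+ 2) - s)) ≡ κ (+ 0) →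
    p + κ (+ 5) * s - κ (+ 2) * γ * α + γ * γ * s + κ (+ 2) * (κ (+ 5) - γ * γ) ≡ κ (+ 0) →
    (κ (+ 5) - γ * γ) * (κ (+ 2) - s) ≡ κ (+ 20) + p - κ (+ 2) * h * γ
tangent₁ p c s n α β γ h h₁ h₂ = equal-up-to (zero-sum (multiple (κ (+ 2) * γ) h₁) (multiple (- κ (+ 1)) h₂))
    (solve (p List.∷ c List.∷ s List.∷ n List.∷ α List.∷ β List.∷ γ List.∷ h List.∷ List.[]) ringℚ)

tangent₂ : ∀ p c s n α β γ h → α + β + γ * (κ (+ 1) - s + n) ≡ κ (+ 4) → h - (α + γ * (κ (+ 2) - s)) ≡ κ (+ 0) →
    (κ (+ 5) - γ * γ) * (κ (+ 2) - s) ≡ κ (+ 20) + p - κ (+ 2) * h * γ →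
    c - α * α + s * (p + κ (+ 5) * s) - κ (+ 5) * n - κ (+ 2) * γ * β - γ * γ * n ≡ κ (+ 5) - γ * γ →
    (κ (+ 5) - γ * γ) * (κ (+ 1) - s + n) ≡ κ (+ 30) + κ (+ 3) * p + c - h * h - κ (+ 8) * γ
tangent₂ p c s n α β γ h h₁ h₂ h₃ h₄ = equal-up-to (zero-sum (zero-sum (zero-sum (multiple (- (κ (+ 2) * γ)) h₁)
    (multiple (- (κ (+ 4) * γ - γ * s - h - α)) h₂)) (multiple (- (s - κ (+ 3))) h₃)) (multiple (- κ (+ 1)) h₄))
    (solve (p List.∷ c List.∷ s List.∷ n List.∷ α List.∷ β List.∷ γ List.∷ h List.∷ List.[]) ringℚ)

-- The long cofactor is the quotient by r + 1 of the change in g² - f when r is replaced by -1;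
-- recall f(-1) = 16.
value-at-−1 : ∀ p c s n α β γ r → (α * r + β + γ * (r * r - s * r + n)) * (α * r + β + γ * (r * r - s * r + n))
    ≡ κ (+ 5) * r * r * r * r + p * r * r * r + c * r * r - p * r + (κ (+ 11) - c) → r ≡ - κ (+ 1) →
    (β - α + γ * (κ (+ 1) + s + n) - κ (+ 4)) * (β - α + γ * (κ (+ 1) + s + n) - - κ (+ 4)) ≡ κ (+ 0)
value-at-−1 p c s n α β γ r h₁ h₂ = equal-up-to (zero-sum (multiple (κ (+ 1)) h₁)
    (multiple (κ (+ 2) * r * r * s * γ * γ - r * s * s * γ * γ - r * r * r * γ * γ - κ (+ 2) * n * r * γ * γ + κ (+ 2) * n * s * γ * γ + κ (+ 2) * r * s * α * γ - κ (+ 2) * r * s * γ * γ - κ (+ 2) * r * r * α * γ + r * r * γ * γ + s * s * γ * γ - κ (+ 2) * n * α * γ + κ (+ 2) * n * γ * γ + p * r * r + κ (+ 2) * r * α * γ - r * α * α - κ (+ 2) * r * β * γ - r * γ * γ + κ (+ 5) * r * r * r - κ (+ 2) * s * α * γ + κ (+ 2) * s * β * γ + κ (+ 2) * s * γ * γ + c * r - p * r - κ (+ 5) * r * r - κ (+ 2) * α * β - κ (+ 2) * α * γ + α * α + κ (+ 2) * β * γ + γ * γ - c + κ (+ 5) * r - κ (+ 5)) h₂))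
    (solve (p List.∷ c List.∷ s List.∷ n List.∷ α List.∷ β List.∷ γ List.∷ r List.∷ List.[]) ringℚ)

opposite-root₀ : ∀ p c s n α β γ r → (κ (+ 5) - γ * γ) * r
    ≡ c - α * α + s * (p + κ (+ 5) * s) - κ (+ 5) * n - κ (+ 2) * γ * β - γ * γ * n → r ≡ - κ (+ 1) →
    c - α * α + s * (p + κ (+ 5) * s) - κ (+ 5) * n - κ (+ 2) * γ * β - γ * γ * n ≡ - (κ (+ 5) - γ * γ)
opposite-root₀ p c s n α β γ r h₁ h₂ = equal-up-to (zero-sum (multiple (- κ (+ 1)) h₁)
    (multiple (κ (+ 5) - γ * γ) h₂))
    (solve (p List.∷ c List.∷ s List.∷ n List.∷ α List.∷ β List.∷ γ List.∷ r List.∷ List.[]) ringℚ)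

opposite-root₁ : ∀ p c s n α β γ →
    κ (+ 5) - γ * γ + (p + κ (+ 5) * s - κ (+ 2) * γ * α + γ * γ * s) + (c - α * α + s * (p + κ (+ 5) * s)
    - κ (+ 5) * n - κ (+ 2) * γ * β - γ * γ * n)
    ≡ κ (+ 0) → c - α * α + s * (p + κ (+ 5) * s) - κ (+ 5) * n - κ (+ 2) * γ * β - γ * γ * n ≡ - (κ (+ 5) - γ * γ) →
    p + κ (+ 5) * s - κ (+ 2) * γ * α + γ * γ * s ≡ κ (+ 0)
opposite-root₁ p c s n α β γ h₁ h₂ = equal-up-to (zero-sum (multiple (κ (+ 1)) h₁) (multiple (- κ (+ 1)) h₂))
    (solve (p List.∷ c List.∷ s List.∷ n List.∷ α List.∷ β List.∷ γ List.∷ List.[]) ringℚ)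

plus-slope : ∀ p c s n α β γ → α + β + γ * (κ (+ 1) - s + n) ≡ κ (+ 4) → β - α + γ * (κ (+ 1) + s + n) ≡ κ (+ 4) →
    κ (+ 2) * (α - γ * s) ≡ κ (+ 0)
plus-slope p c s n α β γ h₁ h₂ = equal-up-to (zero-sum (multiple (κ (+ 1)) h₁) (multiple (- κ (+ 1)) h₂))
    (solve (p List.∷ c List.∷ s List.∷ n List.∷ α List.∷ β List.∷ γ List.∷ List.[]) ringℚ)

minus-slope : ∀ p c s n α β γ → α + β + γ * (κ (+ 1) - s + n) ≡ κ (+ 4) → β - α + γ * (κ (+ 1) + s + n) ≡ - κ (+ 4) →
    κ (+ 2) * (α - (γ * s + κ (+ 4))) ≡ κ (+ 0)
minus-slope p c s n α β γ h₁ h₂ = equal-up-to (zero-sum (multiple (κ (+ 1)) h₁) (multiple (- κ (+ 1)) h₂))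
    (solve (p List.∷ c List.∷ s List.∷ n List.∷ α List.∷ β List.∷ γ List.∷ List.[]) ringℚ)

-- With g(1) = g(-1) = 4 one has g = 4 + γ(t² - 1). Since f - 16 = (t² - 1)(5t² + pt + c + 5) and g²
-- - 16 = γ(t² - 1)(8 + γ(t² - 1)), dividing f - g² by t² - 1 expresses (5 - γ²)m; its linear and
-- constant terms are `plus₁` and `plus₂`.
plus₁ : ∀ p c s n α β γ → α - γ * s ≡ κ (+ 0) → p + κ (+ 5) * s - κ (+ 2) * γ * α + γ * γ * s ≡ κ (+ 0) →
    - ((κ (+ 5) - γ * γ) * s) ≡ p
plus₁ p c s n α β γ h₁ h₂ = equal-up-to (zero-sum (multiple (- (κ (+ 2) * γ)) h₁) (multiple (- κ (+ 1)) h₂))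
    (solve (p List.∷ c List.∷ s List.∷ n List.∷ α List.∷ β List.∷ γ List.∷ List.[]) ringℚ)

plus₂ : ∀ p c s n α β γ → α + β + γ * (κ (+ 1) - s + n) ≡ κ (+ 4) → α - γ * s ≡ κ (+ 0) → - ((κ (+ 5) - γ * γ) * s)
    ≡ p → c - α * α + s * (p + κ (+ 5) * s) - κ (+ 5) * n - κ (+ 2) * γ * β - γ * γ * n ≡ - (κ (+ 5) - γ * γ) →
    (κ (+ 5) - γ * γ) * n ≡ c + κ (+ 5) - κ (+ 8) * γ + γ * γ
plus₂ p c s n α β γ h₁ h₂ h₃ h₄ = equal-up-to (zero-sum (zero-sum (zero-sum (multiple (- (κ (+ 2) * γ)) h₁)
    (multiple (κ (+ 2) * γ - γ * s - α) h₂)) (multiple (- s) h₃)) (multiple (- κ (+ 1)) h₄))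
    (solve (p List.∷ c List.∷ s List.∷ n List.∷ α List.∷ β List.∷ γ List.∷ List.[]) ringℚ)

-- Here g = 4t + γ(t² - 1), so g² - 16 = (t² - 1)(16 + 8γt + γ²(t² - 1)); the comparison is
-- otherwise that of `plus₁`.
minus₁ : ∀ p c s n α β γ → α - (γ * s + κ (+ 4)) ≡ κ (+ 0) → p + κ (+ 5) * s - κ (+ 2) * γ * α + γ * γ * s ≡ κ (+ 0) →
    - ((κ (+ 5) - γ * γ) * s) ≡ p - κ (+ 8) * γ
minus₁ p c s n α β γ h₁ h₂ = equal-up-to (zero-sum (multiple (- (κ (+ 2) * γ)) h₁) (multiple (- κ (+ 1)) h₂))
    (solve (p List.∷ c List.∷ s List.∷ n List.∷ α List.∷ β List.∷ γ List.∷ List.[]) ringℚ)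

minus₂ : ∀ p c s n α β γ → α + β + γ * (κ (+ 1) - s + n) ≡ κ (+ 4) → α - (γ * s + κ (+ 4)) ≡ κ (+ 0) →
    - ((κ (+ 5) - γ * γ) * s) ≡ p - κ (+ 8) * γ →
    c - α * α + s * (p + κ (+ 5) * s) - κ (+ 5) * n - κ (+ 2) * γ * β - γ * γ * n ≡ - (κ (+ 5) - γ * γ) →
    (κ (+ 5) - γ * γ) * n ≡ c - κ (+ 11) + γ * γ
minus₂ p c s n α β γ h₁ h₂ h₃ h₄ = equal-up-to (zero-sum (zero-sum (zero-sum (multiple (- (κ (+ 2) * γ)) h₁)
    (multiple (κ (+ 2) * γ - γ * s - α - κ (+ 4)) h₂)) (multiple (- s) h₃)) (multiple (- κ (+ 1)) h₄))
    (solve (p List.∷ c List.∷ s List.∷ n List.∷ α List.∷ β List.∷ γ List.∷ List.[]) ringℚ)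

nonzero-* : ∀ {a b} → a ≢ 0ℚ → b ≢ 0ℚ → a * b ≢ 0ℚ
nonzero-* {a} {b} na nb e = case zero-product a b e of λ { (inj₁ p) → na p ; (inj₂ p) → nb p }

cancel-factor : ∀ k x → k ≢ 0ℚ → k * x ≡ 0ℚ → x ≡ 0ℚ
cancel-factor k x nk e = case zero-product k x e of λ { (inj₁ p) → ⊥-elim (nk p) ; (inj₂ p) → p }

divide : ∀ a b → b ≢ 0ℚ → ∃ λ x → x * b ≡ a
divide a b nb = a * 1/ b , trans (ℚₚ.*-assoc a (1/ b) b) (trans (cong (a *_) (ℚₚ.*-inverseˡ b)) (ℚₚ.*-identityʳ a))
  where instance _ = ≢-nonZero nb

-- The points at infinity of both quartic curves are defined over ℚ(√5) only, so a rational parabola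
-- passes through neither and Q keeps its second root.
leading-nonzero : ∀ γ → κ (+ 5) - γ * γ ≢ 0ℚ
leading-nonzero γ e = non-square-mod-3 {γ} {5} tt (sym (difference-zero e))

-- The possible minimal polynomials t² − st + n of q, when the parabola through (q , y), its conjugate and (1 , 4),
-- with leading coefficient γ, meets y² = f again at (1 , 4), (−1 , 4) or (−1 , −4) respectively.
data Pencil (p c h s n γ : ℚ) : Set where
  tangent : (κ (+ 5) - γ * γ) * (κ (+ 2) - s) ≡ κ (+ 20) + p - κ (+ 2) * h * γ → (κ (+ 5) - γ * γ) * (κ (+ 1) - s + n)
      ≡ κ (+ 30) + κ (+ 3) * p + c - h * h - κ (+ 8) * γ → Pencil p c h s n γ
  plus : - ((κ (+ 5) - γ * γ) * s) ≡ p → (κ (+ 5) - γ * γ) * n ≡ c + κ (+ 5) - κ (+ 8) * γ + γ * γ → Pencil p c h s n γ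
  minus : - ((κ (+ 5) - γ * γ) * s) ≡ p - κ (+ 8) * γ → (κ (+ 5) - γ * γ) * n ≡ c - κ (+ 11) + γ * γ → Pencil p c h s n γ

module _ (p c h : ℚ) (slope : κ (+ 8) * h ≡ κ (+ 20) + κ (+ 2) * p + κ (+ 2) * c)
        (points : ∀ r y → y * y ≡ κ (+ 5) * r * r * r * r + p * r * r * r + c * r * r - p * r + (κ (+ 11) - c) → IsPM
        (κ (+ 1)) r) where

  -- The vanishing of the two coefficients says that t² − st + n divides f(t) − (αt + β)².
  chord : ∀ s n α β → κ (+ 1) - s + n ≢ 0ℚ →
      s * (c - α * α + s * (p + κ (+ 5) * s) - κ (+ 5) * n) - n * (p + κ (+ 5) * s) - p - κ (+ 2) * α * β ≡ κ (+ 0) →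
      κ (+ 11) - c - β * β - n * (c - α * α + s * (p + κ (+ 5) * s) - κ (+ 5) * n) ≡ κ (+ 0) → ∃ λ γ →
      Pencil p c h s n γ
  chord s n α β m1≢0 c₁ c₀ = γ , (case points r (α * r + β + γ * (r * r - s * r + n))
          (chord-point p c s n α β γ r sum root c₁ c₀) of λ
      { (inj₁ r≡1) → at-1 r≡1 ; (inj₂ r≡−1) → at-−1 r≡−1 })
    where
    quotient = divide (κ (+ 4) - α - β) (κ (+ 1) - s + n) m1≢0
    γ = proj₁ quotient
    through : α + β + γ * (κ (+ 1) - s + n) ≡ κ (+ 4)
    through = trans (cong (λ t → α + β + t) (proj₂ quotient)) (l α β)
      where
      l : ∀ α β → α + β + (κ (+ 4) - α - β) ≡ κ (+ 4)
      l = solve-∀ ringℚ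
    sum : κ (+ 5) - γ * γ + (p + κ (+ 5) * s - κ (+ 2) * γ * α + γ * γ * s) + (c - α * α + s * (p + κ (+ 5) * s)
        - κ (+ 5) * n - κ (+ 2) * γ * β - γ * γ * n)
        ≡ κ (+ 0)
    sum = cancel-factor (κ (+ 1) - s + n) (κ (+ 5) - γ * γ + (p + κ (+ 5) * s - κ (+ 2) * γ * α + γ * γ * s) +
            (c - α * α + s * (p + κ (+ 5) * s) - κ (+ 5) * n - κ (+ 2) * γ * β - γ * γ * n)) m1≢0
            (chord-sum p c s n α β γ through c₁ c₀)
    root-quotient = divide (c - α * α + s * (p + κ (+ 5) * s) - κ (+ 5) * n - κ (+ 2) * γ * β - γ * γ * n)
            (κ (+ 5) - γ * γ) (leading-nonzero γ)
    r = proj₁ root-quotient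
    root : (κ (+ 5) - γ * γ) * r ≡ c - α * α + s * (p + κ (+ 5) * s) - κ (+ 5) * n - κ (+ 2) * γ * β - γ * γ * n
    root = trans (ℚₚ.*-comm (κ (+ 5) - γ * γ) r) (proj₂ root-quotient)
    at-1 : r ≡ κ (+ 1) → Pencil p c h s n γ
    at-1 r≡1 = tangent t₁ (tangent₂ p c s n α β γ h through slope′ t₁ (root-at-1 p c s n α β γ r root r≡1))
      where
      double = double-root p c s n α β γ r sum root r≡1
      slope′ : h - (α + γ * (κ (+ 2) - s)) ≡ κ (+ 0)
      slope′ = cancel-factor (κ (+ 8)) (h - (α + γ * (κ (+ 2) - s))) (λ ())
              (tangent-slope p c s n α β γ h slope through sum double c₁)
      t₁ = tangent₁ p c s n α β γ h slope′ double
    at-−1 : r ≡ - κ (+ 1) → Pencil p c h s n γ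
    at-−1 r≡−1 = case zero-product (β - α + γ * (κ (+ 1) + s + n) - κ (+ 4)) (β - α + γ *
            (κ (+ 1) + s + n) - - κ (+ 4)) (value-at-−1 p c s n α β γ r
            (chord-point p c s n α β γ r sum root c₁ c₀) r≡−1) of λ
      { (inj₁ e) → up (difference-zero e) ; (inj₂ e) → down (difference-zero e) }
      where
      o₀ = opposite-root₀ p c s n α β γ r root r≡−1
      o₁ = opposite-root₁ p c s n α β γ sum o₀
      up : β - α + γ * (κ (+ 1) + s + n) ≡ κ (+ 4) → Pencil p c h s n γ
      up e = plus p₁ (plus₂ p c s n α β γ through e′ p₁ o₀)
        where
        e′ = cancel-factor (κ (+ 2)) (α - γ * s) (λ ()) (plus-slope p c s n α β γ through e)
        p₁ = plus₁ p c s n α β γ e′ o₁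
      down : β - α + γ * (κ (+ 1) + s + n) ≡ - κ (+ 4) → Pencil p c h s n γ
      down e = minus p₁ (minus₂ p c s n α β γ through e′ p₁ o₀)
        where
        e′ = cancel-factor (κ (+ 2)) (α - (γ * s + κ (+ 4))) (λ ()) (minus-slope p c s n α β γ through e)
        p₁ = minus₁ p c s n α β γ e′ o₁

-- No common member in the families of f₁ and f₂

-- The constants (p, c, h) are (0, 14, 6) for f₁ and (-8, 6, 2) for f₂, left unsimplified to match
-- the instances of `Pencil`. Passing from s and n to m(1) = 1 - s + n and m(-1) = 1 + s + n pays
-- off because both factor in γ and are known to be nonzero.
tangent₁-at-1 : ∀ s n γ → (κ (+ 5) - γ * γ) * (κ (+ 2) - s) ≡ κ (+ 20) + κ (+ 0) - κ (+ 2) * κ (+ 6) * γ →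
    (κ (+ 5) - γ * γ) * (κ (+ 1) - s + n)
    ≡ κ (+ 30) + κ (+ 3) * κ (+ 0) + κ (+ 14) - κ (+ 6) * κ (+ 6) - κ (+ 8) * γ →
    (κ (+ 5) - γ * γ) * (κ (+ 1) - s + n) ≡ κ (+ 8) * (κ (+ 1) - γ)
tangent₁-at-1 s n γ h₁ h₂ = equal-up-to (zero-sum (multiple (κ (+ 0)) h₁) (multiple (κ (+ 1)) h₂))
    (solve (s List.∷ n List.∷ γ List.∷ List.[]) ringℚ)

tangent₁-at-−1 : ∀ s n γ → (κ (+ 5) - γ * γ) * (κ (+ 2) - s) ≡ κ (+ 20) + κ (+ 0) - κ (+ 2) * κ (+ 6) * γ →
    (κ (+ 5) - γ * γ) * (κ (+ 1) - s + n)
    ≡ κ (+ 30) + κ (+ 3) * κ (+ 0) + κ (+ 14) - κ (+ 6) * κ (+ 6) - κ (+ 8) * γ →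
    (κ (+ 5) - γ * γ) * (κ (+ 1) + s + n) ≡ κ (+ 4) * ((κ (+ 1) - γ) * (γ - κ (+ 3)))
tangent₁-at-−1 s n γ h₁ h₂ = equal-up-to (zero-sum (multiple (- κ (+ 2)) h₁) (multiple (κ (+ 1)) h₂))
    (solve (s List.∷ n List.∷ γ List.∷ List.[]) ringℚ)

tangent₂-at-1 : ∀ s n δ → (κ (+ 5) - δ * δ) * (κ (+ 2) - s) ≡ κ (+ 20) + - κ (+ 8) - κ (+ 2) * κ (+ 2) * δ →
    (κ (+ 5) - δ * δ) * (κ (+ 1) - s + n)
    ≡ κ (+ 30) + κ (+ 3) * - κ (+ 8) + κ (+ 6) - κ (+ 2) * κ (+ 2) - κ (+ 8) * δ →
    (κ (+ 5) - δ * δ) * (κ (+ 1) - s + n) ≡ κ (+ 8) * (κ (+ 1) - δ)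
tangent₂-at-1 s n δ h₁ h₂ = equal-up-to (zero-sum (multiple (κ (+ 0)) h₁) (multiple (κ (+ 1)) h₂))
    (solve (s List.∷ n List.∷ δ List.∷ List.[]) ringℚ)

tangent₂-at-−1 : ∀ s n δ → (κ (+ 5) - δ * δ) * (κ (+ 2) - s) ≡ κ (+ 20) + - κ (+ 8) - κ (+ 2) * κ (+ 2) * δ →
    (κ (+ 5) - δ * δ) * (κ (+ 1) - s + n)
    ≡ κ (+ 30) + κ (+ 3) * - κ (+ 8) + κ (+ 6) - κ (+ 2) * κ (+ 2) - κ (+ 8) * δ →
    (κ (+ 5) - δ * δ) * (κ (+ 1) + s + n) ≡ κ (+ 4) * (κ (+ 1) - δ * δ)
tangent₂-at-−1 s n δ h₁ h₂ = equal-up-to (zero-sum (multiple (- κ (+ 2)) h₁) (multiple (κ (+ 1)) h₂))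
    (solve (s List.∷ n List.∷ δ List.∷ List.[]) ringℚ)

plus₂-at-1 : ∀ s n δ → - ((κ (+ 5) - δ * δ) * s) ≡ - κ (+ 8) → (κ (+ 5) - δ * δ) * n
    ≡ κ (+ 6) + κ (+ 5) - κ (+ 8) * δ + δ * δ → (κ (+ 5) - δ * δ) * (κ (+ 1) - s + n) ≡ κ (+ 8) * (κ (+ 1) - δ)
plus₂-at-1 s n δ h₁ h₂ = equal-up-to (zero-sum (multiple (κ (+ 1)) h₁) (multiple (κ (+ 1)) h₂))
    (solve (s List.∷ n List.∷ δ List.∷ List.[]) ringℚ)

plus₂-at-−1 : ∀ s n δ → - ((κ (+ 5) - δ * δ) * s) ≡ - κ (+ 8) → (κ (+ 5) - δ * δ) * n
    ≡ κ (+ 6) + κ (+ 5) - κ (+ 8) * δ + δ * δ → (κ (+ 5) - δ * δ) * (κ (+ 1) + s + n) ≡ κ (+ 8) * (κ (+ 3) - δ)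
plus₂-at-−1 s n δ h₁ h₂ = equal-up-to (zero-sum (multiple (- κ (+ 1)) h₁) (multiple (κ (+ 1)) h₂))
    (solve (s List.∷ n List.∷ δ List.∷ List.[]) ringℚ)

minus₁-at-1 : ∀ s n γ → - ((κ (+ 5) - γ * γ) * s) ≡ κ (+ 0) - κ (+ 8) * γ → (κ (+ 5) - γ * γ) * n
    ≡ κ (+ 14) - κ (+ 11) + γ * γ → (κ (+ 5) - γ * γ) * (κ (+ 1) - s + n) ≡ κ (+ 8) * (κ (+ 1) - γ)
minus₁-at-1 s n γ h₁ h₂ = equal-up-to (zero-sum (multiple (κ (+ 1)) h₁) (multiple (κ (+ 1)) h₂))
    (solve (s List.∷ n List.∷ γ List.∷ List.[]) ringℚ)

minus₁-at-−1 : ∀ s n γ → - ((κ (+ 5) - γ * γ) * s) ≡ κ (+ 0) - κ (+ 8) * γ → (κ (+ 5) - γ * γ) * n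
    ≡ κ (+ 14) - κ (+ 11) + γ * γ → (κ (+ 5) - γ * γ) * (κ (+ 1) + s + n) ≡ κ (+ 8) * (κ (+ 1) + γ)
minus₁-at-−1 s n γ h₁ h₂ = equal-up-to (zero-sum (multiple (- κ (+ 1)) h₁) (multiple (κ (+ 1)) h₂))
    (solve (s List.∷ n List.∷ γ List.∷ List.[]) ringℚ)

plus₁-trace : ∀ s n γ → - ((κ (+ 5) - γ * γ) * s) ≡ κ (+ 0) → (κ (+ 5) - γ * γ) * s ≡ κ (+ 0)
plus₁-trace s n γ h₁ = equal-up-to (multiple (- κ (+ 1)) h₁) (solve (s List.∷ n List.∷ γ List.∷ List.[]) ringℚ)

minus₂-norm : ∀ s n δ → (κ (+ 5) - δ * δ) * n ≡ κ (+ 6) - κ (+ 11) + δ * δ → (κ (+ 5) - δ * δ) * (n + κ (+ 1)) ≡ κ (+ 0)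
minus₂-norm s n δ h₁ = equal-up-to (multiple (κ (+ 1)) h₁) (solve (s List.∷ n List.∷ δ List.∷ List.[]) ringℚ)

tangent₁-minus₂ : ∀ s n γ → (κ (+ 5) - γ * γ) * (κ (+ 2) - s) ≡ κ (+ 20) + κ (+ 0) - κ (+ 2) * κ (+ 6) * γ →
    (κ (+ 5) - γ * γ) * (κ (+ 1) - s + n)
    ≡ κ (+ 30) + κ (+ 3) * κ (+ 0) + κ (+ 14) - κ (+ 6) * κ (+ 6) - κ (+ 8) * γ → n + κ (+ 1) ≡ κ (+ 0) →
    κ (+ 2) * ((κ (+ 1) - γ) * (κ (+ 1) - γ)) ≡ κ (+ 0)
tangent₁-minus₂ s n γ h₁ h₂ h₃ = equal-up-to (zero-sum (zero-sum (multiple (- κ (+ 1)) h₁) (multiple (κ (+ 1)) h₂))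
    (multiple (- (κ (+ 5) - γ * γ)) h₃)) (solve (s List.∷ n List.∷ γ List.∷ List.[]) ringℚ)

plus₁-tangent₂ : ∀ s n δ → (κ (+ 5) - δ * δ) * (κ (+ 2) - s) ≡ κ (+ 20) + - κ (+ 8) - κ (+ 2) * κ (+ 2) * δ → s
    ≡ κ (+ 0) → κ (+ 2) * ((κ (+ 1) - δ) * (κ (+ 1) - δ)) ≡ κ (+ 0)
plus₁-tangent₂ s n δ h₁ h₂ = equal-up-to (zero-sum (multiple (- κ (+ 1)) h₁) (multiple (- (κ (+ 5) - δ * δ)) h₂))
    (solve (s List.∷ n List.∷ δ List.∷ List.[]) ringℚ)

plus₁-plus₂ : ∀ s n δ → - ((κ (+ 5) - δ * δ) * s) ≡ - κ (+ 8) → s ≡ κ (+ 0) → κ (+ 8) ≡ κ (+ 0)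
plus₁-plus₂ s n δ h₁ h₂ = equal-up-to (zero-sum (multiple (κ (+ 1)) h₁) (multiple (κ (+ 5) - δ * δ) h₂))
    (solve (s List.∷ n List.∷ δ List.∷ List.[]) ringℚ)

plus₁-minus₂ : ∀ s n → s ≡ κ (+ 0) → n + κ (+ 1) ≡ κ (+ 0) → κ (+ 1) - s + n ≡ κ (+ 0)
plus₁-minus₂ s n h₁ h₂ = equal-up-to (zero-sum (multiple (- κ (+ 1)) h₁) (multiple (κ (+ 1)) h₂))
    (solve (s List.∷ n List.∷ List.[]) ringℚ)

minus₁-minus₂ : ∀ s n γ → (κ (+ 5) - γ * γ) * n ≡ κ (+ 14) - κ (+ 11) + γ * γ → n + κ (+ 1) ≡ κ (+ 0) → κ (+ 8) ≡ κ (+ 0)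
minus₁-minus₂ s n γ h₁ h₂ = equal-up-to (zero-sum (multiple (- κ (+ 1)) h₁) (multiple (κ (+ 5) - γ * γ) h₂))
    (solve (s List.∷ n List.∷ γ List.∷ List.[]) ringℚ)

-- The first hypothesis equates the ratios m(-1) : m(1) of the two families, the second the values
-- m(1). Eliminating leaves a product of factors of m(1) and m(-1), none of which can vanish. The
-- three lemmas that follow have the same form.
tangent₁-tangent₂ : ∀ γ δ → κ (+ 4) * ((κ (+ 1) - γ) * (γ - κ (+ 3))) * (κ (+ 8) * (κ (+ 1) - δ))
    ≡ κ (+ 4) * (κ (+ 1) - δ * δ) * (κ (+ 8) * (κ (+ 1) - γ)) → κ (+ 8) * (κ (+ 1) - γ) * (κ (+ 5) - δ * δ)
    ≡ κ (+ 8) * (κ (+ 1) - δ) * (κ (+ 5) - γ * γ) →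
    κ (+ 128) * ((κ (+ 1) - γ) * (κ (+ 1) - δ) * ((κ (+ 1) + δ) * (κ (+ 1) + δ))) ≡ κ (+ 0)
tangent₁-tangent₂ γ δ h₁ h₂ = equal-up-to (zero-sum (multiple (γ - γ * δ - κ (+ 3) * δ - κ (+ 1)) h₁)
    (multiple (- κ (+ 4) * (κ (+ 1) - γ) * (κ (+ 1) - δ)) h₂)) (solve (γ List.∷ δ List.∷ List.[]) ringℚ)

tangent₁-plus₂ : ∀ γ δ → κ (+ 4) * ((κ (+ 1) - γ) * (γ - κ (+ 3))) * (κ (+ 8) * (κ (+ 1) - δ))
    ≡ κ (+ 8) * (κ (+ 3) - δ) * (κ (+ 8) * (κ (+ 1) - γ)) → κ (+ 8) * (κ (+ 1) - γ) * (κ (+ 5) - δ * δ)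
    ≡ κ (+ 8) * (κ (+ 1) - δ) * (κ (+ 5) - γ * γ) →
    κ (+ 128) * ((κ (+ 1) - γ) * ((κ (+ 1) - δ) * (κ (+ 1) - δ) * ((κ (+ 3) - δ) * (κ (+ 3) - δ)))) ≡ κ (+ 0)
tangent₁-plus₂ γ δ h₁ h₂ = equal-up-to (zero-sum
    (multiple (δ * δ * δ - γ * δ * δ + κ (+ 2) * γ * δ - κ (+ 6) * δ * δ - γ + κ (+ 9) * δ - κ (+ 4)) h₁)
    (multiple (κ (+ 4) * ((κ (+ 1) - γ) * (κ (+ 1) - δ) * (κ (+ 1) - δ))) h₂))
    (solve (γ List.∷ δ List.∷ List.[]) ringℚ)

minus₁-tangent₂ : ∀ γ δ → κ (+ 8) * (κ (+ 1) + γ) * (κ (+ 8) * (κ (+ 1) - δ))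
    ≡ κ (+ 4) * (κ (+ 1) - δ * δ) * (κ (+ 8) * (κ (+ 1) - γ)) → κ (+ 8) * (κ (+ 1) - γ) * (κ (+ 5) - δ * δ)
    ≡ κ (+ 8) * (κ (+ 1) - δ) * (κ (+ 5) - γ * γ) → κ (+ 512) * ((κ (+ 1) - δ) * ((κ (+ 1) + δ) * (κ (+ 1) + δ)))
    ≡ κ (+ 0)
minus₁-tangent₂ γ δ h₁ h₂ = equal-up-to (zero-sum
    (multiple (γ * δ * δ - δ * δ * δ + κ (+ 2) * γ * δ - κ (+ 2) * δ * δ - κ (+ 3) * γ + κ (+ 3) * δ + κ (+ 16)) h₁)
    (multiple (κ (+ 4) * ((κ (+ 1) - δ) * (κ (+ 3) + δ) * (κ (+ 3) + δ))) h₂))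
    (solve (γ List.∷ δ List.∷ List.[]) ringℚ)

minus₁-plus₂ : ∀ γ δ → κ (+ 8) * (κ (+ 1) + γ) * (κ (+ 8) * (κ (+ 1) - δ))
    ≡ κ (+ 8) * (κ (+ 3) - δ) * (κ (+ 8) * (κ (+ 1) - γ)) → κ (+ 8) * (κ (+ 1) - γ) * (κ (+ 5) - δ * δ)
    ≡ κ (+ 8) * (κ (+ 1) - δ) * (κ (+ 5) - γ * γ) → κ (+ 128) * ((κ (+ 1) - γ * γ) * (κ (+ 1) - γ * γ)) ≡ κ (+ 0)
minus₁-plus₂ γ δ h₁ h₂ = equal-up-to (zero-sum
    (multiple (γ * γ * γ - γ * γ * δ + γ * δ - κ (+ 2) * γ * γ - κ (+ 2) * γ - κ (+ 1)) h₁)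
    (multiple (- κ (+ 16) * (γ * γ)) h₂)) (solve (γ List.∷ δ List.∷ List.[]) ringℚ)

scaled-nonzero : ∀ {x} k y → x ≢ 0ℚ → x ≡ k * y → y ≢ 0ℚ
scaled-nonzero k y nx e y≡0 = nx (trans e (trans (cong (k *_) y≡0) (ℚₚ.*-zeroʳ k)))

right-factor-nonzero : ∀ {a b} → a * b ≢ 0ℚ → b ≢ 0ℚ
right-factor-nonzero {a} {b} n e = n (trans (cong (a *_) e) (ℚₚ.*-zeroʳ a))

cross : ∀ ℓ ℓ′ x y {P Q R S} → ℓ * x ≡ P → ℓ * y ≡ Q → ℓ′ * x ≡ R → ℓ′ * y ≡ S → Q * R ≡ S * P
cross ℓ ℓ′ x y refl refl refl refl = l ℓ ℓ′ x y
  where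
  l : ∀ D E x y → D * y * (E * x) ≡ E * y * (D * x)
  l = solve-∀ ringℚ

cross-leading : ∀ ℓ ℓ′ x {P R} → ℓ * x ≡ P → ℓ′ * x ≡ R → P * ℓ′ ≡ R * ℓ
cross-leading ℓ ℓ′ x refl refl = l ℓ ℓ′ x
  where
  l : ∀ D E x → D * x * E ≡ E * x * D
  l = solve-∀ ringℚ

difference-of-squares : ∀ x → κ (+ 1) - x * x ≡ (κ (+ 1) - x) * (κ (+ 1) + x)
difference-of-squares = solve-∀ ringℚ

module _ {s n : ℚ} (ν≢0 : κ (+ 1) - s + n ≢ 0ℚ) (μ≢0 : κ (+ 1) + s + n ≢ 0ℚ) where

  -- `plus` for f₁ means s = 0, and `minus` for f₂ means n = -1; the five cases involving one of
  -- these are immediate. The other four are the eliminations above.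
  incompatible : ∀ γ δ → Pencil (κ (+ 0)) (κ (+ 14)) (κ (+ 6)) s n γ → Pencil (- κ (+ 8)) (κ (+ 6)) (κ (+ 2)) s n δ → ⊥
  incompatible γ δ = go
    where
    D≢0 = leading-nonzero γ
    E≢0 = leading-nonzero δ
    at-1γ : (κ (+ 5) - γ * γ) * (κ (+ 1) - s + n) ≡ κ (+ 8) * (κ (+ 1) - γ) → κ (+ 1) - γ ≢ 0ℚ
    at-1γ = scaled-nonzero (κ (+ 8)) (κ (+ 1) - γ) (nonzero-* D≢0 ν≢0)
    at-1δ : (κ (+ 5) - δ * δ) * (κ (+ 1) - s + n) ≡ κ (+ 8) * (κ (+ 1) - δ) → κ (+ 1) - δ ≢ 0ℚ
    at-1δ = scaled-nonzero (κ (+ 8)) (κ (+ 1) - δ) (nonzero-* E≢0 ν≢0)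
    trace-0 : - ((κ (+ 5) - γ * γ) * s) ≡ κ (+ 0) → s ≡ 0ℚ
    trace-0 p = cancel-factor (κ (+ 5) - γ * γ) s D≢0 (plus₁-trace s n γ p)
    norm-−1 : (κ (+ 5) - δ * δ) * n ≡ κ (+ 6) - κ (+ 11) + δ * δ → n + κ (+ 1) ≡ 0ℚ
    norm-−1 q = cancel-factor (κ (+ 5) - δ * δ) (n + κ (+ 1)) E≢0 (minus₂-norm s n δ q)
    go : Pencil (κ (+ 0)) (κ (+ 14)) (κ (+ 6)) s n γ → Pencil (- κ (+ 8)) (κ (+ 6)) (κ (+ 2)) s n δ → ⊥
    go (tangent t₁ t₂) (tangent t₃ t₄) =
      let ν₁ = tangent₁-at-1 s n γ t₁ t₂ ; ν₂ = tangent₂-at-1 s n δ t₃ t₄ ; μ₂ = tangent₂-at-−1 s n δ t₃ t₄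
          w : (κ (+ 1) - δ) * (κ (+ 1) + δ) ≢ 0ℚ
          w = λ e → scaled-nonzero (κ (+ 4)) (κ (+ 1) - δ * δ) (nonzero-* E≢0 μ≢0) μ₂ (trans (difference-of-squares δ) e)
          v = right-factor-nonzero {κ (+ 1) - δ} {κ (+ 1) + δ} w
      in nonzero-* {κ (+ 128)} (λ ()) (nonzero-* (nonzero-* (at-1γ ν₁) (at-1δ ν₂)) (nonzero-* v v))
           (tangent₁-tangent₂ γ δ (cross (κ (+ 5) - γ * γ) (κ (+ 5) - δ * δ) (κ (+ 1) - s + n) (κ (+ 1) + s + n) ν₁
                   (tangent₁-at-−1 s n γ t₁ t₂) ν₂ μ₂) (cross-leading (κ (+ 5) - γ * γ) (κ (+ 5) - δ * δ)
                   (κ (+ 1) - s + n) ν₁ ν₂))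
    go (tangent t₁ t₂) (plus t₃ t₄) =
      let ν₁ = tangent₁-at-1 s n γ t₁ t₂ ; ν₂ = plus₂-at-1 s n δ t₃ t₄ ; μ₂ = plus₂-at-−1 s n δ t₃ t₄
          v = scaled-nonzero (κ (+ 8)) (κ (+ 3) - δ) (nonzero-* E≢0 μ≢0) μ₂
      in nonzero-* {κ (+ 128)} (λ ()) (nonzero-* (at-1γ ν₁) (nonzero-* (nonzero-* (at-1δ ν₂) (at-1δ ν₂)) (nonzero-* v v)))
           (tangent₁-plus₂ γ δ (cross (κ (+ 5) - γ * γ) (κ (+ 5) - δ * δ) (κ (+ 1) - s + n) (κ (+ 1) + s + n) ν₁
                   (tangent₁-at-−1 s n γ t₁ t₂) ν₂ μ₂) (cross-leading (κ (+ 5) - γ * γ) (κ (+ 5) - δ * δ)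
                   (κ (+ 1) - s + n) ν₁ ν₂))
    go (tangent t₁ t₂) (minus t₃ t₄) =
      let v = at-1γ (tangent₁-at-1 s n γ t₁ t₂)
      in nonzero-* {κ (+ 2)} (λ ()) (nonzero-* v v) (tangent₁-minus₂ s n γ t₁ t₂ (norm-−1 t₄))
    go (plus t₁ t₂) (tangent t₃ t₄) =
      let v = at-1δ (tangent₂-at-1 s n δ t₃ t₄)
      in nonzero-* {κ (+ 2)} (λ ()) (nonzero-* v v) (plus₁-tangent₂ s n δ t₃ (trace-0 t₁))
    go (plus t₁ t₂) (plus t₃ t₄) = case plus₁-plus₂ s n δ t₃ (trace-0 t₁) of λ ()
    go (plus t₁ t₂) (minus t₃ t₄) = ν≢0 (plus₁-minus₂ s n (trace-0 t₁) (norm-−1 t₄))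
    go (minus t₁ t₂) (tangent t₃ t₄) =
      let ν₁ = minus₁-at-1 s n γ t₁ t₂ ; ν₂ = tangent₂-at-1 s n δ t₃ t₄ ; μ₂ = tangent₂-at-−1 s n δ t₃ t₄
          w : (κ (+ 1) - δ) * (κ (+ 1) + δ) ≢ 0ℚ
          w = λ e → scaled-nonzero (κ (+ 4)) (κ (+ 1) - δ * δ) (nonzero-* E≢0 μ≢0) μ₂ (trans (difference-of-squares δ) e)
          v = right-factor-nonzero {κ (+ 1) - δ} {κ (+ 1) + δ} w
      in nonzero-* {κ (+ 512)} (λ ()) (nonzero-* (at-1δ ν₂) (nonzero-* v v))
           (minus₁-tangent₂ γ δ (cross (κ (+ 5) - γ * γ) (κ (+ 5) - δ * δ) (κ (+ 1) - s + n) (κ (+ 1) + s + n) ν₁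
                   (minus₁-at-−1 s n γ t₁ t₂) ν₂ μ₂) (cross-leading (κ (+ 5) - γ * γ) (κ (+ 5) - δ * δ)
                   (κ (+ 1) - s + n) ν₁ ν₂))
    go (minus t₁ t₂) (plus t₃ t₄) =
      let ν₁ = minus₁-at-1 s n γ t₁ t₂ ; ν₂ = plus₂-at-1 s n δ t₃ t₄ ; μ₁ = minus₁-at-−1 s n γ t₁ t₂
          w : κ (+ 1) - γ * γ ≢ 0ℚ
          w = λ e → nonzero-* (at-1γ ν₁) (scaled-nonzero (κ (+ 8)) (κ (+ 1) + γ) (nonzero-* D≢0 μ≢0) μ₁) (trans (sym
                  (difference-of-squares γ)) e)
      in nonzero-* {κ (+ 128)} (λ ()) (nonzero-* w w)
           (minus₁-plus₂ γ δ (cross (κ (+ 5) - γ * γ) (κ (+ 5) - δ * δ) (κ (+ 1) - s + n) (κ (+ 1) + s + n) ν₁ μ₁ ν₂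
                   (plus₂-at-−1 s n δ t₃ t₄)) (cross-leading (κ (+ 5) - γ * γ) (κ (+ 5) - δ * δ)
                   (κ (+ 1) - s + n) ν₁ ν₂))
    go (minus t₁ t₂) (minus t₃ t₄) = case minus₁-minus₂ s n γ t₂ (norm-−1 t₄) of λ ()

-- The equations in coordinates over ℚ(√d), with q irrational

-- The right-hand side is what f₁(a + b√d) unfolds to, so that `cong im` applies to the curve
-- equation directly. Writing y = αq + β, the remainder c₁t + c₀ of f - (αt + β)² modulo t² - 2at +
-- (a² - db²) vanishes at q: its √d-coordinate is bc₁ and its rational coordinate is ac₁ + c₀, which
-- `real-part₁` uses.
imaginary-part₁ : ∀ d a b x y α β → x * y + y * x
    ≡ ((κ (+ 5) * a + d * (0ℚ * b)) * a + d * ((κ (+ 5) * b + 0ℚ * a) * b) - κ (+ 1)) * (a * b + b * a + 0ℚ)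
    + ((κ (+ 5) * a + d * (0ℚ * b)) * b + (κ (+ 5) * b + 0ℚ * a) * a - 0ℚ) * (a * a + d * (b * b) + κ (+ 3)) →
    y ≡ α * b → x ≡ β + α * a →
    b * (κ (+ 2) * a * (κ (+ 14) - α * α + κ (+ 2) * a * (κ (+ 0) + κ (+ 5) * (κ (+ 2) * a)) - κ (+ 5) * (a * a
    - d * (b * b))) - (a * a - d * (b * b)) * (κ (+ 0) + κ (+ 5) * (κ (+ 2) * a)) - κ (+ 0) - κ (+ 2) * α * β)
    ≡ κ (+ 0)
imaginary-part₁ d a b x y α β h₁ h₂ h₃ = equal-up-to (zero-sum (zero-sum (multiple (- κ (+ 1)) h₁)
    (multiple (κ (+ 2) * x) h₂)) (multiple (κ (+ 2) * b * α) h₃))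
    (solve (d List.∷ a List.∷ b List.∷ x List.∷ y List.∷ α List.∷ β List.∷ List.[]) ringℚ)

real-part₁ : ∀ d a b x y α β → x * x + d * (y * y)
    ≡ ((κ (+ 5) * a + d * (0ℚ * b)) * a + d * ((κ (+ 5) * b + 0ℚ * a) * b) - κ (+ 1)) * (a * a + d * (b * b)
    + κ (+ 3)) + d * (((κ (+ 5) * a + d * (0ℚ * b)) * b + (κ (+ 5) * b + 0ℚ * a) * a - 0ℚ) * (a * b + b * a + 0ℚ)) →
    y ≡ α * b → x ≡ β + α * a →
    κ (+ 2) * a * (κ (+ 14) - α * α + κ (+ 2) * a * (κ (+ 0) + κ (+ 5) * (κ (+ 2) * a)) - κ (+ 5) * (a * a
    - d * (b * b))) - (a * a - d * (b * b)) * (κ (+ 0) + κ (+ 5) * (κ (+ 2) * a)) - κ (+ 0) - κ (+ 2) * α * β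
    ≡ κ (+ 0) →
    κ (+ 11) - κ (+ 14) - β * β - (a * a - d * (b * b)) * (κ (+ 14) - α * α + κ (+ 2) * a * (κ (+ 0)
    + κ (+ 5) * (κ (+ 2) * a)) - κ (+ 5) * (a * a - d * (b * b)))
    ≡ κ (+ 0)
real-part₁ d a b x y α β h₁ h₂ h₃ h₄ = equal-up-to (zero-sum (zero-sum (zero-sum (multiple (- κ (+ 1)) h₁)
    (multiple (b * d * α + d * y) h₂)) (multiple (a * α + x + β) h₃)) (multiple (- a) h₄))
    (solve (d List.∷ a List.∷ b List.∷ x List.∷ y List.∷ α List.∷ β List.∷ List.[]) ringℚ)

rational-imaginary-part₁ : ∀ d a x y → x * y + y * x
    ≡ ((κ (+ 5) * a + d * (0ℚ * 0ℚ)) * a + d * ((κ (+ 5) * 0ℚ + 0ℚ * a) * 0ℚ) - κ (+ 1)) * (a * 0ℚ + 0ℚ * a + 0ℚ)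
    + ((κ (+ 5) * a + d * (0ℚ * 0ℚ)) * 0ℚ + (κ (+ 5) * 0ℚ + 0ℚ * a) * a - 0ℚ) * (a * a + d * (0ℚ * 0ℚ) + κ (+ 3)) →
    κ (+ 2) * (x * y) ≡ κ (+ 0)
rational-imaginary-part₁ d a x y h₁ = equal-up-to (multiple (κ (+ 1)) h₁)
    (solve (d List.∷ a List.∷ x List.∷ y List.∷ List.[]) ringℚ)

rational-real-part₁ : ∀ d a x y → x * x + d * (y * y)
    ≡ ((κ (+ 5) * a + d * (0ℚ * 0ℚ)) * a + d * ((κ (+ 5) * 0ℚ + 0ℚ * a) * 0ℚ) - κ (+ 1)) * (a * a + d * (0ℚ * 0ℚ)
    + κ (+ 3)) + d * (((κ (+ 5) * a + d * (0ℚ * 0ℚ)) * 0ℚ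
    + (κ (+ 5) * 0ℚ + 0ℚ * a) * a - 0ℚ) * (a * 0ℚ + 0ℚ * a + 0ℚ)) →
    x * x + d * (y * y) ≡ (κ (+ 5) * a * a - κ (+ 1)) * (a * a + κ (+ 3))
rational-real-part₁ d a x y h₁ = equal-up-to (multiple (κ (+ 1)) h₁)
    (solve (d List.∷ a List.∷ x List.∷ y List.∷ List.[]) ringℚ)

quartic₁ : ∀ r →
    κ (+ 5) * r * r * r * r + κ (+ 0) * r * r * r + κ (+ 14) * r * r - κ (+ 0) * r + (κ (+ 11) - κ (+ 14))
    ≡ (κ (+ 5) * r * r - κ (+ 1)) * (r * r + κ (+ 3))
quartic₁ = solve-∀ ringℚ

imaginary-part₂ : ∀ d a b x y α β → x * y + y * x
    ≡ (((κ (+ 5) * a + d * (0ℚ * b)) * a + d * ((κ (+ 5) * b + 0ℚ * a) * b)) * a + d * (((κ (+ 5) * a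
    + d * (0ℚ * b)) * b + (κ (+ 5) * b + 0ℚ * a) * a) * b)) * b + (((κ (+ 5) * a + d * (0ℚ * b)) * a
    + d * ((κ (+ 5) * b + 0ℚ * a) * b)) * b + ((κ (+ 5) * a + d * (0ℚ * b)) * b + (κ (+ 5) * b + 0ℚ * a) * a) * a) * a
    - (((κ (+ 8) * a + d * (0ℚ * b)) * a + d * ((κ (+ 8) * b + 0ℚ * a) * b)) * b + ((κ (+ 8) * a + d * (0ℚ * b)) * b
    + (κ (+ 8) * b + 0ℚ * a) * a) * a) + ((κ (+ 6) * a + d * (0ℚ * b)) * b + (κ (+ 6) * b + 0ℚ * a) * a)
    + (κ (+ 8) * b + 0ℚ * a) + 0ℚ →
    y ≡ α * b → x ≡ β + α * a →
    b * (κ (+ 2) * a * (κ (+ 6) - α * α + κ (+ 2) * a * (- κ (+ 8) + κ (+ 5) * (κ (+ 2) * a)) - κ (+ 5) * (a * a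
    - d * (b * b))) - (a * a - d * (b * b)) * (- κ (+ 8) + κ (+ 5) * (κ (+ 2) * a)) - - κ (+ 8) - κ (+ 2) * α * β)
    ≡ κ (+ 0)
imaginary-part₂ d a b x y α β h₁ h₂ h₃ = equal-up-to (zero-sum (zero-sum (multiple (- κ (+ 1)) h₁)
    (multiple (κ (+ 2) * x) h₂)) (multiple (κ (+ 2) * b * α) h₃))
    (solve (d List.∷ a List.∷ b List.∷ x List.∷ y List.∷ α List.∷ β List.∷ List.[]) ringℚ)

real-part₂ : ∀ d a b x y α β → x * x + d * (y * y)
    ≡ (((κ (+ 5) * a + d * (0ℚ * b)) * a + d * ((κ (+ 5) * b + 0ℚ * a) * b)) * a + d * (((κ (+ 5) * a
    + d * (0ℚ * b)) * b + (κ (+ 5) * b + 0ℚ * a) * a) * b)) * a + d * ((((κ (+ 5) * a + d * (0ℚ * b)) * a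
    + d * ((κ (+ 5) * b + 0ℚ * a) * b)) * b + ((κ (+ 5) * a + d * (0ℚ * b)) * b
    + (κ (+ 5) * b + 0ℚ * a) * a) * a) * b) - (((κ (+ 8) * a + d * (0ℚ * b)) * a
    + d * ((κ (+ 8) * b + 0ℚ * a) * b)) * a + d * (((κ (+ 8) * a + d * (0ℚ * b)) * b
    + (κ (+ 8) * b + 0ℚ * a) * a) * b)) + ((κ (+ 6) * a + d * (0ℚ * b)) * a + d * ((κ (+ 6) * b + 0ℚ * a) * b))
    + (κ (+ 8) * a + d * (0ℚ * b)) + κ (+ 5) →
    y ≡ α * b → x ≡ β + α * a →
    κ (+ 2) * a * (κ (+ 6) - α * α + κ (+ 2) * a * (- κ (+ 8) + κ (+ 5) * (κ (+ 2) * a)) - κ (+ 5) * (a * a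
    - d * (b * b))) - (a * a - d * (b * b)) * (- κ (+ 8) + κ (+ 5) * (κ (+ 2) * a)) - - κ (+ 8) - κ (+ 2) * α * β
    ≡ κ (+ 0) →
    κ (+ 11) - κ (+ 6) - β * β - (a * a - d * (b * b)) * (κ (+ 6) - α * α + κ (+ 2) * a * (- κ (+ 8)
    + κ (+ 5) * (κ (+ 2) * a)) - κ (+ 5) * (a * a - d * (b * b)))
    ≡ κ (+ 0)
real-part₂ d a b x y α β h₁ h₂ h₃ h₄ = equal-up-to (zero-sum (zero-sum (zero-sum (multiple (- κ (+ 1)) h₁)
    (multiple (b * d * α + d * y) h₂)) (multiple (a * α + x + β) h₃)) (multiple (- a) h₄))
    (solve (d List.∷ a List.∷ b List.∷ x List.∷ y List.∷ α List.∷ β List.∷ List.[]) ringℚ)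

rational-imaginary-part₂ : ∀ d a x y → x * y + y * x
    ≡ (((κ (+ 5) * a + d * (0ℚ * 0ℚ)) * a + d * ((κ (+ 5) * 0ℚ + 0ℚ * a) * 0ℚ)) * a + d * (((κ (+ 5) * a
    + d * (0ℚ * 0ℚ)) * 0ℚ + (κ (+ 5) * 0ℚ + 0ℚ * a) * a) * 0ℚ)) * 0ℚ + (((κ (+ 5) * a + d * (0ℚ * 0ℚ)) * a
    + d * ((κ (+ 5) * 0ℚ + 0ℚ * a) * 0ℚ)) * 0ℚ + ((κ (+ 5) * a + d * (0ℚ * 0ℚ)) * 0ℚ
    + (κ (+ 5) * 0ℚ + 0ℚ * a) * a) * a) * a - (((κ (+ 8) * a + d * (0ℚ * 0ℚ)) * a
    + d * ((κ (+ 8) * 0ℚ + 0ℚ * a) * 0ℚ)) * 0ℚ + ((κ (+ 8) * a + d * (0ℚ * 0ℚ)) * 0ℚ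
    + (κ (+ 8) * 0ℚ + 0ℚ * a) * a) * a) + ((κ (+ 6) * a + d * (0ℚ * 0ℚ)) * 0ℚ + (κ (+ 6) * 0ℚ + 0ℚ * a) * a)
    + (κ (+ 8) * 0ℚ + 0ℚ * a) + 0ℚ →
    κ (+ 2) * (x * y) ≡ κ (+ 0)
rational-imaginary-part₂ d a x y h₁ = equal-up-to (multiple (κ (+ 1)) h₁)
    (solve (d List.∷ a List.∷ x List.∷ y List.∷ List.[]) ringℚ)

rational-real-part₂ : ∀ d a x y → x * x + d * (y * y)
    ≡ (((κ (+ 5) * a + d * (0ℚ * 0ℚ)) * a + d * ((κ (+ 5) * 0ℚ + 0ℚ * a) * 0ℚ)) * a + d * (((κ (+ 5) * a
    + d * (0ℚ * 0ℚ)) * 0ℚ + (κ (+ 5) * 0ℚ + 0ℚ * a) * a) * 0ℚ)) * a + d * ((((κ (+ 5) * a + d * (0ℚ * 0ℚ)) * a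
    + d * ((κ (+ 5) * 0ℚ + 0ℚ * a) * 0ℚ)) * 0ℚ + ((κ (+ 5) * a + d * (0ℚ * 0ℚ)) * 0ℚ
    + (κ (+ 5) * 0ℚ + 0ℚ * a) * a) * a) * 0ℚ) - (((κ (+ 8) * a + d * (0ℚ * 0ℚ)) * a
    + d * ((κ (+ 8) * 0ℚ + 0ℚ * a) * 0ℚ)) * a + d * (((κ (+ 8) * a + d * (0ℚ * 0ℚ)) * 0ℚ
    + (κ (+ 8) * 0ℚ + 0ℚ * a) * a) * 0ℚ)) + ((κ (+ 6) * a + d * (0ℚ * 0ℚ)) * a + d * ((κ (+ 6) * 0ℚ + 0ℚ * a) * 0ℚ))
    + (κ (+ 8) * a + d * (0ℚ * 0ℚ)) + κ (+ 5) →
    x * x + d * (y * y) ≡ κ (+ 5) * a * a * a * a - κ (+ 8) * a * a * a + κ (+ 6) * a * a + κ (+ 8) * a + κ (+ 5)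
rational-real-part₂ d a x y h₁ = equal-up-to (multiple (κ (+ 1)) h₁)
    (solve (d List.∷ a List.∷ x List.∷ y List.∷ List.[]) ringℚ)

quartic₂ : ∀ r →
    κ (+ 5) * r * r * r * r + - κ (+ 8) * r * r * r + κ (+ 6) * r * r - - κ (+ 8) * r + (κ (+ 11) - κ (+ 6))
    ≡ κ (+ 5) * r * r * r * r - κ (+ 8) * r * r * r + κ (+ 6) * r * r + κ (+ 8) * r + κ (+ 5)
quartic₂ = solve-∀ ringℚ

norm-at-1 : ∀ d a b → κ (+ 1) - κ (+ 2) * a + (a * a - d * (b * b)) ≡ (κ (+ 1) - a) * (κ (+ 1) - a) - d * (b * b)
norm-at-1 = solve-∀ ringℚ

norm-at-−1 : ∀ d a b → κ (+ 1) + κ (+ 2) * a + (a * a - d * (b * b)) ≡ (κ (+ 1) + a) * (κ (+ 1) + a) - d * (b * b)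
norm-at-−1 = solve-∀ ringℚ

ratio-square : ∀ d x b t → t * b ≡ x → x * x - d * (b * b) ≡ κ (+ 0) → b * b * (t * t - d) ≡ κ (+ 0)
ratio-square d x b t h₁ h₂ = equal-up-to (zero-sum (multiple (t * b + x) h₁) (multiple (κ (+ 1)) h₂))
    (solve (d List.∷ x List.∷ b List.∷ t List.∷ List.[]) ringℚ)

norm-nonzero : ∀ {d} → NonSquare d → ∀ x b → b ≢ 0ℚ → x * x - d * (b * b) ≢ 0ℚ
norm-nonzero {d} ns x b b≢0 e = ns t (difference-zero (cancel-factor (b * b) (t * t - d) (nonzero-* b≢0 b≢0)
        (ratio-square d x b t (proj₂ quotient) e)))
  where
  quotient = divide x b b≢0
  t = proj₁ quotient

module _ {d a b : ℚ} (b≢0 : b ≢ 0ℚ) (ns : NonSquare d) where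
  private
    ν≢0 : κ (+ 1) - κ (+ 2) * a + (a * a - d * (b * b)) ≢ 0ℚ
    ν≢0 e = norm-nonzero ns (κ (+ 1) - a) b b≢0 (trans (sym (norm-at-1 d a b)) e)
    μ≢0 : κ (+ 1) + κ (+ 2) * a + (a * a - d * (b * b)) ≢ 0ℚ
    μ≢0 e = norm-nonzero ns (κ (+ 1) + a) b b≢0 (trans (sym (norm-at-−1 d a b)) e)

    split : ∀ x y → ∃₂ λ α β → y ≡ α * b × x ≡ β + α * a
    split x y = α , x - α * a , sym (proj₂ quotient) , l x (α * a)
      where
      quotient = divide y b b≢0
      α = proj₁ quotient
      l : ∀ x z → x ≡ x - z + z
      l = solve-∀ ringℚ

    pencil₁ : ∀ x y → x * x + d * (y * y)
        ≡ ((κ (+ 5) * a + d * (0ℚ * b)) * a + d * ((κ (+ 5) * b + 0ℚ * a) * b) - κ (+ 1)) * (a * a + d * (b * b)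
        + κ (+ 3)) + d * (((κ (+ 5) * a + d * (0ℚ * b)) * b + (κ (+ 5) * b + 0ℚ * a) * a - 0ℚ) * (a * b
        + b * a + 0ℚ)) →
        x * y + y * x
        ≡ ((κ (+ 5) * a + d * (0ℚ * b)) * a + d * ((κ (+ 5) * b + 0ℚ * a) * b) - κ (+ 1)) * (a * b + b * a + 0ℚ)
        + ((κ (+ 5) * a + d * (0ℚ * b)) * b + (κ (+ 5) * b + 0ℚ * a) * a - 0ℚ) * (a * a + d * (b * b) + κ (+ 3)) →
        ∃ λ γ → Pencil (κ (+ 0)) (κ (+ 14)) (κ (+ 6)) (κ (+ 2) * a) (a * a - d * (b * b)) γ
    pencil₁ x y real imaginary =
      let α , β , y≡ , x≡ = split x y
          c₁ = cancel-factor b (κ (+ 2) * a * (κ (+ 14) - α * α + κ (+ 2) * a * (κ (+ 0) + κ (+ 5) *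
                  (κ (+ 2) * a)) - κ (+ 5) * (a * a - d * (b * b))) - (a * a - d * (b * b)) * (κ (+ 0) + κ (+ 5) *
                  (κ (+ 2) * a)) - κ (+ 0) - κ (+ 2) * α * β) b≢0 (imaginary-part₁ d a b x y α β imaginary y≡ x≡)
      in chord (κ (+ 0)) (κ (+ 14)) (κ (+ 6)) refl (λ r y e → E₁-points r y (trans e (quartic₁ r))) (κ (+ 2) * a)
              (a * a - d * (b * b)) α β ν≢0 c₁
           (real-part₁ d a b x y α β real y≡ x≡ c₁)

    pencil₂ : ∀ x y → x * x + d * (y * y)
        ≡ (((κ (+ 5) * a + d * (0ℚ * b)) * a + d * ((κ (+ 5) * b + 0ℚ * a) * b)) * a + d * (((κ (+ 5) * a
        + d * (0ℚ * b)) * b + (κ (+ 5) * b + 0ℚ * a) * a) * b)) * a + d * ((((κ (+ 5) * a + d * (0ℚ * b)) * a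
        + d * ((κ (+ 5) * b + 0ℚ * a) * b)) * b + ((κ (+ 5) * a + d * (0ℚ * b)) * b
        + (κ (+ 5) * b + 0ℚ * a) * a) * a) * b) - (((κ (+ 8) * a + d * (0ℚ * b)) * a
        + d * ((κ (+ 8) * b + 0ℚ * a) * b)) * a + d * (((κ (+ 8) * a + d * (0ℚ * b)) * b
        + (κ (+ 8) * b + 0ℚ * a) * a) * b)) + ((κ (+ 6) * a + d * (0ℚ * b)) * a + d * ((κ (+ 6) * b + 0ℚ * a) * b))
        + (κ (+ 8) * a + d * (0ℚ * b)) + κ (+ 5) →
        x * y + y * x
        ≡ (((κ (+ 5) * a + d * (0ℚ * b)) * a + d * ((κ (+ 5) * b + 0ℚ * a) * b)) * a + d * (((κ (+ 5) * a
        + d * (0ℚ * b)) * b + (κ (+ 5) * b + 0ℚ * a) * a) * b)) * b + (((κ (+ 5) * a + d * (0ℚ * b)) * a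
        + d * ((κ (+ 5) * b + 0ℚ * a) * b)) * b + ((κ (+ 5) * a + d * (0ℚ * b)) * b
        + (κ (+ 5) * b + 0ℚ * a) * a) * a) * a - (((κ (+ 8) * a + d * (0ℚ * b)) * a
        + d * ((κ (+ 8) * b + 0ℚ * a) * b)) * b + ((κ (+ 8) * a + d * (0ℚ * b)) * b + (κ (+ 8) * b + 0ℚ * a) * a) * a)
        + ((κ (+ 6) * a + d * (0ℚ * b)) * b + (κ (+ 6) * b + 0ℚ * a) * a) + (κ (+ 8) * b + 0ℚ * a) + 0ℚ →
        ∃ λ γ → Pencil (- κ (+ 8)) (κ (+ 6)) (κ (+ 2)) (κ (+ 2) * a) (a * a - d * (b * b)) γ
    pencil₂ x y real imaginary =
      let α , β , y≡ , x≡ = split x y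
          c₁ = cancel-factor b (κ (+ 2) * a * (κ (+ 6) - α * α + κ (+ 2) * a * (- κ (+ 8) + κ (+ 5) *
                  (κ (+ 2) * a)) - κ (+ 5) * (a * a - d * (b * b))) - (a * a - d * (b * b)) * (- κ (+ 8) + κ (+ 5) *
                  (κ (+ 2) * a)) - - κ (+ 8) - κ (+ 2) * α * β) b≢0 (imaginary-part₂ d a b x y α β imaginary y≡ x≡)
      in chord (- κ (+ 8)) (κ (+ 6)) (κ (+ 2)) refl (λ r y e → E₂-points r y (trans e (quartic₂ r))) (κ (+ 2) * a)
              (a * a - d * (b * b)) α β ν≢0 c₁
           (real-part₂ d a b x y α β real y≡ x≡ c₁)

  no-irrational : ∀ y z → ¬ OnY d (a +√ b) y z
  no-irrational (x +√ y) (x′ +√ y′) (e , e′) =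
    let γ , pencil = pencil₁ x y (cong re e) (cong im e)
        δ , pencil′ = pencil₂ x′ y′ (cong re e′) (cong im e′)
    in incompatible ν≢0 μ≢0 γ δ pencil pencil′

-- Rational q with irrational y and z: the square class of f₁

-- These are J⁴f₁(I/J) and J⁴f₂(I/J). The second uses f₂ = (q² - 4q - 1)² + 4(q² - 1)², which makes
-- its sign evident.
form₁ form₂ : ℤ → ℤ → ℤ
form₁ I J = (+ 5 ℤ.* I ℤ.* I ℤ.- J ℤ.* J) ℤ.* (I ℤ.* I ℤ.+ + 3 ℤ.* J ℤ.* J)
form₂ I J = (I ℤ.* I ℤ.- + 4 ℤ.* I ℤ.* J ℤ.- J ℤ.* J) ℤ.* (I ℤ.* I ℤ.- + 4 ℤ.* I ℤ.* J ℤ.- J ℤ.* J) ℤ.+ + 4 ℤ.*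
        ((I ℤ.* I ℤ.- J ℤ.* J) ℤ.* (I ℤ.* I ℤ.- J ℤ.* J))

-- The ideal of the two quartic forms contains 1280I⁷ and 256J⁷, with cubic cofactors, as
-- elimination predicts for forms without common zero. For coprime I and J a common divisor of the
-- values therefore divides 1280 = 2⁸ · 5.
bezout-I : ∀ I J → + 1280 ℤ.* (I ℤ.* ((I ℤ.* I) ℤ.* ((I ℤ.* I) ℤ.* (I ℤ.* I))))
    ≡ ((+ 171) ℤ.* (I ℤ.* I ℤ.* I) ℤ.+ (ℤ.- + 117) ℤ.* (I ℤ.* I ℤ.* J) ℤ.+ (ℤ.- + 161) ℤ.* (I ℤ.* J ℤ.* J) ℤ.+
            (ℤ.- + 85) ℤ.* (J ℤ.* J ℤ.* J)) ℤ.* ((+ 5 ℤ.* I ℤ.* I ℤ.- J ℤ.* J) ℤ.* (I ℤ.* I ℤ.+ + 3 ℤ.* J ℤ.* J)) ℤ.+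
            ((+ 85) ℤ.* (I ℤ.* I ℤ.* I) ℤ.+ (+ 253) ℤ.* (I ℤ.* I ℤ.* J) ℤ.+ (ℤ.- + 15) ℤ.* (I ℤ.* J ℤ.* J) ℤ.+
            (ℤ.- + 51) ℤ.* (J ℤ.* J ℤ.* J)) ℤ.* ((I ℤ.* I ℤ.- + 4 ℤ.* I ℤ.* J ℤ.- J ℤ.* J) ℤ.*
            (I ℤ.* I ℤ.- + 4 ℤ.* I ℤ.* J ℤ.- J ℤ.* J) ℤ.+ + 4 ℤ.* ((I ℤ.* I ℤ.- J ℤ.* J) ℤ.* (I ℤ.* I ℤ.- J ℤ.* J)))
bezout-I = ℤ-Solver.solve-∀

bezout-J : ∀ I J → + 256 ℤ.* (J ℤ.* ((J ℤ.* J) ℤ.* ((J ℤ.* J) ℤ.* (J ℤ.* J))))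
    ≡ ((+ 15) ℤ.* (I ℤ.* I ℤ.* I) ℤ.+ (ℤ.- + 39) ℤ.* (I ℤ.* I ℤ.* J) ℤ.+ (+ 47) ℤ.* (I ℤ.* J ℤ.* J) ℤ.+ (ℤ.- + 7) ℤ.*
            (J ℤ.* J ℤ.* J)) ℤ.* ((+ 5 ℤ.* I ℤ.* I ℤ.- J ℤ.* J) ℤ.* (I ℤ.* I ℤ.+ + 3 ℤ.* J ℤ.* J)) ℤ.+ ((ℤ.- + 15) ℤ.*
            (I ℤ.* I ℤ.* I) ℤ.+ (+ 15) ℤ.* (I ℤ.* I ℤ.* J) ℤ.+ (ℤ.- + 47) ℤ.* (I ℤ.* J ℤ.* J) ℤ.+ (+ 47) ℤ.*
            (J ℤ.* J ℤ.* J)) ℤ.* ((I ℤ.* I ℤ.- + 4 ℤ.* I ℤ.* J ℤ.- J ℤ.* J) ℤ.*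
            (I ℤ.* I ℤ.- + 4 ℤ.* I ℤ.* J ℤ.- J ℤ.* J) ℤ.+ + 4 ℤ.* ((I ℤ.* I ℤ.- J ℤ.* J) ℤ.* (I ℤ.* I ℤ.- J ℤ.* J)))
bezout-J = ℤ-Solver.solve-∀

factor : ∀ P Q f h g → P ℤ.* (f ℤ.* g) ℤ.+ Q ℤ.* (h ℤ.* g) ≡ (P ℤ.* f ℤ.+ Q ℤ.* h) ℤ.* g
factor = ℤ-Solver.solve-∀

rearrange : ∀ I J → form₁ I J ℤ.+ (J ℤ.* J) ℤ.* (I ℤ.* I ℤ.+ + 3 ℤ.* (J ℤ.* J))
    ≡ + 5 ℤ.* (I ℤ.* I) ℤ.* (I ℤ.* I ℤ.+ + 3 ℤ.* (J ℤ.* J))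
rearrange = unfolded
  where
  unfolded : ∀ I J →
      ((+ 5 ℤ.* I ℤ.* I ℤ.- J ℤ.* J) ℤ.* (I ℤ.* I ℤ.+ + 3 ℤ.* J ℤ.* J)) ℤ.+ (J ℤ.* J) ℤ.* (I ℤ.* I ℤ.+ + 3 ℤ.* (J ℤ.* J))
      ≡ + 5 ℤ.* (I ℤ.* I) ℤ.* (I ℤ.* I ℤ.+ + 3 ℤ.* (J ℤ.* J))
  unfolded = ℤ-Solver.solve-∀

seventh : ℕ → ℕ
seventh a = a ℕ.* ((a ℕ.* a) ℕ.* ((a ℕ.* a) ℕ.* (a ℕ.* a)))

abs-seventh : ∀ z → ∣ z ℤ.* ((z ℤ.* z) ℤ.* ((z ℤ.* z) ℤ.* (z ℤ.* z))) ∣ ≡ seventh (∣ z ∣)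
abs-seventh z = trans (ℤₚ.abs-* z _) (cong (∣ z ∣ ℕ.*_) (trans (ℤₚ.abs-* (z ℤ.* z) _) (cong₂ ℕ._*_ (ℤₚ.abs-* z z)
  (trans (ℤₚ.abs-* (z ℤ.* z) (z ℤ.* z)) (cong₂ ℕ._*_ (ℤₚ.abs-* z z) (ℤₚ.abs-* z z))))))

coprime-seventh : ∀ {a b} → Coprime a b → Coprime a (seventh b)
coprime-seventh c = coprime-* c (coprime-* c² (coprime-* c² c²))
  where c² = coprime-* c c

common-divisor∣1280 : ∀ I J f h g → Coprime ∣ I ∣ ∣ J ∣ → form₁ I J ≡ + (f ℕ.* g) → form₂ I J ≡ + (h ℕ.* g) → g ∣ 1280
common-divisor∣1280 I J f h g cop e₁ e₂ = Coprimality.coprime-factors {o = 1280}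
    (Coprimality.sym (coprime-seventh (Coprimality.sym (coprime-seventh cop)))) (commuted (abs I) on-I , commuted
            (abs J) (∣-trans on-J (256∣1280 (abs J))))
  where
  abs : ℤ → ℕ
  abs z = ∣ z ∣
  commuted : ∀ a → g ∣ 1280 ℕ.* seventh a → g ∣ seventh a ℕ.* 1280
  commuted a = subst (g ∣_) (ℕₚ.*-comm 1280 (seventh a))
  256∣1280 : ∀ a → 256 ℕ.* seventh a ∣ 1280 ℕ.* seventh a
  256∣1280 a = divides 5 (ℕₚ.*-assoc 5 256 (seventh a))
  multiple-of-g : ∀ c z P Q → + c ℤ.* (z ℤ.* ((z ℤ.* z) ℤ.* ((z ℤ.* z) ℤ.* (z ℤ.* z))))
      ≡ P ℤ.* form₁ I J ℤ.+ Q ℤ.* form₂ I J → g ∣ (c ℕ.* seventh (abs z))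
  multiple-of-g c z P Q e = divides ∣ P ℤ.* + f ℤ.+ Q ℤ.* + h ∣ (trans (sym (trans (ℤₚ.abs-* (+ c) _) (cong (c ℕ.*_)
          (abs-seventh z))))
    (trans (cong ∣_∣ (trans e (trans (cong₂ (λ x y → P ℤ.* x ℤ.+ Q ℤ.* y) (trans e₁ (ℤₚ.pos-* f g)) (trans e₂
            (ℤₚ.pos-* h g))) (factor P Q (+ f) (+ h) (+ g)))))
      (ℤₚ.abs-* (P ℤ.* + f ℤ.+ Q ℤ.* + h) (+ g))))
  on-I : g ∣ (1280 ℕ.* seventh (abs I))
  on-I = multiple-of-g 1280 I ((+ 171) ℤ.* (I ℤ.* I ℤ.* I) ℤ.+ (ℤ.- + 117) ℤ.* (I ℤ.* I ℤ.* J) ℤ.+ (ℤ.- + 161) ℤ.*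
          (I ℤ.* J ℤ.* J) ℤ.+ (ℤ.- + 85) ℤ.* (J ℤ.* J ℤ.* J)) ((+ 85) ℤ.* (I ℤ.* I ℤ.* I) ℤ.+ (+ 253) ℤ.*
          (I ℤ.* I ℤ.* J) ℤ.+ (ℤ.- + 15) ℤ.* (I ℤ.* J ℤ.* J) ℤ.+ (ℤ.- + 51) ℤ.* (J ℤ.* J ℤ.* J)) (bezout-I I J)
  on-J : g ∣ (256 ℕ.* seventh (abs J))
  on-J = multiple-of-g 256 J ((+ 15) ℤ.* (I ℤ.* I ℤ.* I) ℤ.+ (ℤ.- + 39) ℤ.* (I ℤ.* I ℤ.* J) ℤ.+ (+ 47) ℤ.*
          (I ℤ.* J ℤ.* J) ℤ.+ (ℤ.- + 7) ℤ.* (J ℤ.* J ℤ.* J)) ((ℤ.- + 15) ℤ.* (I ℤ.* I ℤ.* I) ℤ.+ (+ 15) ℤ.*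
          (I ℤ.* I ℤ.* J) ℤ.+ (ℤ.- + 47) ℤ.* (I ℤ.* J ℤ.* J) ℤ.+ (+ 47) ℤ.* (J ℤ.* J ℤ.* J)) (bezout-J I J)

data Class (g : ℕ) : Set where
  class : ∀ c t → c ≡ 1 ⊎ c ≡ 5 ⊎ c ≡ 2 ⊎ c ≡ 10 → g ≡ c ℕ.* (t ℕ.* t) → Class g

divisor-class : ∀ k {g} → g ∣ 2 ℕ.^ k ℕ.* 5 → Class g
divisor-class zero {g} d = case prime⇒irreducible prime-5 d of λ
  { (inj₁ e) → class 1 1 (inj₁ refl) e ; (inj₂ e) → class 5 1 (inj₂ (inj₁ refl)) e }
divisor-class (suc k) {g} d = case even-or-odd g of λ
  { (inj₂ o) → divisor-class k (coprime-divisor (coprime-2 o) (subst (g ∣_) (ℕₚ.*-assoc 2 (2 ℕ.^ k) 5) d))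
  ; (inj₁ (g′ , e)) → double {g} {g′} e (divisor-class k (*-cancelˡ-∣ 2 (subst₂ _∣_ e (ℕₚ.*-assoc 2 (2 ℕ.^ k) 5) d))) }
  where
  double : ∀ {g g′} → g ≡ 2 ℕ.* g′ → Class g′ → Class g
  double e (class .1 t (inj₁ refl) refl) = class 2 t (inj₂ (inj₂ (inj₁ refl))) (trans e (l t))
    where
    l : ∀ t → 2 ℕ.* (1 ℕ.* (t ℕ.* t)) ≡ 2 ℕ.* (t ℕ.* t)
    l = ℕ-Solver.solve-∀
  double e (class .5 t (inj₂ (inj₁ refl)) refl) = class 10 t (inj₂ (inj₂ (inj₂ refl))) (trans e (l t))
    where
    l : ∀ t → 2 ℕ.* (5 ℕ.* (t ℕ.* t)) ≡ 10 ℕ.* (t ℕ.* t)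
    l = ℕ-Solver.solve-∀
  double e (class .2 t (inj₂ (inj₂ (inj₁ refl))) refl) = class 1 (2 ℕ.* t) (inj₁ refl) (trans e (l t))
    where
    l : ∀ t → 2 ℕ.* (2 ℕ.* (t ℕ.* t)) ≡ 1 ℕ.* (2 ℕ.* t ℕ.* (2 ℕ.* t))
    l = ℕ-Solver.solve-∀
  double e (class .10 t (inj₂ (inj₂ (inj₂ refl))) refl) = class 5 (2 ℕ.* t) (inj₂ (inj₁ refl)) (trans e (l t))
    where
    l : ∀ t → 2 ℕ.* (10 ℕ.* (t ℕ.* t)) ≡ 5 ℕ.* (2 ℕ.* t ℕ.* (2 ℕ.* t))
    l = ℕ-Solver.solve-∀

odd-mod-32 : ∀ {n} → Odd n → T (oddᵇ (n ℕ.% 32))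
odd-mod-32 {n} o = case halves n of λ
  { (inj₁ (k , e)) → ⊥-elim (odd-even-⊥ o (divides k (trans e (ℕₚ.*-comm 2 k))))
  ; (inj₂ (k , e)) → consequence 32 2 (var 0F ≗ lit 1 ⊞ lit 2 ⊠ var 1F ∷ []) (λ _ → true) (λ {
          (n ∷ _) → oddᵇ n }) refl (n ∷ k ∷ []) tt e }

-- The equation says cs² = (5a² - j²)(a² + 3j²). If one of a, j is even, the right side is odd. If
-- both are odd, each factor is 4 modulo 8, so the product is exactly divisible by 2⁴; but cs² has
-- odd 2-adic valuation. The modulus 32 is what detects this.
even-class : ∀ {a j s} c → c ≡ 2 ⊎ c ≡ 10 → Coprime a j →
             c ℕ.* (s ℕ.* s) ℕ.+ j ℕ.* j ℕ.* (a ℕ.* a ℕ.+ 3 ℕ.* (j ℕ.* j)) ≢ 5 ℕ.* (a ℕ.* a) ℕ.* (a ℕ.* a ℕ.+ 3 ℕ.* (j ℕ.* j))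
even-class {a} {j} {s} c c∈ cop e = check c∈ e (case odd-or-odd cop of λ
  { (inj₁ o) → T-∨₁ (odd-mod-32 o) ; (inj₂ o) → T-∨₂ (oddᵇ (a ℕ.% 32)) (odd-mod-32 o) })
  where
  T-∨₁ : ∀ {x y} → T x → T (x ∨ y)
  T-∨₁ {true} _ = tt
  T-∨₂ : ∀ x {y} → T y → T (x ∨ y)
  T-∨₂ true _ = tt
  T-∨₂ false p = p
  equation : ℕ → Equation 3
  equation c = lit c ⊠ (var 2F ⊠ var 2F) ⊞ var 1F ⊠ var 1F ⊠ (var 0F ⊠ var 0F ⊞ lit 3 ⊠ (var 1F ⊠ var 1F)) ≗ lit 5 ⊠
          (var 0F ⊠ var 0F) ⊠ (var 0F ⊠ var 0F ⊞ lit 3 ⊠ (var 1F ⊠ var 1F))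
  check : ∀ {c} → c ≡ 2 ⊎ c ≡ 10 → c ℕ.* (s ℕ.* s) ℕ.+ j ℕ.* j ℕ.* (a ℕ.* a ℕ.+ 3 ℕ.* (j ℕ.* j))
      ≡ 5 ℕ.* (a ℕ.* a) ℕ.* (a ℕ.* a ℕ.+ 3 ℕ.* (j ℕ.* j)) →
          T (oddᵇ (a ℕ.% 32) ∨ oddᵇ (j ℕ.% 32)) → ⊥
  check (inj₁ refl) e o = consequence 32 3 (equation 2 ∷ []) (λ { (a ∷ j ∷ _) → oddᵇ a ∨ oddᵇ j }) (λ _ → false) refl
          (a ∷ j ∷ s ∷ []) o e
  check (inj₂ refl) e o = consequence 32 3 (equation 10 ∷ []) (λ { (a ∷ j ∷ _) → oddᵇ a ∨ oddᵇ j }) (λ _ → false) refl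
          (a ∷ j ∷ s ∷ []) o e

homogenise₁ : ∀ q y → (κ (+ 5) * (q * y) * (q * y) - y * y) * (q * y * (q * y) + κ (+ 3) * y * y)
    ≡ (κ (+ 5) * q * q - κ (+ 1)) * (q * q + κ (+ 3)) * (y * y * (y * y))
homogenise₁ = solve-∀ ringℚ

homogenise₂ : ∀ q y →
    (q * y * (q * y) - κ (+ 4) * (q * y) * y - y * y) * (q * y * (q * y) - κ (+ 4) * (q * y) * y - y * y)
    + κ (+ 4) * ((q * y * (q * y) - y * y) * (q * y * (q * y) - y * y))
    ≡ (κ (+ 5) * q * q * q * q - κ (+ 8) * q * q * q + κ (+ 6) * q * q + κ (+ 8) * q + κ (+ 5)) * (y * y * (y * y))
homogenise₂ = solve-∀ ringℚ

κ-- : ∀ a b → κ (a ℤ.- b) ≡ κ a - κ b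
κ-- a b = trans (l (κ (a ℤ.- b)) (κ b)) (cong (_- κ b) (trans (sym (κ-+ (a ℤ.- b) b)) (cong κ (m a b))))
  where
  l : ∀ x y → x ≡ x + y - y
  l = solve-∀ ringℚ
  m : ∀ a b → a ℤ.- b ℤ.+ b ≡ a
  m = ℤ-Solver.solve-∀

-- The equation is wrapped so that z can be inferred.
record _≐_ (z : ℤ) (x : ℚ) : Set where
  constructor represents
  field
    value : κ z ≡ x
open _≐_ using (value)

infix 4 _≐_
infixl 7 _⟨*⟩_
infixl 6 _⟨+⟩_ _⟨-⟩_

_⟨*⟩_ : ∀ {a b x y} → a ≐ x → b ≐ y → a ℤ.* b ≐ x * y
_⟨*⟩_ {a} {b} (represents e) (represents f) = represents (trans (κ-* a b) (cong₂ _*_ e f))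

_⟨+⟩_ : ∀ {a b x y} → a ≐ x → b ≐ y → a ℤ.+ b ≐ x + y
_⟨+⟩_ {a} {b} (represents e) (represents f) = represents (trans (κ-+ a b) (cong₂ _+_ e f))

_⟨-⟩_ : ∀ {a b x y} → a ≐ x → b ≐ y → a ℤ.- b ≐ x - y
_⟨-⟩_ {a} {b} (represents e) (represents f) = represents (trans (κ-- a b) (cong₂ _-_ e f))

literal : ∀ n → + n ≐ κ (+ n)
literal n = represents refl

κ-form₁ : ∀ {I J q y} → I ≐ q * y → J ≐ y → κ (form₁ I J)
    ≡ (κ (+ 5) * q * q - κ (+ 1)) * (q * q + κ (+ 3)) * (y * y * (y * y))
κ-form₁ {I} {J} {q} {y} i j = trans (value ((literal 5 ⟨*⟩ i ⟨*⟩ i ⟨-⟩ j ⟨*⟩ j) ⟨*⟩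
        (i ⟨*⟩ i ⟨+⟩ literal 3 ⟨*⟩ j ⟨*⟩ j))) (homogenise₁ q y)

κ-form₂ : ∀ {I J q y} → I ≐ q * y → J ≐ y → κ (form₂ I J)
    ≡ (κ (+ 5) * q * q * q * q - κ (+ 8) * q * q * q + κ (+ 6) * q * q + κ (+ 8) * q + κ (+ 5)) * (y * y * (y * y))
κ-form₂ {I} {J} {q} {y} i j = trans (value (A ⟨*⟩ A ⟨+⟩ literal 4 ⟨*⟩ (B ⟨*⟩ B))) (homogenise₂ q y)
  where
  A = i ⟨*⟩ i ⟨-⟩ literal 4 ⟨*⟩ i ⟨*⟩ j ⟨-⟩ j ⟨*⟩ j
  B = i ⟨*⟩ i ⟨-⟩ j ⟨*⟩ j

f₂-nonzero : ∀ q → κ (+ 5) * q * q * q * q - κ (+ 8) * q * q * q + κ (+ 6) * q * q + κ (+ 8) * q + κ (+ 5) ≢ 0ℚ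
f₂-nonzero q e = case E₂-points q 0ℚ (sym e) of λ
  { (inj₁ refl) → case e of λ () ; (inj₂ refl) → case e of λ () }

form₂-nonnegative : ∀ I J → ∃ λ h → form₂ I J ≡ + h
form₂-nonnegative I J = ∣ A ∣ ℕ.* ∣ A ∣ ℕ.+ 4 ℕ.* (∣ B ∣ ℕ.* ∣ B ∣) ,
  trans (cong₂ (λ x y → x ℤ.+ + 4 ℤ.* y) (square-∣∣ A) (square-∣∣ B))
    (trans (cong (λ y → + (∣ A ∣ ℕ.* ∣ A ∣) ℤ.+ y) (sym (ℤₚ.pos-* 4 (∣ B ∣ ℕ.* ∣ B ∣)))) (sym (ℤₚ.pos-+
            (∣ A ∣ ℕ.* ∣ A ∣) (4 ℕ.* (∣ B ∣ ℕ.* ∣ B ∣)))))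
  where
  A = I ℤ.* I ℤ.- + 4 ℤ.* I ℤ.* J ℤ.- J ℤ.* J
  B = I ℤ.* I ℤ.- J ℤ.* J

nonnegative-factor : ∀ x h m → h ≢ 0 → x ℤ.* + h ≡ + m → ∃ λ f → x ≡ + f × f ℕ.* h ≡ m
nonnegative-factor (+ f) h m _ e = f , refl , ℤₚ.+-injective (trans (ℤₚ.pos-* f h) e)
nonnegative-factor -[1+ n ] zero m h≢0 e = ⊥-elim (h≢0 refl)
nonnegative-factor -[1+ n ] (suc h) m _ ()

-- Let g = gcd(h, f), f = f₀g and h = h₀g. Then f₀h₀ is a square with coprime factors, so f₀ is a
-- square and f lies in the square class of g. The bound 1280 = 2⁸ · 5 accounts for the argument 8
-- of `divisor-class`.
square-class : ∀ {f h m} → f ℕ.* h ≡ m ℕ.* m → h ≢ 0 → (∀ {g f₀ h₀} → f ≡ f₀ ℕ.* g → h ≡ h₀ ℕ.* g → g ∣ 1280) → Class f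
square-class {f} {h} {m} e h≢0 bound = go (gcd-split h f h≢0)
  where
  rearrange′ : ∀ f h g → f ℕ.* g ℕ.* (h ℕ.* g) ≡ f ℕ.* h ℕ.* (g ℕ.* g)
  rearrange′ = ℕ-Solver.solve-∀
  absorb : ∀ s c t → s ℕ.* s ℕ.* (c ℕ.* (t ℕ.* t)) ≡ c ℕ.* (s ℕ.* t ℕ.* (s ℕ.* t))
  absorb = ℕ-Solver.solve-∀
  go : (∃ λ g → ∃₂ λ h₀ f₀ → g ≢ 0 × h ≡ h₀ ℕ.* g × f ≡ f₀ ℕ.* g × Coprime h₀ f₀) → Class f
  go (g , h₀ , f₀ , g≢0 , h≡ , f≡ , cop) =
    let s , _ , s² = square-descale (f₀ ℕ.* h₀) g≢0 m (trans (sym e) (trans (cong₂ ℕ._*_ f≡ h≡) (rearrange′ f₀ h₀ g)))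
        t , t² = square-factor {f₀} {h₀} {s} (Coprimality.sym cop) (sym s²)
    in combine t t² (divisor-class 8 (bound {g} {f₀} {h₀} f≡ h≡))
    where
    combine : ∀ t → f₀ ≡ t ℕ.* t → Class g → Class f
    combine t t² (class c u c∈ g≡) = class c (t ℕ.* u) c∈ (trans f≡ (trans (cong₂ ℕ._*_ t² g≡) (absorb t c u)))

-- The negative contribution J²(I² + 3J²) is moved to the other side, giving an identity of natural
-- numbers as the congruence checks require.
natural-relation : ∀ I J f → form₁ I J ≡ + f →
  f ℕ.+ ∣ J ∣ ℕ.* ∣ J ∣ ℕ.* (∣ I ∣ ℕ.* ∣ I ∣ ℕ.+ 3 ℕ.* (∣ J ∣ ℕ.* ∣ J ∣)) ≡ 5 ℕ.* (∣ I ∣ ℕ.* ∣ I ∣) ℕ.*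
          (∣ I ∣ ℕ.* ∣ I ∣ ℕ.+ 3 ℕ.* (∣ J ∣ ℕ.* ∣ J ∣))
natural-relation I J f e = ℤₚ.+-injective (trans (fold-left a j)
    (trans (cong₂ ℤ._+_ (sym e) (cong₂ (λ i j → j ℤ.* (i ℤ.+ + 3 ℤ.* j)) (sym (square-∣∣ I)) (sym (square-∣∣ J))))
      (trans (rearrange I J) (trans (cong₂ (λ i j → + 5 ℤ.* i ℤ.* (i ℤ.+ + 3 ℤ.* j)) (square-∣∣ I) (square-∣∣ J)) (sym
              (fold-right a j))))))
  where
  a = ∣ I ∣ ℕ.* ∣ I ∣
  j = ∣ J ∣ ℕ.* ∣ J ∣
  inner : ∀ a j → + (a ℕ.+ 3 ℕ.* j) ≡ + a ℤ.+ + 3 ℤ.* + j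
  inner a j = trans (ℤₚ.pos-+ a (3 ℕ.* j)) (cong (λ t → + a ℤ.+ t) (ℤₚ.pos-* 3 j))
  fold-left : ∀ a j → + (f ℕ.+ j ℕ.* (a ℕ.+ 3 ℕ.* j)) ≡ + f ℤ.+ + j ℤ.* (+ a ℤ.+ + 3 ℤ.* + j)
  fold-left a j = trans (ℤₚ.pos-+ f _) (cong (λ t → + f ℤ.+ t) (trans (ℤₚ.pos-* j _) (cong (+ j ℤ.*_) (inner a j))))
  fold-right : ∀ a j → + (5 ℕ.* a ℕ.* (a ℕ.+ 3 ℕ.* j)) ≡ + 5 ℤ.* + a ℤ.* (+ a ℤ.+ + 3 ℤ.* + j)
  fold-right a j = trans (ℤₚ.pos-* (5 ℕ.* a) _) (cong₂ ℤ._*_ (ℤₚ.pos-* 5 a) (inner a j))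

square-of-quotient : ∀ F y r n c → r * (y * y) ≡ n → F * (y * y * (y * y)) ≡ c * (n * n) →
    y * y * (y * y) * (c * (r * r) - F) ≡ κ (+ 0)
square-of-quotient F y r n c h₁ h₂ = equal-up-to (zero-sum (multiple (c * (r * (y * y) + n)) h₁)
    (multiple (- κ (+ 1)) h₂)) (solve (F List.∷ y List.∷ r List.∷ n List.∷ c List.∷ List.[]) ringℚ)

homogeneous-product : ∀ N F H y a b → N * N ≡ F * H → a ≡ F * (y * y * (y * y)) → b ≡ H * (y * y * (y * y)) →
    N * (y * y * (y * y)) * (N * (y * y * (y * y))) ≡ a * b
homogeneous-product N F H y a b h₁ h₂ h₃ = equal-up-to (zero-sum (zero-sum
    (multiple (y * y * (y * y) * (y * y * (y * y))) h₁) (multiple (- b) h₂))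
    (multiple (- (F * (y * y * (y * y)))) h₃))
    (solve (N List.∷ F List.∷ H List.∷ y List.∷ a List.∷ b List.∷ List.[]) ringℚ)

coprime-parts : ∀ q → Coprime ∣ ↥ q ∣ (↧ₙ q)
coprime-parts (mkℚ _ _ c) = Coprimality.recompute c

denominator-nonzero : ∀ q → κ (↧ q) ≢ 0ℚ
denominator-nonzero q e = case κ-injective {↧ q} {+ 0} e of λ ()

-- The class 5 cannot be excluded by congruences: the points at infinity are defined over ℚ(√5).
twist : ∀ q N → N * N
    ≡ ((κ (+ 5) * q * q - κ (+ 1)) * (q * q + κ (+ 3))) * (κ (+ 5) * q * q * q * q - κ (+ 8) * q * q * q
    + κ (+ 6) * q * q + κ (+ 8) * q + κ (+ 5)) →
    ∃ λ r → r * r ≡ (κ (+ 5) * q * q - κ (+ 1)) * (q * q + κ (+ 3)) ⊎ κ (+ 5) * (r * r)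
    ≡ (κ (+ 5) * q * q - κ (+ 1)) * (q * q + κ (+ 3))
-- For q = I/J and y = J, the number N y⁴ is a rational square root of the integer
-- `form₁ I J ℤ.* form₂ I J`, which is thus a perfect square.
twist q N hN = go (form₂-nonnegative I J) (integer-square {N * (y * y * (y * y))} {form₁ I J ℤ.* form₂ I J}
    (trans (homogeneous-product N ((κ (+ 5) * q * q - κ (+ 1)) * (q * q + κ (+ 3)))
            (κ (+ 5) * q * q * q * q - κ (+ 8) * q * q * q + κ (+ 6) * q * q + κ (+ 8) * q + κ (+ 5)) y (κ
            (form₁ I J)) (κ (form₂ I J)) hN e₁ e₂) (sym (κ-* (form₁ I J) (form₂ I J)))))
  where
  I = ↥ q
  J = ↧ q
  y = κ J
  i : I ≐ q * y
  i = represents (sym (*-denominator q))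
  e₁ = κ-form₁ {I} {J} {q} {y} i (represents refl)
  e₂ = κ-form₂ {I} {J} {q} {y} i (represents refl)
  y⁴≢0 : y * y * (y * y) ≢ 0ℚ
  y⁴≢0 = nonzero-* (nonzero-* y≢0 y≢0) (nonzero-* y≢0 y≢0)
    where y≢0 = denominator-nonzero q
  finish : ∀ f → form₁ I J ≡ + f → Class f → ∃ λ r → r * r
      ≡ (κ (+ 5) * q * q - κ (+ 1)) * (q * q + κ (+ 3)) ⊎ κ (+ 5) * (r * r)
      ≡ (κ (+ 5) * q * q - κ (+ 1)) * (q * q + κ (+ 3))
  finish f f≡ (class c n c∈ e) = conclude c∈
    where
    quotient = divide (κ (+ n)) (y * y) (nonzero-* (denominator-nonzero q) (denominator-nonzero q))
    r = proj₁ quotient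
    scaled : (κ (+ 5) * q * q - κ (+ 1)) * (q * q + κ (+ 3)) * (y * y * (y * y)) ≡ κ (+ c) * (κ (+ n) * κ (+ n))
    scaled = trans (sym e₁) (trans (cong κ (trans f≡ (trans (cong +_ e) (trans (ℤₚ.pos-* c (n ℕ.* n)) (cong (+ c ℤ.*_)
            (ℤₚ.pos-* n n))))))
      (value (literal c ⟨*⟩ (literal n ⟨*⟩ literal n))))
    root : κ (+ c) * (r * r) ≡ (κ (+ 5) * q * q - κ (+ 1)) * (q * q + κ (+ 3))
    root = difference-zero (cancel-factor (y * y * (y * y)) (κ (+ c) * (r * r) - ((κ (+ 5) * q * q - κ (+ 1)) *
            (q * q + κ (+ 3)))) y⁴≢0
      (square-of-quotient ((κ (+ 5) * q * q - κ (+ 1)) * (q * q + κ (+ 3))) y r (κ (+ n)) (κ (+ c)) (proj₂ quotient) scaled))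
    excluded : c ≡ 2 ⊎ c ≡ 10 → ⊥
    excluded c∈ = even-class {∣ I ∣} {∣ J ∣} {n} c c∈ (coprime-parts q) (subst (λ f → f ℕ.+ ∣ J ∣ ℕ.* ∣ J ∣ ℕ.*
            (∣ I ∣ ℕ.* ∣ I ∣ ℕ.+ 3 ℕ.* (∣ J ∣ ℕ.* ∣ J ∣))
      ≡ 5 ℕ.* (∣ I ∣ ℕ.* ∣ I ∣) ℕ.* (∣ I ∣ ℕ.* ∣ I ∣ ℕ.+ 3 ℕ.* (∣ J ∣ ℕ.* ∣ J ∣))) e (natural-relation I J f f≡))
    conclude : c ≡ 1 ⊎ c ≡ 5 ⊎ c ≡ 2 ⊎ c ≡ 10 → ∃ λ r → r * r
        ≡ (κ (+ 5) * q * q - κ (+ 1)) * (q * q + κ (+ 3)) ⊎ κ (+ 5) * (r * r)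
        ≡ (κ (+ 5) * q * q - κ (+ 1)) * (q * q + κ (+ 3))
    conclude (inj₁ c≡1) = r , inj₁ (trans (sym (trans (cong (λ c → κ (+ c) * (r * r)) c≡1) (ℚₚ.*-identityˡ (r * r)))) root)
    conclude (inj₂ (inj₁ c≡5)) = r , inj₂ (trans (cong (λ c → κ (+ c) * (r * r)) (sym c≡5)) root)
    conclude (inj₂ (inj₂ c∈)) = ⊥-elim (excluded c∈)
  go : (∃ λ h → form₂ I J ≡ + h) → (∃ λ m → form₁ I J ℤ.* form₂ I J ≡ + (m ℕ.* m)) → ∃ λ r → r * r
      ≡ (κ (+ 5) * q * q - κ (+ 1)) * (q * q + κ (+ 3)) ⊎ κ (+ 5) * (r * r)
      ≡ (κ (+ 5) * q * q - κ (+ 1)) * (q * q + κ (+ 3))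
  go (h , h≡) (m , m≡) =
    let f , f≡ , fh = nonnegative-factor (form₁ I J) h (m ℕ.* m) h≢0 (trans (cong (form₁ I J ℤ.*_) (sym h≡)) m≡)
    in finish f f≡ (square-class {f} {h} {m} fh h≢0 (λ {g} {f₀} {h₀} f₀g h₀g → common-divisor∣1280 I J f₀ h₀ g
            (coprime-parts q) (trans f≡ (cong +_ f₀g)) (trans h≡ (cong +_ h₀g))))
    where
    h≢0 : h ≢ 0
    h≢0 h≡0 = nonzero-* (f₂-nonzero q) y⁴≢0 (trans (sym e₂) (cong κ (trans h≡ (cong +_ h≡0))))

-- Rational q, the fibres over ±1, and the theorem

nonreal-square : ∀ d x y F → x * x + d * (y * y) ≡ F → x ≡ κ (+ 0) → d * (y * y) ≡ F
nonreal-square d x y F h₁ h₂ = equal-up-to (zero-sum (multiple (κ (+ 1)) h₁) (multiple (- x) h₂))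
    (solve (d List.∷ x List.∷ y List.∷ F List.∷ List.[]) ringℚ)

real-square : ∀ d x y F → x * x + d * (y * y) ≡ F → y ≡ κ (+ 0) → x * x ≡ F
real-square d x y F h₁ h₂ = equal-up-to (zero-sum (multiple (κ (+ 1)) h₁) (multiple (- (d * y)) h₂))
    (solve (d List.∷ x List.∷ y List.∷ F List.∷ List.[]) ringℚ)

product-of-twists : ∀ d y z F H → d * (y * y) ≡ F → d * (z * z) ≡ H → d * y * z * (d * y * z) ≡ F * H
product-of-twists d y z F H h₁ h₂ = equal-up-to (zero-sum (multiple (d * (z * z)) h₁) (multiple (F) h₂))
    (solve (d List.∷ y List.∷ z List.∷ F List.∷ H List.∷ List.[]) ringℚ)

twisted-16 : ∀ d y t → t * y ≡ κ (+ 4) → d * (y * y) ≡ κ (+ 16) → y * y * (t * t - d) ≡ κ (+ 0)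
twisted-16 d y t h₁ h₂ = equal-up-to (zero-sum (multiple (t * y + κ (+ 4)) h₁) (multiple (- κ (+ 1)) h₂))
    (solve (d List.∷ y List.∷ t List.∷ List.[]) ringℚ)

difference-from-4 : ∀ x → x * x ≡ κ (+ 16) → (x - κ (+ 4)) * (x - - κ (+ 4)) ≡ κ (+ 0)
difference-from-4 x h₁ = equal-up-to (multiple (κ (+ 1)) h₁) (solve (x List.∷ List.[]) ringℚ)

values-over-±1 : ∀ {d} → NonSquare d → ∀ x y → x * x + d * (y * y) ≡ κ (+ 16) → κ (+ 2) * (x * y) ≡ κ (+ 0) → y
    ≡ 0ℚ × IsPM (κ (+ 4)) x
values-over-±1 {d} ns x y e e′ = case zero-product x y (cancel-factor (κ (+ 2)) (x * y) (λ ()) e′) of λ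
  { (inj₁ x≡0) → ⊥-elim (nonreal (nonreal-square d x y (κ (+ 16)) e x≡0))
  ; (inj₂ y≡0) → y≡0 , (case zero-product (x - κ (+ 4)) (x - - κ (+ 4)) (difference-from-4 x (real-square d x y
          (κ (+ 16)) e y≡0)) of λ
      { (inj₁ p) → inj₁ (difference-zero p) ; (inj₂ p) → inj₂ (difference-zero p) }) }
  where
  nonreal : d * (y * y) ≡ κ (+ 16) → ⊥
  nonreal h = ns t (difference-zero (cancel-factor (y * y) (t * t - d) (nonzero-* y≢0 y≢0) (twisted-16 d y t (proj₂ quotient) h)))
    where
    y≢0 : y ≢ 0ℚ
    y≢0 y≡0 = case trans (sym h) (trans (cong (λ y → d * (y * y)) y≡0) (ℚₚ.*-zeroʳ d)) of λ ()
    quotient = divide (κ (+ 4)) y y≢0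
    t = proj₁ quotient

rational-points : ∀ d a x y x′ y′ → x * x + d * (y * y) ≡ (κ (+ 5) * a * a - κ (+ 1)) * (a * a + κ (+ 3)) →
    κ (+ 2) * (x * y) ≡ κ (+ 0) → x′ * x′ + d * (y′ * y′)
    ≡ κ (+ 5) * a * a * a * a - κ (+ 8) * a * a * a + κ (+ 6) * a * a + κ (+ 8) * a + κ (+ 5) → κ (+ 2) * (x′ * y′)
    ≡ κ (+ 0) → IsPM (κ (+ 1)) a
rational-points d a x y x′ y′ e₁ i₁ e₂ i₂ =
  case zero-product x y (cancel-factor (κ (+ 2)) (x * y) (λ ()) i₁) of λ
  { (inj₂ y≡0) → E₁-points a x (real-square d x y ((κ (+ 5) * a * a - κ (+ 1)) * (a * a + κ (+ 3))) e₁ y≡0)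
  ; (inj₁ x≡0) → case zero-product x′ y′ (cancel-factor (κ (+ 2)) (x′ * y′) (λ ()) i₂) of λ
      { (inj₂ y′≡0) → E₂-points a x′ (real-square d x′ y′
              (κ (+ 5) * a * a * a * a - κ (+ 8) * a * a * a + κ (+ 6) * a * a + κ (+ 8) * a + κ (+ 5)) e₂ y′≡0)
      -- Both values are multiples of √d, so (dyy′)² = (dy²)(dy′²) = f₁f₂ supplies the rational
      -- square root required by `twist`.
      ; (inj₁ x′≡0) → case twist a (d * y * y′) (product-of-twists d y y′ ((κ (+ 5) * a * a - κ (+ 1)) *
              (a * a + κ (+ 3)))
              (κ (+ 5) * a * a * a * a - κ (+ 8) * a * a * a + κ (+ 6) * a * a + κ (+ 8) * a + κ (+ 5))
            (nonreal-square d x y ((κ (+ 5) * a * a - κ (+ 1)) * (a * a + κ (+ 3))) e₁ x≡0) (nonreal-square d x′ y′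
                    (κ (+ 5) * a * a * a * a - κ (+ 8) * a * a * a + κ (+ 6) * a * a + κ (+ 8) * a + κ (+ 5)) e₂ x′≡0)) of λ
          { (r , inj₁ e) → E₁-points a r e
          ; (r , inj₂ e) → ⊥-elim (E₁-twist-points a r e) } } }

embed-re₁ : ∀ d a x → x * x ≡ (κ (+ 5) * a * a - κ (+ 1)) * (a * a + κ (+ 3)) → x * x + d * (0ℚ * 0ℚ)
    ≡ ((κ (+ 5) * a + d * (0ℚ * 0ℚ)) * a + d * ((κ (+ 5) * 0ℚ + 0ℚ * a) * 0ℚ) - κ (+ 1)) * (a * a + d * (0ℚ * 0ℚ)
    + κ (+ 3)) + d * (((κ (+ 5) * a + d * (0ℚ * 0ℚ)) * 0ℚ
    + (κ (+ 5) * 0ℚ + 0ℚ * a) * a - 0ℚ) * (a * 0ℚ + 0ℚ * a + 0ℚ))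
embed-re₁ d a x h₁ = equal-up-to (multiple (κ (+ 1)) h₁) (solve (d List.∷ a List.∷ x List.∷ List.[]) ringℚ)

embed-im₁ : ∀ d a x → x * 0ℚ + 0ℚ * x
    ≡ ((κ (+ 5) * a + d * (0ℚ * 0ℚ)) * a + d * ((κ (+ 5) * 0ℚ + 0ℚ * a) * 0ℚ) - κ (+ 1)) * (a * 0ℚ + 0ℚ * a + 0ℚ)
    + ((κ (+ 5) * a + d * (0ℚ * 0ℚ)) * 0ℚ + (κ (+ 5) * 0ℚ + 0ℚ * a) * a - 0ℚ) * (a * a + d * (0ℚ * 0ℚ) + κ (+ 3))
embed-im₁ = solve-∀ ringℚ

embed-re₂ : ∀ d a x → x * x
    ≡ κ (+ 5) * a * a * a * a - κ (+ 8) * a * a * a + κ (+ 6) * a * a + κ (+ 8) * a + κ (+ 5) → x * x + d * (0ℚ * 0ℚ)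
    ≡ (((κ (+ 5) * a + d * (0ℚ * 0ℚ)) * a + d * ((κ (+ 5) * 0ℚ + 0ℚ * a) * 0ℚ)) * a + d * (((κ (+ 5) * a
    + d * (0ℚ * 0ℚ)) * 0ℚ + (κ (+ 5) * 0ℚ + 0ℚ * a) * a) * 0ℚ)) * a + d * ((((κ (+ 5) * a + d * (0ℚ * 0ℚ)) * a
    + d * ((κ (+ 5) * 0ℚ + 0ℚ * a) * 0ℚ)) * 0ℚ + ((κ (+ 5) * a + d * (0ℚ * 0ℚ)) * 0ℚ
    + (κ (+ 5) * 0ℚ + 0ℚ * a) * a) * a) * 0ℚ) - (((κ (+ 8) * a + d * (0ℚ * 0ℚ)) * a
    + d * ((κ (+ 8) * 0ℚ + 0ℚ * a) * 0ℚ)) * a + d * (((κ (+ 8) * a + d * (0ℚ * 0ℚ)) * 0ℚ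
    + (κ (+ 8) * 0ℚ + 0ℚ * a) * a) * 0ℚ)) + ((κ (+ 6) * a + d * (0ℚ * 0ℚ)) * a + d * ((κ (+ 6) * 0ℚ + 0ℚ * a) * 0ℚ))
    + (κ (+ 8) * a + d * (0ℚ * 0ℚ)) + κ (+ 5)
embed-re₂ d a x h₁ = equal-up-to (multiple (κ (+ 1)) h₁) (solve (d List.∷ a List.∷ x List.∷ List.[]) ringℚ)

embed-im₂ : ∀ d a x → x * 0ℚ + 0ℚ * x
    ≡ (((κ (+ 5) * a + d * (0ℚ * 0ℚ)) * a + d * ((κ (+ 5) * 0ℚ + 0ℚ * a) * 0ℚ)) * a + d * (((κ (+ 5) * a
    + d * (0ℚ * 0ℚ)) * 0ℚ + (κ (+ 5) * 0ℚ + 0ℚ * a) * a) * 0ℚ)) * 0ℚ + (((κ (+ 5) * a + d * (0ℚ * 0ℚ)) * a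
    + d * ((κ (+ 5) * 0ℚ + 0ℚ * a) * 0ℚ)) * 0ℚ + ((κ (+ 5) * a + d * (0ℚ * 0ℚ)) * 0ℚ
    + (κ (+ 5) * 0ℚ + 0ℚ * a) * a) * a) * a - (((κ (+ 8) * a + d * (0ℚ * 0ℚ)) * a
    + d * ((κ (+ 8) * 0ℚ + 0ℚ * a) * 0ℚ)) * 0ℚ + ((κ (+ 8) * a + d * (0ℚ * 0ℚ)) * 0ℚ
    + (κ (+ 8) * 0ℚ + 0ℚ * a) * a) * a) + ((κ (+ 6) * a + d * (0ℚ * 0ℚ)) * 0ℚ + (κ (+ 6) * 0ℚ + 0ℚ * a) * a)
    + (κ (+ 8) * 0ℚ + 0ℚ * a) + 0ℚ
embed-im₂ = solve-∀ ringℚ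

embedded : ∀ d a x z → x * x ≡ (κ (+ 5) * a * a - κ (+ 1)) * (a * a + κ (+ 3)) → z * z
    ≡ κ (+ 5) * a * a * a * a - κ (+ 8) * a * a * a + κ (+ 6) * a * a + κ (+ 8) * a + κ (+ 5) →
    OnY d (a +√ 0ℚ) (x +√ 0ℚ) (z +√ 0ℚ)
embedded d a x z e f = cong₂ _+√_ (embed-re₁ d a x e) (embed-im₁ d a x) , cong₂ _+√_ (embed-re₂ d a z f) (embed-im₂ d a z)

f₁-at-±1 : ∀ {a} → IsPM (κ (+ 1)) a → (κ (+ 5) * a * a - κ (+ 1)) * (a * a + κ (+ 3)) ≡ κ (+ 16)
f₁-at-±1 (inj₁ refl) = refl
f₁-at-±1 (inj₂ refl) = refl

f₂-at-±1 : ∀ {a} → IsPM (κ (+ 1)) a →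
    κ (+ 5) * a * a * a * a - κ (+ 8) * a * a * a + κ (+ 6) * a * a + κ (+ 8) * a + κ (+ 5) ≡ κ (+ 16)
f₂-at-±1 (inj₁ refl) = refl
f₂-at-±1 (inj₂ refl) = refl

square-of-±4 : ∀ {x} → IsPM (κ (+ 4)) x → x * x ≡ κ (+ 16)
square-of-±4 (inj₁ refl) = refl
square-of-±4 (inj₂ refl) = refl

theorem5p18 : (d : ℚ) → NonSquare d → (q y z : QF d) →
    OnY d q y z ⇔
    ((im q ≡ 0ℚ) × (im y ≡ 0ℚ) × (im z ≡ 0ℚ) × IsListedPoint (re q) (re y) (re z))
theorem5p18 d ns (a +√ b) (x +√ y) (x′ +√ y′) = mk⇔ to from
  where
  to : OnY d (a +√ b) (x +√ y) (x′ +√ y′) → (b ≡ 0ℚ) × (y ≡ 0ℚ) × (y′ ≡ 0ℚ) × IsListedPoint a x x′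
  to on = case b ℚₚ.≟ 0ℚ of λ
    { (no b≢0) → ⊥-elim (no-irrational {d} {a} {b} b≢0 ns (x +√ y) (x′ +√ y′) on)
    ; (yes b≡0) → rational b≡0 (subst (λ b → OnY d (a +√ b) (x +√ y) (x′ +√ y′)) b≡0 on) }
    where
    rational : b ≡ 0ℚ → OnY d (a +√ 0ℚ) (x +√ y) (x′ +√ y′) → (b ≡ 0ℚ) × (y ≡ 0ℚ) × (y′ ≡ 0ℚ) × IsListedPoint a x x′
    rational b≡0 (e , e′) =
      let r₁ = rational-real-part₁ d a x y (cong re e) ; i₁ = rational-imaginary-part₁ d a x y (cong im e)
          r₂ = rational-real-part₂ d a x′ y′ (cong re e′) ; i₂ = rational-imaginary-part₂ d a x′ y′ (cong im e′)
          a∈ = rational-points d a x y x′ y′ r₁ i₁ r₂ i₂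
          y≡0 , x∈ = values-over-±1 ns x y (trans r₁ (f₁-at-±1 a∈)) i₁
          y′≡0 , x′∈ = values-over-±1 ns x′ y′ (trans r₂ (f₂-at-±1 a∈)) i₂
      in b≡0 , y≡0 , y′≡0 , a∈ , x∈ , x′∈
  from : (b ≡ 0ℚ) × (y ≡ 0ℚ) × (y′ ≡ 0ℚ) × IsListedPoint a x x′ → OnY d (a +√ b) (x +√ y) (x′ +√ y′)
  from (refl , refl , refl , a∈ , x∈ , x′∈) = embedded d a x x′
    (trans (square-of-±4 x∈) (sym (f₁-at-±1 a∈))) (trans (square-of-±4 x′∈) (sym (f₂-at-±1 a∈)))
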